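{- Let $F$ and $G$ be 1-sorted species with $F$ strictly finite, and let $F\boxtimes G$ be their inner plethysm. Then $$Z_{F\boxtimes G}=Z_F\boxtimes Z_G,$$ where the $\boxtimes$ on the right-hand side is the inner plethysm of symmetric functions.
   Context: $\mathbb{B}$ is the category of finite sets and bijections. A (1-sorted) species is a functor $F:\mathbb{B}\to\mathbb{B}$; a 2-sorted species is a functor $\mathbb{B}^2\to\mathbb{B}$. Write $[n]=\{1,\dots,n\}$ and $F[n]=F[[n]]$; the symmetric group $\mathfrak{S}_n$ acts on $F[n]$ by $\sigma\cdot t=F[\sigma](t)$. $F$ is strictly finite if there is $N$ with $F[n]=\emptyset$ for all $n>N$. Cycle index: for a partition $\lambda\vdash n$, $\mathrm{fix}\,F[\lambda]$ is the number of fixed points of $F[\sigma]$ on $F[n]$ for any $\sigma\in\mathfrak{S}_n$ of cycle type $\lambda$, and $Z_F=\sum_\lambda \mathrm{fix}\,F[\lambda]\,\frac{p_\lambda}{z_\lambda}$ (sum over all partitions), where $p_\lambda$ are the power sum symmetric functions and $z_\lambda=\prod_i i^{m_i}m_i!$ for $\lambda=(1^{m_1}2^{m_2}\cdots)$. It is a symmetric function (with rational coefficients, possibly of unbounded degree). Inner plethysm of species: for a 1-sorted species $G$, $\Phi(G)$ is the 2-sorted species $\Phi(G)(X,Y)$ for which $\Phi(G)[U,V]$ is the set of all functions from $U$ to $G[V]$ (with transport $f\mapsto G[\sigma]\circ f\circ\beta^{ -1}$ along bijections $(\beta,\sigma)$). Then $F\boxtimes G=\langle F(X),\Phi(G)(X,Y)\rangle_X$,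 the scalar product in $X$; explicitly, $(F\boxtimes G)[V]=\sum_{n\ge 0}\bigl(F[n]\times\Phi(G)[[n],V]\bigr)/\mathfrak{S}_n$ (disjoint union of orbit sets), where $\mathfrak{S}_n$ acts by $\sigma\cdot(t,f)=(F[\sigma](t),f\circ\sigma^{ -1})$. Inner plethysm of symmetric functions: let $\mathrm{CF}(\mathfrak{S}_n)$ be the ring of complex class functions on $\mathfrak{S}_n$ with pointwise operations and Adams operations $(\psi^k c)(\sigma)=c(\sigma^k)$. For a symmetric function $f$ of bounded degree and $\chi\in\mathrm{CF}(\mathfrak{S}_n)$, $f[\chi]$ is obtained by writing $f$ as a polynomial in the $p_k$ and substituting $\psi^k(\chi)$ for $p_k$. If $g=\sum_{\mu\vdash n}\chi_\mu\frac{p_\mu}{z_\mu}$ is homogeneous of degree $n$, identify $g$ with the class function $\chi$ taking value $\chi_\mu$ on permutations of cycle type $\mu$, and put $f\boxtimes g=\sum_{\mu\vdash n}f[\chi](\sigma_\mu)\frac{p_\mu}{z_\mu}$, where $\sigma_\mu$ has cycle type $\mu$. For general $g=\sum_{n\ge 0}g_n$ with $g_n$ homogeneous of degree $n$, put $f\boxtimes g=\sum_{n\ge0}f\boxtimes g_n$ (every degree $n$ contributes, including those with $g_n=0$, for which $\chi=0\in\mathrm{CF}(\mathfrak{S}_n)$). -}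

module Defs where

open import Data.Bool.Base using (if_then_else_)
open import Data.Empty using (⊥-elim)
open import Data.Fin.Base using (Fin; zero; suc; fromℕ; toℕ; finToFun; funToFin; combine)
import Data.Fin.Properties as Fin
open import Data.Fin.Permutation as Perm
  using (Permutation′; _⟨$⟩ʳ_; _∘ₚ_; flip; insert; permutation)
open import Data.Integer.Base using (+_)
open import Data.List.Base
  using (List; []; _∷_; _++_; map; concatMap; replicate; upTo; allFin; lookup;
         cartesianProduct; deduplicate; length; filter; foldr)
open import Data.List.Membership.Propositional.Properties using (∈-upTo⁺; ∈-allFin; ∈-lookup)
open import Data.List.Relation.Unary.All as All using (All; []; _∷_)
import Data.List.Relation.Unary.All.Properties as All
open import Data.List.Relation.Unary.AllPairs using (AllPairs; []; _∷_)
import Data.List.Relation.Unary.AllPairs.Properties as AllPairs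
open import Data.List.Relation.Unary.Any as Any using (Any)
import Data.List.Relation.Unary.Any.Properties as Any
open import Data.List.Relation.Unary.Enumerates.Setoid using (IsEnumeration)
open import Data.List.Relation.Unary.Enumerates.Setoid.Properties using (deduplicate⁺)
open import Data.List.Relation.Unary.Unique.DecSetoid.Properties using (deduplicate-!)
open import Data.Nat.Base
  using (ℕ; zero; suc; _+_; _*_; _∸_; _^_; _!; _/_; _≤_; _≥_; _<_; NonZero; s≤s)
open import Data.Nat.ListAction using (sum; product)
open import Data.Nat.ListAction.Properties using (product≢0)
import Data.Nat.Properties as ℕ
open import Data.Product.Base using (Σ-syntax; ∃; _×_; _,_; proj₁; proj₂)
open import Data.Rational.Base as ℚ using (ℚ; 0ℚ; 1ℚ)
import Data.Rational.Properties as ℚ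
open import Data.Sum.Function.Propositional using (_⊎-↔_)
open import Function.Base using (_∘_)
open import Function.Bundles using (Inverse; Func; _↔_; mk⇔)
open import Function.Construct.Composition as Composition using (_↔-∘_)
import Function.Construct.Identity as Identity
open import Function.Construct.Symmetry as Symmetry using (↔-sym)
open import Function.Relation.Binary.Setoid.Equality using (_⇨_)
open import Level using (0ℓ)
open import Relation.Binary.Bundles using (Setoid; DecSetoid)
open import Relation.Binary.PropositionalEquality
  using (_≡_; _≢_; refl; cong; cong₂; sym; trans; setoid)
open import Relation.Nullary using (Dec; yes; no; does; ¬_)
open import Relation.Nullary.Decidable using (map′; _×-dec_; ¬?; does-⇔)
open import Relation.Unary using (Pred; Decidable)
import Algebra.Properties.CommutativeMonoid.Sum ℕ.+-0-commutativeMonoid as ℕ-Sum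

count : ∀ {n} {P : Pred (Fin n) 0ℓ} → Decidable P → ℕ
count P? = ℕ-Sum.sum (λ i → if does (P? i) then 1 else 0)

------------------------------------------------------------------------
-- The category 𝔹
--
-- Orbit sets occur as values of functors, so the objects are setoids.

record FinSet : Set₁ where
  field
    set  : Setoid 0ℓ 0ℓ
    size : ℕ
    enum : Inverse set (setoid (Fin size))
  open Setoid set public renaming (refl to ≈-refl; sym to ≈-sym; trans to ≈-trans)
  open Inverse enum public using () renaming
    ( to to index; from to element; to-cong to index-cong
    ; strictlyInverseˡ to index-element; strictlyInverseʳ to element-index )

  index-injective : ∀ {x y} → index x ≡ index y → x ≈ y
  index-injective {x} {y} eq =
    ≈-trans (≈-sym (element-index x)) (≈-trans (reflexive (cong element eq)) (element-index y))

  _≟_ : ∀ x y → Dec (x ≈ y)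
  x ≟ y = map′ index-injective index-cong (index x Fin.≟ index y)

  elements : List Carrier
  elements = map element (allFin size)

  elements-complete : IsEnumeration set elements
  elements-complete x =
    Any.map⁺ (Any.map (λ eq → ≈-trans (≈-sym (element-index x)) (reflexive (cong element eq)))
                      (∈-allFin (index x)))

open FinSet using (set) renaming (Carrier to ∣_∣)

infix 4 _≅_ _≋_
infixr 9 _∘ᴮ_

record _≅_ (A B : FinSet) : Set where
  constructor bij
  field bijection : Inverse (set A) (set B)
  open Inverse bijection public
    using (to; from; to-cong; from-cong; strictlyInverseˡ; strictlyInverseʳ)

open _≅_

_≋_ : ∀ {A B} → A ≅ B → A ≅ B → Set
_≋_ {A} {B} f g = ∀ x → FinSet._≈_ B (to f x) (to g x)

idᴮ : ∀ {A} → A ≅ A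
idᴮ {A} = bij (Identity.inverse (set A))

_∘ᴮ_ : ∀ {A B C} → B ≅ C → A ≅ B → A ≅ C
bij g ∘ᴮ bij f = bij (Composition.inverse f g)

_⁻¹ : ∀ {A B} → A ≅ B → B ≅ A
bij f ⁻¹ = bij (Symmetry.inverse f)

-- [ n ] is {0,…,n-1}; up to the wrapper bij its automorphisms are Permutation′ n.
[_] : ℕ → FinSet
[ n ] = record { set = setoid (Fin n) ; size = n ; enum = Identity.inverse (setoid (Fin n)) }

fixedPoints : ∀ {A} → A ≅ A → ℕ
fixedPoints {A} f = count (λ i → to f (element i) ≟ element i)
  where open FinSet A

count≡0 : ∀ {n} {P : Pred (Fin n) 0ℓ} (P? : Decidable P) → ¬ Fin n → count P? ≡ 0
count≡0 {zero}  P? ¬i = refl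
count≡0 {suc n} P? ¬i = ⊥-elim (¬i zero)

fixedPoints≡0 : ∀ {A} (f : A ≅ A) → ¬ ∣ A ∣ → fixedPoints f ≡ 0
fixedPoints≡0 {A} f ¬a = count≡0 (λ i → to f (element i) ≟ element i) (¬a ∘ element)
  where open FinSet A

-- The list xs may contain repetitions.
fromEnumeration : (D : DecSetoid 0ℓ 0ℓ) (xs : List (DecSetoid.Carrier D)) →
                  IsEnumeration (DecSetoid.setoid D) xs → FinSet
fromEnumeration D xs complete = record
  { set  = S
  ; size = length ys
  ; enum = record
    { to        = λ x → Any.index (complete′ x)
    ; from      = lookup ys
    ; to-cong   = λ {x} {y} x≈y → lookup-injective (deduplicate-! D xs)
        (S.trans (S.sym (at x)) (S.trans x≈y (at y)))
    ; from-cong = λ { refl → S.refl }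
    ; inverse   = (λ {i} {x} x≈ → lookup-injective (deduplicate-! D xs)
                      (S.trans (S.sym (at x)) x≈))
                , (λ { {x} refl → S.sym (at x) })
    }
  }
  where
  S = DecSetoid.setoid D
  module S = Setoid S
  ys = deduplicate (DecSetoid._≟_ D) xs

  complete′ : IsEnumeration S ys
  complete′ = deduplicate⁺ D complete

  at : ∀ x → x S.≈ lookup ys (Any.index (complete′ x))
  at x = Any.lookup-index (complete′ x)

  lookup-injective : ∀ {zs} → AllPairs (λ x y → ¬ x S.≈ y) zs →
                     ∀ {i j} → lookup zs i S.≈ lookup zs j → i ≡ j
  lookup-injective (_ ∷ _)  {zero}  {zero}  _  = refl
  lookup-injective (p ∷ _)  {zero}  {suc j} eq = ⊥-elim (All.lookup p (∈-lookup j) eq)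
  lookup-injective (p ∷ _)  {suc i} {zero}  eq = ⊥-elim (All.lookup p (∈-lookup i) (S.sym eq))
  lookup-injective (_ ∷ ps) {suc i} {suc j} eq = cong suc (lookup-injective ps eq)

------------------------------------------------------------------------
-- Species

record Species : Set₁ where
  field
    obj   : FinSet → FinSet
    hom   : ∀ {U V} → U ≅ V → obj U ≅ obj V
    resp  : ∀ {U V} {f g : U ≅ V} → f ≋ g → hom f ≋ hom g
    ident : ∀ {U} → hom (idᴮ {U}) ≋ idᴮ
    comp  : ∀ {U V W} (g : V ≅ W) (f : U ≅ V) → hom (g ∘ᴮ f) ≋ hom g ∘ᴮ hom f

record Species₂ : Set₁ where
  field
    obj   : FinSet → FinSet → FinSet
    hom   : ∀ {U U′ V V′} → U ≅ U′ → V ≅ V′ → obj U V ≅ obj U′ V′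
    resp  : ∀ {U U′ V V′} {β β′ : U ≅ U′} {σ σ′ : V ≅ V′} →
            β ≋ β′ → σ ≋ σ′ → hom β σ ≋ hom β′ σ′
    ident : ∀ {U V} → hom (idᴮ {U}) (idᴮ {V}) ≋ idᴮ
    comp  : ∀ {U U′ U″ V V′ V″} (β′ : U′ ≅ U″) (β : U ≅ U′) (σ′ : V′ ≅ V″) (σ : V ≅ V′) →
            hom (β′ ∘ᴮ β) (σ′ ∘ᴮ σ) ≋ hom β′ σ′ ∘ᴮ hom β σ

StrictlyFinite : Species → Set
StrictlyFinite F = ∃ λ N → ∀ n → N < n → ¬ ∣ Species.obj F [ n ] ∣

from-resp : ∀ {A B} {f g : A ≅ B} → f ≋ g → f ⁻¹ ≋ g ⁻¹
from-resp {A} {B} {f} {g} f≋g y = A.≈-trans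
  (A.≈-sym (strictlyInverseʳ g (from f y)))
  (from-cong g (B.≈-trans (B.≈-sym (f≋g (from f y))) (strictlyInverseˡ f y)))
  where
  module A = FinSet A
  module B = FinSet B

------------------------------------------------------------------------
-- The 2-sorted species Φ(G)

module _ (A B : FinSet) where
  private
    module A = FinSet A
    module B = FinSet B

  code : Func (set A) (set B) → Fin (B.size ^ A.size)
  code f = funToFin (λ i → B.index (Func.to f (A.element i)))

  decode : Fin (B.size ^ A.size) → Func (set A) (set B)
  decode k = record
    { to   = λ x → B.element (finToFun k (A.index x))
    ; cong = λ eq → B.reflexive (cong (B.element ∘ finToFun k) (A.index-cong eq))
    }

  funToFin-cong : ∀ {m n} {f g : Fin m → Fin n} → (∀ i → f i ≡ g i) → funToFin f ≡ funToFin g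
  funToFin-cong {zero}  _  = refl
  funToFin-cong {suc m} eq = cong₂ combine (eq zero) (funToFin-cong (eq ∘ suc))

  decode-code : ∀ f x → Func.to (decode (code f)) x B.≈ Func.to f x
  decode-code f x = B.≈-trans
    (B.reflexive (cong B.element (Fin.finToFun-funToFin _ (A.index x))))
    (B.≈-trans (B.element-index _) (Func.cong f (A.element-index x)))

  code-decode : ∀ k → code (decode k) ≡ k
  code-decode k = trans
    (funToFin-cong (λ i → trans (B.index-element _) (cong (finToFun k) (A.index-element i))))
    (Fin.funToFin-finToFin {A.size} {B.size} k)

  Functions : FinSet
  Functions = record
    { set  = set A ⇨ set B
    ; size = B.size ^ A.size
    ; enum = record
      { to        = code
      ; from      = decode
      ; to-cong   = λ {f} {g} → code-cong f g
      ; from-cong = λ { refl _ → B.≈-refl }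
      ; inverse   = (λ {k} {f} eq → trans (code-cong f (decode k) eq) (code-decode k))
                  , (λ { {f} refl → decode-code f })
      }
    }
    where
    code-cong : ∀ f g → (∀ x → Func.to f x B.≈ Func.to g x) → code f ≡ code g
    code-cong f g eq = funToFin-cong (λ i → B.index-cong (eq (A.element i)))

Φ : Species → Species₂
Φ G = record
  { obj   = λ U V → Functions U (G.obj V)
  ; hom   = λ {U} {U′} {V} {V′} β σ → bij (record
      { to        = transport β (G.hom σ)
      ; from      = transport (β ⁻¹) (G.hom σ ⁻¹)
      ; to-cong   = λ eq x → to-cong (G.hom σ) (eq (from β x))
      ; from-cong = λ eq x → from-cong (G.hom σ) (eq (to β x))
      ; inverse   =
          (λ {f} {g} eq x → FinSet.≈-trans (G.obj V′)
             (to-cong (G.hom σ) (eq (from β x)))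
             (FinSet.≈-trans (G.obj V′) (strictlyInverseˡ (G.hom σ) _)
               (Func.cong f (strictlyInverseˡ β x))))
        , (λ {f} {g} eq x → FinSet.≈-trans (G.obj V)
             (from-cong (G.hom σ) (eq (to β x)))
             (FinSet.≈-trans (G.obj V) (strictlyInverseʳ (G.hom σ) _)
               (Func.cong f (strictlyInverseʳ β x))))
      })
  ; resp  = λ {U} {U′} {V} {V′} {β} {β′} {σ} {σ′} β≋ σ≋ f x → FinSet.≈-trans (G.obj V′)
      (G.resp σ≋ _)
      (to-cong (G.hom σ′) (Func.cong f (from-resp {f = β} {g = β′} β≋ x)))
  ; ident = λ f x → G.ident _
  ; comp  = λ β′ β σ′ σ f x → G.comp σ′ σ _
  }
  where
  module G = Species G

  transport : ∀ {U U′ A A′} → U ≅ U′ → A ≅ A′ → Func (set U) (set A) → Func (set U′) (set A′)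
  transport β α f = record
    { to   = λ x → to α (Func.to f (from β x))
    ; cong = λ eq → to-cong α (Func.cong f (from-cong β eq))
    }

------------------------------------------------------------------------
-- The scalar product ⟨F(X), H(X,Y)⟩_X

anyBijection? : ∀ {n m} {P : [ n ] ≅ [ m ] → Set} → (∀ {σ τ} → σ ≋ τ → P σ → P τ) →
                Decidable P → Dec (∃ P)
anyBijection? {n} {m} {P} P-resp P? =
  map′ (λ { (_ , _ , l , r , p) → bij (permutation _ _ l r) , p })
       found
       (Fin.any? λ f → Fin.any? λ g → attempt (finToFun f) (finToFun g))
  where
  Attempt : (Fin n → Fin m) → (Fin m → Fin n) → Set
  Attempt f g = Σ[ l ∈ (∀ j → f (g j) ≡ j) ] Σ[ r ∈ (∀ i → g (f i) ≡ i) ]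
                P (bij (permutation f g l r))

  attempt : ∀ f g → Dec (Attempt f g)
  attempt f g with Fin.all? (λ j → f (g j) Fin.≟ j) | Fin.all? (λ i → g (f i) Fin.≟ i)
  ... | no ¬l | _     = no (¬l ∘ proj₁)
  ... | yes _ | no ¬r = no (¬r ∘ proj₁ ∘ proj₂)
  ... | yes l | yes r = map′ (λ p → l , r , p) (λ { (_ , _ , p) → P-resp (λ _ → refl) p }) (P? _)

  found : ∃ P → ∃ λ f → ∃ λ g → Attempt (finToFun {m} {n} f) (finToFun {n} {m} g)
  found (σ , p) = funToFin (to σ) , funToFin (from σ)
    , (λ j → trans (to≗ _) (trans (cong (to σ) (from≗ j)) (strictlyInverseˡ σ j)))
    , (λ i → trans (from≗ _) (trans (cong (from σ) (to≗ i)) (strictlyInverseʳ σ i)))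
    , P-resp (λ i → sym (to≗ i)) p
    where
    to≗   = Fin.finToFun-funToFin (to σ)
    from≗ = Fin.finToFun-funToFin (from σ)

module _ (F : Species) (H : Species₂) where
  private
    module F = Species F
    module H = Species₂ H

  Pairs : FinSet → ℕ → Set
  Pairs V n = ∣ F.obj [ n ] ∣ × ∣ H.obj [ n ] V ∣

  -- Bijections [ n ] ≅ [ m ] exist only for n = m, where they are the elements of 𝔖ₙ.
  -- So the classes of this relation are the 𝔖ₙ-orbits on F[n] × H[[n],V], for all n ≥ 0.
  SameOrbit : (V : FinSet) → ∃ (Pairs V) → ∃ (Pairs V) → Set
  SameOrbit V (n , t , h) (m , t′ , h′) = Σ[ σ ∈ [ n ] ≅ [ m ] ]
    FinSet._≈_ (F.obj [ m ]) (to (F.hom σ) t) t′ ×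
    FinSet._≈_ (H.obj [ m ] V) (to (H.hom σ (idᴮ {V})) h) h′

  private
    module Fm (m : ℕ) = FinSet (F.obj [ m ])
    module Hm (V : FinSet) (m : ℕ) = FinSet (H.obj [ m ] V)

  sameOrbit? : ∀ V x y → Dec (SameOrbit V x y)
  sameOrbit? V (n , t , h) (m , t′ , h′) = anyBijection?
    (λ {σ} {τ} σ≋τ → λ { (p , q) →
        Fm.≈-trans m (Fm.≈-sym m (F.resp {f = σ} {g = τ} σ≋τ t)) p
      , Hm.≈-trans V m (Hm.≈-sym V m (H.resp {β = σ} {τ} {idᴮ} {idᴮ} σ≋τ (λ _ → FinSet.≈-refl V) h)) q })
    (λ σ → Fm._≟_ m (to (F.hom σ) t) t′ ×-dec Hm._≟_ V m (to (H.hom σ idᴮ) h) h′)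

  Orbits : FinSet → DecSetoid 0ℓ 0ℓ
  Orbits V = record
    { Carrier = ∃ (Pairs V)
    ; _≈_ = SameOrbit V
    ; isDecEquivalence = record
      { isEquivalence = record
        { refl  = idᴮ , F.ident _ , H.ident _
        ; sym   = λ { {n , t , h} {m , t′ , h′} (σ , p , q) → σ ⁻¹
            , Fm.≈-trans n (to-cong (F.hom (σ ⁻¹)) (Fm.≈-sym m p))
                (Fm.≈-trans n (Fm.≈-sym n (F.comp (σ ⁻¹) σ t))
                  (Fm.≈-trans n (F.resp {f = σ ⁻¹ ∘ᴮ σ} {g = idᴮ} (strictlyInverseʳ σ) t)
                    (F.ident t)))
            , Hm.≈-trans V n (to-cong (H.hom (σ ⁻¹) idᴮ) (Hm.≈-sym V m q))
                (Hm.≈-trans V n (Hm.≈-sym V n (H.comp (σ ⁻¹) σ idᴮ idᴮ h))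
                  (Hm.≈-trans V n
                    (H.resp {β = σ ⁻¹ ∘ᴮ σ} {idᴮ} {idᴮ ∘ᴮ idᴮ} {idᴮ}
                      (strictlyInverseʳ σ) (λ _ → FinSet.≈-refl V) h)
                    (H.ident h))) }
        ; trans = λ { {n , t , h} {m , t′ , h′} {l , t″ , h″} (σ , p , q) (τ , p′ , q′) → τ ∘ᴮ σ
            , Fm.≈-trans l (F.comp τ σ t) (Fm.≈-trans l (to-cong (F.hom τ) p) p′)
            , Hm.≈-trans V l
                (H.resp {β = τ ∘ᴮ σ} {τ ∘ᴮ σ} {idᴮ} {idᴮ ∘ᴮ idᴮ}
                  (λ _ → refl) (λ _ → FinSet.≈-refl V) h)
                (Hm.≈-trans V l (H.comp τ σ idᴮ idᴮ h)
                  (Hm.≈-trans V l (to-cong (H.hom τ idᴮ) q) q′)) }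
        }
      ; _≟_ = sameOrbit? V
      }
    }

  module _ (fin : StrictlyFinite F) where
    private
      N = proj₁ fin

      representatives : ∀ V → List (∃ (Pairs V))
      representatives V = concatMap
        (λ n → map (n ,_) (cartesianProduct (Fm.elements n) (Hm.elements V n)))
        (upTo (suc N))

      n≤N : ∀ n → ∣ F.obj [ n ] ∣ → n ≤ N
      n≤N n t = ℕ.≮⇒≥ (λ N<n → proj₂ fin n N<n t)

      complete : ∀ V → IsEnumeration (DecSetoid.setoid (Orbits V)) (representatives V)
      complete V (n , t , h) = Any.concatMap⁺ _ (Any.map in-block (∈-upTo⁺ (s≤s (n≤N n t))))
        where
        in-block : ∀ {m} → n ≡ m → Any (SameOrbit V (n , t , h))
          (map (m ,_) (cartesianProduct (Fm.elements m) (Hm.elements V m)))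
        in-block refl = Any.map⁺ (Any.map
          (λ { (p , q) → idᴮ , Fm.≈-trans n (F.ident t) p , Hm.≈-trans V n (H.ident h) q })
          (Any.cartesianProduct⁺ (Fm.elements-complete n t) (Hm.elements-complete V n h)))

    scalarProduct : Species
    scalarProduct = record
      { obj   = λ V → fromEnumeration (Orbits V) (representatives V) (complete V)
      ; hom   = λ {V} {W} τ → bij (record
          { to        = act τ
          ; from      = act (τ ⁻¹)
          ; to-cong   = λ {x} {y} → act-cong τ {x} {y}
          ; from-cong = λ {x} {y} → act-cong (τ ⁻¹) {x} {y}
          ; inverse   =
              (λ {x} {y} e → DecSetoid.trans (Orbits W)
                {act τ y} {act τ (act (τ ⁻¹) x)} {x}
                (act-cong τ {y} {act (τ ⁻¹) x} e)
                (act-inverse τ (τ ⁻¹) (strictlyInverseˡ τ) x))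
            , (λ {x} {y} e → DecSetoid.trans (Orbits V)
                {act (τ ⁻¹) y} {act (τ ⁻¹) (act τ x)} {x}
                (act-cong (τ ⁻¹) {y} {act τ x} e)
                (act-inverse (τ ⁻¹) τ (strictlyInverseʳ τ) x))
          })
      ; resp  = λ {V} {W} {f} {g} f≋g → λ { (n , t , h) → pointwise W n t
          (H.resp {β = idᴮ} {idᴮ} {f} {g} (λ _ → refl) f≋g h) }
      ; ident = λ {V} → λ { (n , t , h) → pointwise V n t (H.ident h) }
      ; comp  = λ {U} {V} {W} g f → λ { (n , t , h) → pointwise W n t (Hm.≈-trans W n
          (H.resp {β = idᴮ} {idᴮ ∘ᴮ idᴮ} {g ∘ᴮ f} {g ∘ᴮ f}
            (λ _ → refl) (λ _ → FinSet.≈-refl W) h)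
          (H.comp idᴮ idᴮ g f h)) }
      }
      where
      act : ∀ {V W} → V ≅ W → ∃ (Pairs V) → ∃ (Pairs W)
      act τ (n , t , h) = n , t , to (H.hom idᴮ τ) h

      pointwise : ∀ V n t {h h′} → FinSet._≈_ (H.obj [ n ] V) h h′ →
                  SameOrbit V (n , t , h) (n , t , h′)
      pointwise V n t e = idᴮ , F.ident t , Hm.≈-trans V n (H.ident _) e

      act-cong : ∀ {V W} (τ : V ≅ W) {x y} → SameOrbit V x y → SameOrbit W (act τ x) (act τ y)
      act-cong {V} {W} τ {n , t , h} {m , t′ , h′} (σ , p , q) = σ , p
        , Hm.≈-trans W m (Hm.≈-sym W m (H.comp σ idᴮ idᴮ τ h))
            (Hm.≈-trans W m
              (H.resp {β = σ ∘ᴮ idᴮ} {idᴮ ∘ᴮ σ} {idᴮ ∘ᴮ τ} {τ ∘ᴮ idᴮ}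
                (λ _ → refl) (λ _ → FinSet.≈-refl W) h)
              (Hm.≈-trans W m (H.comp idᴮ σ τ idᴮ h) (to-cong (H.hom idᴮ τ) q)))

      act-inverse : ∀ {V W} (τ : V ≅ W) (τ′ : W ≅ V) → τ ∘ᴮ τ′ ≋ idᴮ →
                    ∀ x → SameOrbit W (act τ (act τ′ x)) x
      act-inverse {V} {W} τ τ′ e (n , t , h) = pointwise W n t (Hm.≈-trans W n
        (Hm.≈-sym W n (H.comp idᴮ idᴮ τ τ′ h))
        (Hm.≈-trans W n
          (H.resp {β = idᴮ ∘ᴮ idᴮ} {idᴮ} {τ ∘ᴮ τ′} {idᴮ} (λ _ → refl) e h)
          (H.ident h)))

infixl 7 _⊠[_]_

_⊠[_]_ : (F : Species) → StrictlyFinite F → Species → Species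
F ⊠[ fin ] G = scalarProduct F (Φ G) fin

------------------------------------------------------------------------
-- Partitions

record Partition : Set where
  constructor partition
  field
    parts       : List ℕ
    .positive   : All NonZero parts
    .decreasing : AllPairs _≥_ parts

  size : ℕ
  size = sum parts

record PartsUpTo (k : ℕ) : Set where
  constructor upTo≤
  field
    toPartition : Partition
    .bounded    : All (_≤ k) (Partition.parts toPartition)

empty : PartsUpTo 0
empty = upTo≤ (partition [] [] []) []

-- Adds j parts equal to k + 1.
addParts : ∀ k (j : ℕ) → PartsUpTo k → PartsUpTo (suc k)
addParts k j (upTo≤ (partition parts pos dec) bd) = upTo≤
  (partition (replicate j (suc k) ++ parts)
    (All.++⁺ (All.replicate⁺ j _) pos)
    (AllPairs.++⁺ (equal j) dec (All.replicate⁺ j (All.map ℕ.m≤n⇒m≤1+n bd))))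
  (All.++⁺ (All.replicate⁺ j ℕ.≤-refl) (All.map ℕ.m≤n⇒m≤1+n bd))
  where
  equal : ∀ j → AllPairs _≥_ (replicate j (suc k))
  equal zero    = []
  equal (suc j) = All.replicate⁺ j ℕ.≤-refl ∷ equal j

-- The partitions of n with all parts at most k; j is the number of parts equal to k.
partitionsUpTo : ∀ k → ℕ → List (PartsUpTo k)
partitionsUpTo zero    zero    = empty ∷ []
partitionsUpTo zero    (suc n) = []
partitionsUpTo (suc k) n       = concatMap
  (λ j → map (addParts k j) (partitionsUpTo k (n ∸ j * suc k)))
  (upTo (suc (n / suc k)))

partitions : ℕ → List Partition
partitions n = map PartsUpTo.toPartition (partitionsUpTo n n)

multiplicity : ℕ → Partition → ℕ
multiplicity i λs = length (filter (i ℕ.≟_) (Partition.parts λs))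

-- No part exceeds the size, so the factors with i > size λs would all be 1.
zFactors : Partition → List ℕ
zFactors λs = map (λ i → suc i ^ multiplicity (suc i) λs * (multiplicity (suc i) λs) !)
                  (upTo (Partition.size λs))

z : Partition → ℕ
z λs = product (zFactors λs)

z≢0 : ∀ λs → NonZero (z λs)
z≢0 λs = product≢0 (All.map⁺ (All.universal factor≢0 (upTo (Partition.size λs))))
  where
  factor≢0 : ∀ i → NonZero (suc i ^ multiplicity (suc i) λs * (multiplicity (suc i) λs) !)
  factor≢0 i = ℕ.m*n≢0 _ _ {{ℕ.m^n≢0 (suc i) m}} {{m ℕ.!≢0}}
    where m = multiplicity (suc i) λs

------------------------------------------------------------------------
-- Permutations and cycle types

infixl 10 _^ₚ_

_^ₚ_ : ∀ {n} → Permutation′ n → ℕ → Permutation′ n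
σ ^ₚ zero  = Perm.id
σ ^ₚ suc k = σ ∘ₚ σ ^ₚ k

-- _∘ₚ_ applies its left argument first, so this is τ σ τ⁻¹.
conjugate : ∀ {n} → Permutation′ n → Permutation′ n → Permutation′ n
conjugate τ σ = flip τ ∘ₚ σ ∘ₚ τ

_⊕_ : ∀ {m n} → Permutation′ m → Permutation′ n → Permutation′ (m + n)
σ ⊕ τ = ↔-sym Fin.+↔⊎ ↔-∘ ((σ ⊎-↔ τ) ↔-∘ Fin.+↔⊎)

-- The (k + 1)-cycle i ↦ i + 1, k ↦ 0.
rotation : ∀ k → Permutation′ (suc k)
rotation k = insert (fromℕ k) zero Perm.id

cycles : ∀ ks → Permutation′ (sum ks)
cycles []           = Perm.id
cycles (zero  ∷ ks) = cycles ks
cycles (suc k ∷ ks) = rotation k ⊕ cycles ks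

-- The representative σ_λ.  Counts and class functions do not depend on the choice of
-- a permutation of cycle type λ.
ofType : (λs : Partition) → Permutation′ (Partition.size λs)
ofType λs = cycles (Partition.parts λs)

-- The cycle of σ through x has length k + 1.
InCycle : ∀ {n} → Permutation′ n → ℕ → Pred (Fin n) 0ℓ
InCycle σ k x = (σ ^ₚ suc k ⟨$⟩ʳ x ≡ x) × (∀ (j : Fin k) → σ ^ₚ suc (toℕ j) ⟨$⟩ʳ x ≢ x)

inCycle? : ∀ {n} (σ : Permutation′ n) k → Decidable (InCycle σ k)
inCycle? σ k x = (_ Fin.≟ _) ×-dec Fin.all? (λ j → ¬? (_ Fin.≟ _))

-- The number of cycles of length k + 1, each of which has k + 1 points.
cycleCount : ∀ {n} → Permutation′ n → ℕ → ℕ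
cycleCount σ k = count (inCycle? σ k) / suc k

withMultiplicities : (ℕ → ℕ) → ∀ k → PartsUpTo k
withMultiplicities m zero    = empty
withMultiplicities m (suc k) = addParts k (m k) (withMultiplicities m k)

cycleType : ∀ {n} → Permutation′ n → Partition
cycleType {n} σ = PartsUpTo.toPartition (withMultiplicities (cycleCount σ) n)

^ₚ-cong : ∀ {n} {σ τ : Permutation′ n} → σ Perm.≈ τ → ∀ k → σ ^ₚ k Perm.≈ τ ^ₚ k
^ₚ-cong         σ≈τ zero    i = refl
^ₚ-cong {τ = τ} σ≈τ (suc k) i = trans (^ₚ-cong σ≈τ k _) (cong (τ ^ₚ k ⟨$⟩ʳ_) (σ≈τ i))

conjugate-^ₚ : ∀ {n} (τ σ : Permutation′ n) k → conjugate τ σ ^ₚ k Perm.≈ conjugate τ (σ ^ₚ k)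
conjugate-^ₚ τ σ zero    i = sym (Perm.inverseʳ τ)
conjugate-^ₚ τ σ (suc k) i = trans (conjugate-^ₚ τ σ k _)
  (cong (λ x → τ ⟨$⟩ʳ (σ ^ₚ k ⟨$⟩ʳ x)) (Perm.inverseˡ τ))

withMultiplicities-cong : ∀ {m m′} → (∀ i → m i ≡ m′ i) →
                          ∀ k → withMultiplicities m k ≡ withMultiplicities m′ k
withMultiplicities-cong eq zero    = refl
withMultiplicities-cong eq (suc k) =
  cong₂ (addParts k) (eq k) (withMultiplicities-cong eq k)

cycleType-intertwine : ∀ {n} (τ σ σ′ : Permutation′ n) →
  (∀ k x → σ′ ^ₚ k ⟨$⟩ʳ (τ ⟨$⟩ʳ x) ≡ τ ⟨$⟩ʳ (σ ^ₚ k ⟨$⟩ʳ x)) → cycleType σ′ ≡ cycleType σ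
cycleType-intertwine {n} τ σ σ′ comm =
  cong PartsUpTo.toPartition (withMultiplicities-cong (λ k → cong (_/ suc k) (counts k)) n)
  where
  τ-injective : ∀ {x y} → τ ⟨$⟩ʳ x ≡ τ ⟨$⟩ʳ y → x ≡ y
  τ-injective eq = trans (sym (Perm.inverseˡ τ)) (trans (cong (Inverse.from τ) eq) (Perm.inverseˡ τ))

  there : ∀ {k x} → InCycle σ′ k (τ ⟨$⟩ʳ x) → InCycle σ k x
  there {k} {x} (p , q) = τ-injective (trans (sym (comm (suc k) x)) p)
    , λ j e → q j (trans (comm (suc (toℕ j)) x) (cong (τ ⟨$⟩ʳ_) e))

  back : ∀ {k x} → InCycle σ k x → InCycle σ′ k (τ ⟨$⟩ʳ x)
  back {k} {x} (p , q) = trans (comm (suc k) x) (cong (τ ⟨$⟩ʳ_) p)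
    , λ j e → q j (τ-injective (trans (sym (comm (suc (toℕ j)) x)) e))

  counts : ∀ k → count (inCycle? σ′ k) ≡ count (inCycle? σ k)
  counts k = trans (ℕ-Sum.sum-permute _ τ) (ℕ-Sum.sum-cong-≗ λ x → cong (λ b → if b then 1 else 0)
    (does-⇔ (mk⇔ there back) (inCycle? σ′ k (τ ⟨$⟩ʳ x)) (inCycle? σ k x)))

------------------------------------------------------------------------
-- Class functions
--
-- Rational values suffice, since symmetric functions here have rational coefficients.

record CF (n : ℕ) : Set where
  field
    value     : Permutation′ n → ℚ
    resp      : ∀ {σ τ} → σ Perm.≈ τ → value σ ≡ value τ
    invariant : ∀ τ σ → value (conjugate τ σ) ≡ value σ

open CF

constᶜ : ∀ {n} → ℚ → CF n
constᶜ a = record { value = λ _ → a ; resp = λ _ → refl ; invariant = λ _ _ → refl }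

_+ᶜ_ _*ᶜ_ : ∀ {n} → CF n → CF n → CF n
c +ᶜ d = record
  { value     = λ σ → value c σ ℚ.+ value d σ
  ; resp      = λ e → cong₂ ℚ._+_ (resp c e) (resp d e)
  ; invariant = λ τ σ → cong₂ ℚ._+_ (invariant c τ σ) (invariant d τ σ)
  }
c *ᶜ d = record
  { value     = λ σ → value c σ ℚ.* value d σ
  ; resp      = λ e → cong₂ ℚ._*_ (resp c e) (resp d e)
  ; invariant = λ τ σ → cong₂ ℚ._*_ (invariant c τ σ) (invariant d τ σ)
  }

sumᶜ productᶜ : ∀ {n} → List (CF n) → CF n
sumᶜ     = foldr _+ᶜ_ (constᶜ 0ℚ)
productᶜ = foldr _*ᶜ_ (constᶜ 1ℚ)

ψ : ∀ {n} → ℕ → CF n → CF n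
ψ k c = record
  { value     = λ σ → value c (σ ^ₚ k)
  ; resp      = λ e → resp c (^ₚ-cong e k)
  ; invariant = λ τ σ → trans (resp c (conjugate-^ₚ τ σ k)) (invariant c τ (σ ^ₚ k))
  }

------------------------------------------------------------------------
-- Symmetric functions
--
-- Over ℚ the power sums p₁, p₂, … are algebraically independent generators of the
-- ring of symmetric functions.  So a symmetric function of possibly unbounded degree
-- is a formal series ∑_λ a_λ p_λ, stored as the family of its coefficients a_λ; it is a
-- polynomial in the p_k exactly when its degree is bounded.

SymmetricFunction : Set
SymmetricFunction = Partition → ℚ

infix 4 _≈ˢ_

_≈ˢ_ : SymmetricFunction → SymmetricFunction → Set
f ≈ˢ g = ∀ λs → f λs ≡ g λs

BoundedDegree : SymmetricFunction → Set
BoundedDegree f = ∃ λ N → ∀ λs → N < Partition.size λs → f λs ≡ 0ℚ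

-- The class function χ with g_n = ∑_{μ ⊢ n} χ_μ p_μ / z_μ.
classFunction : SymmetricFunction → ∀ n → CF n
classFunction g n = record
  { value     = χ ∘ cycleType
  ; resp      = λ {σ} {τ} e → cong χ (sym (cycleType-intertwine Perm.id σ τ
      (λ k x → sym (^ₚ-cong e k x))))
  ; invariant = λ τ σ → cong χ (cycleType-intertwine τ σ (conjugate τ σ)
      (λ k x → trans (conjugate-^ₚ τ σ k (τ ⟨$⟩ʳ x))
        (cong (λ y → τ ⟨$⟩ʳ (σ ^ₚ k ⟨$⟩ʳ y)) (Perm.inverseˡ τ))))
  }
  where
  χ : Partition → ℚ
  χ μ = g μ ℚ.* (+ z μ ℚ./ 1)

-- p_λ[χ] = ∏ᵢ ψ^{λᵢ}(χ).
powerSum : ∀ {n} → Partition → CF n → CF n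
powerSum λs χ = productᶜ (map (λ k → ψ k χ) (Partition.parts λs))

-- f[χ] = ∑_λ a_λ p_λ[χ].  Beyond the bound all a_λ vanish, so its choice is irrelevant.
_[_]⟨_⟩ : ∀ {n} (f : SymmetricFunction) → BoundedDegree f → CF n → CF n
f [ (N , _) ]⟨ χ ⟩ =
  sumᶜ (map (λ λs → constᶜ (f λs) *ᶜ powerSum λs χ) (concatMap partitions (upTo (suc N))))

infixl 7 _⊠ˢ[_]_

-- The coefficient of p_μ in ∑_n f ⊠ g_n comes from the single summand n = size μ.
_⊠ˢ[_]_ : (f : SymmetricFunction) → BoundedDegree f → SymmetricFunction → SymmetricFunction
(f ⊠ˢ[ b ] g) μ =
  value (f [ b ]⟨ classFunction g (Partition.size μ) ⟩) (ofType μ) ℚ.* (ℚ._/_ (+ 1) (z μ) {{z≢0 μ}})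

------------------------------------------------------------------------
-- Cycle index

fix : Species → Partition → ℕ
fix F λs = fixedPoints (Species.hom F {[ n ]} {[ n ]} (bij (ofType λs)))
  where n = Partition.size λs

Z : Species → SymmetricFunction
Z F λs = ℚ._/_ (+ fix F λs) (z λs) {{z≢0 λs}}

Z-bounded : (F : Species) → StrictlyFinite F → BoundedDegree (Z F)
Z-bounded F (N , empty-above) = N , λ λs N<n →
  trans (cong (λ k → ℚ._/_ (+ k) (z λs) {{z≢0 λs}}) (fix≡0 λs N<n)) (ℚ.0/n≡0 (z λs) {{z≢0 λs}})
  where
  fix≡0 : ∀ λs → N < Partition.size λs → fix F λs ≡ 0
  fix≡0 λs N<n = fixedPoints≡0 (Species.hom F {[ n ]} {[ n ]} (bij (ofType λs))) (empty-above n N<n)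
    where n = Partition.size λs

{-# OPTIONS --safe #-}

-- Let τ ∈ 𝔖ₘ.  By Burnside's counting argument, the number of 𝔖ₙ-orbits of pairs (t , f)
-- fixed by τ is the average over σ ∈ 𝔖ₙ of the number of pairs with σ · (t , τ f) = (t , f),
-- which is fix F[σ] times the number of functions f with G[τ] ∘ f = f ∘ σ.  Such an f is
-- given on each k-cycle of σ by one fixed point of G[τ]ᵏ, so there are ∏ fix G[τᵏ] of them,
-- the product being over the cycles of σ; this is p_λ[χ](τ) for λ the cycle type of σ.
-- It remains to replace the average over 𝔖ₙ by the sum over λ ⊢ n with weights 1 / z_λ.
-- Both sides obey the recursion in n that arises from inserting a new point into a
-- permutation: either it becomes a fixed point, or it makes one of the cycles, say of length
-- k, longer by one, and this in k ways.
module Submission where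

open import Defs

open import Data.Bool.Base using (true; false; if_then_else_)
open import Data.Fin.Base as Fin
  using (Fin; zero; suc; toℕ; fromℕ; fromℕ<; inject₁; punchIn; combine; remQuot; splitAt; _↑ˡ_; _↑ʳ_)
open import Data.Fin.Induction using (<-weakInduction)
open import Data.Fin.Permutation as Perm
  using (Permutation; Permutation′; _⟨$⟩ʳ_; _⟨$⟩ˡ_; _∘ₚ_; flip; permutation; lift₀; transpose; remove)
import Data.Fin.Permutation.Components as PC
import Data.Fin.Properties as Fin
import Data.Integer.Base as ℤ
import Data.Integer.Properties as ℤ
open import Data.List.Base
  using (List; []; _∷_; _∷ʳ_; _++_; map; replicate; concatMap; upTo; applyUpTo; length; filter)
import Data.List.Properties as List
open import Data.List.Relation.Binary.Permutation.Propositional as ↭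
  using (_↭_; ↭-refl; ↭-trans; ↭-reflexive)
import Data.List.Relation.Binary.Permutation.Propositional.Properties as ↭
open import Data.List.Relation.Unary.All as All using (All; []; _∷_)
import Data.List.Relation.Unary.All.Properties as All
open import Data.Nat.Base as ℕ
  using (ℕ; zero; suc; _∸_; _/_; _^_; _!; _<_; _≤_; NonZero; z≤n; s≤s; s≤s⁻¹)
import Data.Nat.DivMod as ℕ
open import Data.Nat.ListAction using (sum; product)
open import Data.Nat.ListAction.Properties using (product-++)
import Data.Nat.Properties as ℕ
open import Data.Nat.Tactic.RingSolver using (solve-∀)
open import Data.Product.Base using (∃; _×_; _,_; proj₁; proj₂)
open import Data.Product.Relation.Binary.Pointwise.NonDependent using (×-setoid)
open import Data.Rational.Base as ℚ using (ℚ; 0ℚ; 1ℚ; _+_; _*_; fromℚᵘ)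
import Data.Rational.Properties as ℚ
open import Data.Rational.Solver using (module +-*-Solver)
open import Data.Rational.Unnormalised.Base as ℚᵘ using (mkℚᵘ; *≡*)
import Data.Rational.Unnormalised.Properties as ℚᵘ
open import Data.Sum.Base using (_⊎_; inj₁; inj₂; [_,_]′)
open import Data.Sum.Function.Propositional using (_⊎-↔_)
open import Function.Base using (_∘_)
open import Function.Bundles using (Func; Inverse; mk⇔)
open import Function.Construct.Composition as Composition using (_↔-∘_)
open import Function.Construct.Symmetry using (↔-sym)
open import Level using (0ℓ)
open import Relation.Binary.Bundles using (Setoid)
open import Relation.Binary.Definitions using (tri<; tri≈; tri>)
open import Relation.Binary.PropositionalEquality
  using (_≡_; _≢_; refl; sym; trans; cong; cong₂; subst; setoid; module ≡-Reasoning)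
open import Relation.Nullary using (Dec; yes; no; does; ¬_; contradiction)
open import Relation.Nullary.Decidable using (_×-dec_; dec-true; dec-false; does-⇔; recompute)
open import Relation.Unary using (Pred; Decidable)
open import Algebra.Properties.AbelianGroup ℚ.+-0-abelianGroup using ()
  renaming (∙-cancelʳ to +-cancelʳ)
import Algebra.Properties.Semiring.Sum ℕ.+-*-semiring as Σℕ

open +-*-Solver using (solve; _:+_; _:*_; _:=_; con)
open FinSet using () renaming (Carrier to ∣_∣)
open _≅_
open Partition using (parts)
open CF using (value)

-- Sums over finite sets

-- The insertion recursion stands in for counting conjugacy classes. On the side of permutations it
-- is a bijection between 𝔖ₙ₊₁ and the product of n + 1 points with 𝔖ₙ. The side of partitions is
-- harder: insertion enlarges an arbitrary part, whereas partitions are enumerated by the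
-- multiplicity of the largest part. The bridge is the derivation x d/dx on generating series: the
-- factor n on the coefficient of xⁿ distributes over the parts of λ, each part k removed with
-- weight k. Applied twice in degree n + 1 and once in degree n, it reduces the recursion to lower
-- degrees, at the price of a factor n that has to be cancelled. A second obstacle is that class
-- functions read a cycle type obtained by counting points, while `fix` is evaluated at the
-- representative `ofType`. So each σ must be shown conjugate to `ofType (cycleType σ)`; the
-- decomposition into cycles that this requires comes from the same insertion of points.

⟦_⟧ : ∀ {m n} → Permutation m n → [ m ] ≅ [ n ]
⟦ σ ⟧ = bij σ

𝟙 : ∀ {P : Set} → Dec P → ℕ
𝟙 P? = if does P? then 1 else 0

𝟙-cong : ∀ {P Q : Set} (P? : Dec P) (Q? : Dec Q) → (P → Q) → (Q → P) → 𝟙 P? ≡ 𝟙 Q?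
𝟙-cong P? Q? f g = cong (λ b → if b then 1 else 0) (does-⇔ (mk⇔ f g) P? Q?)

𝟙-true : ∀ {P : Set} (P? : Dec P) → P → 𝟙 P? ≡ 1
𝟙-true P? p = cong (λ b → if b then 1 else 0) (dec-true P? p)

𝟙-false : ∀ {P : Set} (P? : Dec P) → ¬ P → 𝟙 P? ≡ 0
𝟙-false P? ¬p = cong (λ b → if b then 1 else 0) (dec-false P? ¬p)

𝟙-× : ∀ {P Q : Set} (P? : Dec P) (Q? : Dec Q) → 𝟙 (P? ×-dec Q?) ≡ 𝟙 P? ℕ.* 𝟙 Q?
𝟙-× P? Q? with does P?
... | true  = sym (ℕ.+-identityʳ _)
... | false = refl

sum-δ : ∀ {n} (j : Fin n) (f : Fin n → ℕ) → Σℕ.sum (λ i → 𝟙 (i Fin.≟ j) ℕ.* f i) ≡ f j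
sum-δ {suc n} zero f = trans
  (cong₂ ℕ._+_ (ℕ.+-identityʳ (f zero)) (Σℕ.sum-replicate-zero n)) (ℕ.+-identityʳ (f zero))
sum-δ {suc n} (suc j) f = trans
  (Σℕ.sum-cong-≗ {n} λ i → cong (ℕ._* f (suc i))
    (𝟙-cong (suc i Fin.≟ suc j) (i Fin.≟ j) Fin.suc-injective (cong suc)))
  (sum-δ j (f ∘ suc))

sum-++ : ∀ m {n} (f : Fin (m ℕ.+ n) → ℕ) →
         Σℕ.sum f ≡ Σℕ.sum (λ i → f (i ↑ˡ n)) ℕ.+ Σℕ.sum (λ j → f (m ↑ʳ j))
sum-++ zero    f = refl
sum-++ (suc m) f = trans (cong (f zero ℕ.+_) (sum-++ m (f ∘ suc))) (sym (ℕ.+-assoc (f zero) _ _))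

sum-combine : ∀ m {n} (f : Fin (m ℕ.* n) → ℕ) →
              Σℕ.sum f ≡ Σℕ.sum {m} (λ i → Σℕ.sum {n} (λ j → f (combine i j)))
sum-combine zero        f = refl
sum-combine (suc m) {n} f = trans (sum-++ n f)
  (cong (Σℕ.sum (λ j → f (j ↑ˡ m ℕ.* n)) ℕ.+_) (sum-combine m {n} (λ k → f (n ↑ʳ k))))

-- A sum only visits the enumerated elements, so its summand may be any function. Reindexing along a
-- bijection carries enumerated elements to merely equivalent ones, and there this condition enters.
Resp : (A : FinSet) → (∣ A ∣ → ℕ) → Set
Resp A f = ∀ {x y} → FinSet._≈_ A x y → f x ≡ f y

-- Opaque so that the summand can be inferred from a sum.
opaque
  ∑ : (A : FinSet) → (∣ A ∣ → ℕ) → ℕ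
  ∑ A f = Σℕ.sum (λ i → f (FinSet.element A i))

  fixedPoints≡∑ : ∀ {A} (f : A ≅ A) → fixedPoints f ≡ ∑ A (λ x → 𝟙 (FinSet._≟_ A (to f x) x))
  fixedPoints≡∑ f = refl

  ∑-Fin : ∀ n (f : Fin n → ℕ) → ∑ [ n ] f ≡ Σℕ.sum f
  ∑-Fin n f = refl

  ∑-suc : ∀ n (f : Fin (suc n) → ℕ) → ∑ [ suc n ] f ≡ f zero ℕ.+ ∑ [ n ] (f ∘ suc)
  ∑-suc n f = refl

  ∑-++ : ∀ m n (f : Fin (m ℕ.+ n) → ℕ) →
         ∑ [ m ℕ.+ n ] f ≡ ∑ [ m ] (λ i → f (i ↑ˡ n)) ℕ.+ ∑ [ n ] (λ j → f (m ↑ʳ j))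
  ∑-++ m n f = sum-++ m f

  ∑-cong : ∀ A {f g : ∣ A ∣ → ℕ} → (∀ x → f x ≡ g x) → ∑ A f ≡ ∑ A g
  ∑-cong A eq = Σℕ.sum-cong-≗ (λ i → eq (FinSet.element A i))

  ∑-comm : ∀ A B (f : ∣ A ∣ → ∣ B ∣ → ℕ) →
           ∑ A (λ x → ∑ B (f x)) ≡ ∑ B (λ y → ∑ A (λ x → f x y))
  ∑-comm A B f = Σℕ.∑-comm (λ i j → f (FinSet.element A i) (FinSet.element B j))

  ∑-*ˡ : ∀ A c (f : ∣ A ∣ → ℕ) → c ℕ.* ∑ A f ≡ ∑ A (λ x → c ℕ.* f x)
  ∑-*ˡ A c f = Σℕ.*-distribˡ-sum c (λ i → f (FinSet.element A i))

  ∑-*ʳ : ∀ A c (f : ∣ A ∣ → ℕ) → ∑ A f ℕ.* c ≡ ∑ A (λ x → f x ℕ.* c)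
  ∑-*ʳ A c f = Σℕ.*-distribʳ-sum c (λ i → f (FinSet.element A i))

  ∑-0 : ∀ A → ∑ A (λ _ → 0) ≡ 0
  ∑-0 A = Σℕ.sum-replicate-zero (FinSet.size A)

  ∑-1 : ∀ A → ∑ A (λ _ → 1) ≡ FinSet.size A
  ∑-1 A = go (FinSet.size A)
    where
    go : ∀ n → Σℕ.sum {n} (λ _ → 1) ≡ n
    go zero    = refl
    go (suc n) = cong suc (go n)

  ∑-δ : ∀ A (y : ∣ A ∣) → ∑ A (λ x → 𝟙 (FinSet._≟_ A x y)) ≡ 1
  ∑-δ A y = trans
    (Σℕ.sum-cong-≗ λ i → trans
      (𝟙-cong (A.element i A.≟ y) (i Fin.≟ A.index y)
        (λ e → trans (sym (A.index-element i)) (A.index-cong e))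
        (λ e → A.index-injective (trans (A.index-element i) e)))
      (sym (ℕ.*-identityʳ _)))
    (sum-δ (A.index y) (λ _ → 1))
    where module A = FinSet A

  ∑-≅ : ∀ {A B} (φ : A ≅ B) (f : ∣ B ∣ → ℕ) → Resp B f → ∑ A (λ x → f (to φ x)) ≡ ∑ B f
  ∑-≅ {A} {B} φ f f-resp = sym (trans
    (Σℕ.sum-permute (f ∘ B.element) π)
    (Σℕ.sum-cong-≗ {A.size} λ i → f-resp (B.element-index (to φ (A.element i)))))
    where
    module A = FinSet A
    module B = FinSet B
    π : Permutation A.size B.size
    π = permutation (B.index ∘ to φ ∘ A.element) (A.index ∘ from φ ∘ B.element)
      (λ j → trans (B.index-cong (B.≈-trans (to-cong φ (A.element-index _)) (strictlyInverseˡ φ _)))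
               (B.index-element j))
      (λ i → trans (A.index-cong (A.≈-trans (from-cong φ (B.element-index _)) (strictlyInverseʳ φ _)))
               (A.index-element i))

-- f and g are inverse bijections between the subsets P and Q only.
∑-partial-bijection : ∀ A B {P : Pred ∣ A ∣ 0ℓ} {Q : Pred ∣ B ∣ 0ℓ}
  (P? : Decidable P) (Q? : Decidable Q) (f : ∣ A ∣ → ∣ B ∣) (g : ∣ B ∣ → ∣ A ∣) →
  (∀ {x} → P x → ∀ {y} → FinSet._≈_ B y (f x) → Q y × FinSet._≈_ A x (g y)) →
  (∀ {y} → Q y → ∀ {x} → FinSet._≈_ A x (g y) → P x × FinSet._≈_ B y (f x)) →
  ∑ A (λ x → 𝟙 (P? x)) ≡ ∑ B (λ y → 𝟙 (Q? y))
∑-partial-bijection A B P? Q? f g there back = begin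
  ∑ A (λ x → 𝟙 (P? x))
    ≡⟨ ∑-cong A (λ x → expand B (P? x) (f x)) ⟩
  ∑ A (λ x → ∑ B (λ y → 𝟙 (P? x ×-dec (y B.≟ f x))))
    ≡⟨ ∑-comm A B _ ⟩
  ∑ B (λ y → ∑ A (λ x → 𝟙 (P? x ×-dec (y B.≟ f x))))
    -- Both sums count one graph: the pairs with `P x` and `y` equal to `f x` are those with `Q y`
    -- and `x` equal to `g y`. The hypotheses speak of everything equivalent to `f x` or `g y`, so
    -- they apply to each such pair directly.
    ≡⟨ ∑-cong B (λ y → ∑-cong A λ x → 𝟙-cong (P? x ×-dec (y B.≟ f x)) (Q? y ×-dec (x A.≟ g y))
         (λ (p , e) → there p e) (λ (q , e) → back q e)) ⟩
  ∑ B (λ y → ∑ A (λ x → 𝟙 (Q? y ×-dec (x A.≟ g y))))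
    ≡⟨ ∑-cong B (λ y → expand A (Q? y) (g y)) ⟨
  ∑ B (λ y → 𝟙 (Q? y)) ∎
  where
  open ≡-Reasoning
  module A = FinSet A
  module B = FinSet B
  expand : ∀ C {R : Set} (R? : Dec R) z → 𝟙 R? ≡ ∑ C (λ y → 𝟙 (R? ×-dec FinSet._≟_ C y z))
  expand C R? z = begin
    𝟙 R?                                       ≡⟨ ℕ.*-identityʳ (𝟙 R?) ⟨
    𝟙 R? ℕ.* 1                                   ≡⟨ cong (𝟙 R? ℕ.*_) (∑-δ C z) ⟨
    𝟙 R? ℕ.* ∑ C (λ y → 𝟙 (FinSet._≟_ C y z))    ≡⟨ ∑-*ˡ C (𝟙 R?) _ ⟩
    ∑ C (λ y → 𝟙 R? ℕ.* 𝟙 (FinSet._≟_ C y z))    ≡⟨ ∑-cong C (λ y → 𝟙-× R? (FinSet._≟_ C y z)) ⟨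
    ∑ C (λ y → 𝟙 (R? ×-dec FinSet._≟_ C y z))  ∎

fixedPoints-cong : ∀ {A} {f g : A ≅ A} → f ≋ g → fixedPoints f ≡ fixedPoints g
fixedPoints-cong {A} {f} {g} f≋g = begin
  fixedPoints f                   ≡⟨ fixedPoints≡∑ f ⟩
  ∑ A (λ x → 𝟙 (to f x A.≟ x))    ≡⟨ ∑-cong A (λ x → 𝟙-cong (to f x A.≟ x) (to g x A.≟ x)
                                       (A.≈-trans (A.≈-sym (f≋g x))) (A.≈-trans (f≋g x))) ⟩
  ∑ A (λ x → 𝟙 (to g x A.≟ x))    ≡⟨ fixedPoints≡∑ g ⟨
  fixedPoints g                   ∎
  where
  open ≡-Reasoning
  module A = FinSet A

fixedPoints-conjugate : ∀ {A B} (φ : A ≅ B) (f : A ≅ A) (g : B ≅ B) →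
                        g ∘ᴮ φ ≋ φ ∘ᴮ f → fixedPoints f ≡ fixedPoints g
fixedPoints-conjugate {A} {B} φ f g gφ≋φf = begin
  fixedPoints f
    ≡⟨ fixedPoints≡∑ f ⟩
  ∑ A (λ x → 𝟙 (to f x A.≟ x))
    ≡⟨ ∑-cong A (λ x → 𝟙-cong (to f x A.≟ x) (to g (to φ x) B.≟ to φ x)
         (λ e → B.≈-trans (gφ≋φf x) (to-cong φ e))
         (λ e → A.≈-trans (A.≈-sym (strictlyInverseʳ φ (to f x)))
                  (A.≈-trans (from-cong φ (B.≈-trans (B.≈-sym (gφ≋φf x)) e))
                    (strictlyInverseʳ φ x)))) ⟩
  ∑ A (λ x → 𝟙 (to g (to φ x) B.≟ to φ x))
    ≡⟨ ∑-≅ φ (λ y → 𝟙 (to g y B.≟ y)) (λ {x} {y} x≈y → 𝟙-cong (to g x B.≟ x) (to g y B.≟ y)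
         (λ e → B.≈-trans (to-cong g (B.≈-sym x≈y)) (B.≈-trans e x≈y))
         (λ e → B.≈-trans (to-cong g x≈y) (B.≈-trans e (B.≈-sym x≈y)))) ⟩
  ∑ B (λ y → 𝟙 (to g y B.≟ y))
    ≡⟨ fixedPoints≡∑ g ⟨
  fixedPoints g ∎
  where
  open ≡-Reasoning
  module A = FinSet A
  module B = FinSet B

infixr 2 _×ᴮ_

_×ᴮ_ : FinSet → FinSet → FinSet
A ×ᴮ B = record
  { set  = ×-setoid A.set B.set
  ; size = A.size ℕ.* B.size
  ; enum = record
    { to        = index
    ; from      = element
    ; to-cong   = λ (p , q) → cong₂ combine (A.index-cong p) (B.index-cong q)
    ; from-cong = λ { refl → A.≈-refl , B.≈-refl }
    ; inverse   =
        (λ {k} (p , q) → trans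
          (cong₂ combine (trans (A.index-cong p) (A.index-element _))
                         (trans (B.index-cong q) (B.index-element _)))
          (Fin.combine-remQuot {A.size} B.size k))
      , (λ { {x , y} refl →
            A.≈-trans (A.reflexive (cong (A.element ∘ proj₁) (rq x y))) (A.element-index x)
          , B.≈-trans (B.reflexive (cong (B.element ∘ proj₂) (rq x y))) (B.element-index y) })
    }
  }
  where
  module A = FinSet A
  module B = FinSet B
  index : A.Carrier × B.Carrier → Fin (A.size ℕ.* B.size)
  index (x , y) = combine (A.index x) (B.index y)
  element : Fin (A.size ℕ.* B.size) → A.Carrier × B.Carrier
  element k = A.element (proj₁ (remQuot {A.size} B.size k)) , B.element (proj₂ (remQuot {A.size} B.size k))
  rq : ∀ x y → remQuot {A.size} B.size (combine (A.index x) (B.index y)) ≡ (A.index x , B.index y)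
  rq x y = Fin.remQuot-combine (A.index x) (B.index y)

opaque
  unfolding ∑

  ∑-× : ∀ A B (f : ∣ A ×ᴮ B ∣ → ℕ) → ∑ (A ×ᴮ B) f ≡ ∑ A (λ x → ∑ B (λ y → f (x , y)))
  ∑-× A B f = trans (sum-combine A.size {B.size} (f ∘ FinSet.element (A ×ᴮ B)))
    (Σℕ.sum-cong-≗ {A.size} λ i → Σℕ.sum-cong-≗ {B.size} λ j →
      cong (λ (k , l) → f (A.element k , B.element l)) (Fin.remQuot-combine i j))
    where
    module A = FinSet A
    module B = FinSet B

∑-×-* : ∀ A B (f : ∣ A ∣ → ℕ) (g : ∣ B ∣ → ℕ) →
        ∑ (A ×ᴮ B) (λ (x , y) → f x ℕ.* g y) ≡ ∑ A f ℕ.* ∑ B g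
∑-×-* A B f g = trans (∑-× A B _)
  (trans (∑-cong A λ x → sym (∑-*ˡ B (f x) g)) (sym (∑-*ʳ A (∑ B g) f)))

-- Permutations up to conjugacy

↑-elim : ∀ m {n} (P : Fin (m ℕ.+ n) → Set) →
         (∀ i → P (i ↑ˡ n)) → (∀ j → P (m ↑ʳ j)) → ∀ x → P x
↑-elim m P l r x with splitAt m x in eq
... | inj₁ i = subst P (Fin.splitAt⁻¹-↑ˡ eq) (l i)
... | inj₂ j = subst P (Fin.splitAt⁻¹-↑ʳ eq) (r j)

[_∣_]ᶠ : ∀ {m n} {A : Set} → (Fin m → A) → (Fin n → A) → Fin (m ℕ.+ n) → A
[_∣_]ᶠ {m} f g x = [ f , g ]′ (splitAt m x)

[∣]-↑ˡ : ∀ {m n} {A : Set} (f : Fin m → A) (g : Fin n → A) i → [ f ∣ g ]ᶠ (i ↑ˡ n) ≡ f i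
[∣]-↑ˡ {m} {n} f g i = cong [ f , g ]′ (Fin.splitAt-↑ˡ m i n)

[∣]-↑ʳ : ∀ {m n} {A : Set} (f : Fin m → A) (g : Fin n → A) j → [ f ∣ g ]ᶠ (m ↑ʳ j) ≡ g j
[∣]-↑ʳ {m} {n} f g j = cong [ f , g ]′ (Fin.splitAt-↑ʳ m n j)

module _ {m n} (σ : Permutation′ m) (ρ : Permutation′ n) where
  ⊕-↑ˡ : ∀ i → σ ⊕ ρ ⟨$⟩ʳ (i ↑ˡ n) ≡ (σ ⟨$⟩ʳ i) ↑ˡ n
  ⊕-↑ˡ i rewrite Fin.splitAt-↑ˡ m i n = refl

  ⊕-↑ʳ : ∀ j → σ ⊕ ρ ⟨$⟩ʳ (m ↑ʳ j) ≡ m ↑ʳ (ρ ⟨$⟩ʳ j)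
  ⊕-↑ʳ j rewrite Fin.splitAt-↑ʳ m n j = refl

-- The two underlying sets may have different descriptions, such as Fin n and Fin (sum ks).
infix 4 _∼_

record _∼_ {m n} (σ : Permutation′ m) (ρ : Permutation′ n) : Set where
  constructor conj
  field
    by          : Permutation m n
    intertwines : ∀ x → ρ ⟨$⟩ʳ (by ⟨$⟩ʳ x) ≡ by ⟨$⟩ʳ (σ ⟨$⟩ʳ x)

≈⇒∼ : ∀ {n} {σ ρ : Permutation′ n} → σ Perm.≈ ρ → σ ∼ ρ
≈⇒∼ σ≈ρ = conj Perm.id (λ x → sym (σ≈ρ x))

∼-refl : ∀ {n} {σ : Permutation′ n} → σ ∼ σ
∼-refl = ≈⇒∼ (λ _ → refl)

∼-sym : ∀ {m n} {σ : Permutation′ m} {ρ : Permutation′ n} → σ ∼ ρ → ρ ∼ σ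
∼-sym {σ = σ} {ρ} (conj τ e) = conj (flip τ) λ y → trans
  (sym (Perm.inverseˡ τ))
  (cong (τ ⟨$⟩ˡ_) (trans (sym (e (τ ⟨$⟩ˡ y))) (cong (ρ ⟨$⟩ʳ_) (Perm.inverseʳ τ))))

∼-trans : ∀ {l m n} {σ : Permutation′ l} {ρ : Permutation′ m} {θ : Permutation′ n} →
          σ ∼ ρ → ρ ∼ θ → σ ∼ θ
∼-trans (conj τ e) (conj τ′ e′) = conj (τ ∘ₚ τ′) λ x →
  trans (e′ (τ ⟨$⟩ʳ x)) (cong (τ′ ⟨$⟩ʳ_) (e x))

⊕-cong : ∀ {m m′ n n′} {σ : Permutation′ m} {σ′ : Permutation′ m′}
         {ρ : Permutation′ n} {ρ′ : Permutation′ n′} → σ ∼ σ′ → ρ ∼ ρ′ → σ ⊕ ρ ∼ σ′ ⊕ ρ′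
⊕-cong {m} {m′} {n} {n′} {σ} {σ′} {ρ} {ρ′} (conj τ e) (conj θ d) = conj β
  (↑-elim m _
    (λ i → begin
      σ′ ⊕ ρ′ ⟨$⟩ʳ (β ⟨$⟩ʳ (i ↑ˡ n))     ≡⟨ cong (σ′ ⊕ ρ′ ⟨$⟩ʳ_) (β-↑ˡ i) ⟩
      σ′ ⊕ ρ′ ⟨$⟩ʳ ((τ ⟨$⟩ʳ i) ↑ˡ n′)    ≡⟨ ⊕-↑ˡ σ′ ρ′ _ ⟩
      (σ′ ⟨$⟩ʳ (τ ⟨$⟩ʳ i)) ↑ˡ n′         ≡⟨ cong (_↑ˡ n′) (e i) ⟩
      (τ ⟨$⟩ʳ (σ ⟨$⟩ʳ i)) ↑ˡ n′          ≡⟨ β-↑ˡ _ ⟨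
      β ⟨$⟩ʳ ((σ ⟨$⟩ʳ i) ↑ˡ n)           ≡⟨ cong (β ⟨$⟩ʳ_) (⊕-↑ˡ σ ρ i) ⟨
      β ⟨$⟩ʳ (σ ⊕ ρ ⟨$⟩ʳ (i ↑ˡ n))       ∎)
    (λ j → begin
      σ′ ⊕ ρ′ ⟨$⟩ʳ (β ⟨$⟩ʳ (m ↑ʳ j))     ≡⟨ cong (σ′ ⊕ ρ′ ⟨$⟩ʳ_) (β-↑ʳ j) ⟩
      σ′ ⊕ ρ′ ⟨$⟩ʳ (m′ ↑ʳ (θ ⟨$⟩ʳ j))    ≡⟨ ⊕-↑ʳ σ′ ρ′ _ ⟩
      m′ ↑ʳ (ρ′ ⟨$⟩ʳ (θ ⟨$⟩ʳ j))         ≡⟨ cong (m′ ↑ʳ_) (d j) ⟩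
      m′ ↑ʳ (θ ⟨$⟩ʳ (ρ ⟨$⟩ʳ j))          ≡⟨ β-↑ʳ _ ⟨
      β ⟨$⟩ʳ (m ↑ʳ (ρ ⟨$⟩ʳ j))           ≡⟨ cong (β ⟨$⟩ʳ_) (⊕-↑ʳ σ ρ j) ⟨
      β ⟨$⟩ʳ (σ ⊕ ρ ⟨$⟩ʳ (m ↑ʳ j))       ∎))
  where
  open ≡-Reasoning
  β : Permutation (m ℕ.+ n) (m′ ℕ.+ n′)
  β = ↔-sym Fin.+↔⊎ ↔-∘ ((τ ⊎-↔ θ) ↔-∘ Fin.+↔⊎)
  β-↑ˡ : ∀ i → β ⟨$⟩ʳ (i ↑ˡ n) ≡ (τ ⟨$⟩ʳ i) ↑ˡ n′
  β-↑ˡ i rewrite Fin.splitAt-↑ˡ m i n = refl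
  β-↑ʳ : ∀ j → β ⟨$⟩ʳ (m ↑ʳ j) ≡ m′ ↑ʳ (θ ⟨$⟩ʳ j)
  β-↑ʳ j rewrite Fin.splitAt-↑ʳ m n j = refl

⊕-exchange : ∀ {l m n} (σ : Permutation′ l) (ρ : Permutation′ m) (θ : Permutation′ n) →
             σ ⊕ (ρ ⊕ θ) ∼ ρ ⊕ (σ ⊕ θ)
⊕-exchange {l} {m} {n} σ ρ θ = conj
  (permutation (exchange l m) (exchange m l) (exchange-involutive m l) (exchange-involutive l m))
  (↑-elim l _
    (λ i → begin
      ρσθ (exchange l m (i ↑ˡ (m ℕ.+ n)))      ≡⟨ cong ρσθ (exchange-1 l m i) ⟩
      ρσθ (m ↑ʳ (i ↑ˡ n))                    ≡⟨ ⊕-↑ʳ ρ (σ ⊕ θ) _ ⟩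
      m ↑ʳ (σ ⊕ θ ⟨$⟩ʳ (i ↑ˡ n))             ≡⟨ cong (m ↑ʳ_) (⊕-↑ˡ σ θ i) ⟩
      m ↑ʳ ((σ ⟨$⟩ʳ i) ↑ˡ n)                 ≡⟨ exchange-1 l m _ ⟨
      exchange l m ((σ ⟨$⟩ʳ i) ↑ˡ (m ℕ.+ n))   ≡⟨ cong (exchange l m) (⊕-↑ˡ σ (ρ ⊕ θ) i) ⟨
      exchange l m (σρθ (i ↑ˡ (m ℕ.+ n)))      ∎)
    (↑-elim m _
      (λ j → begin
        ρσθ (exchange l m (l ↑ʳ (j ↑ˡ n)))      ≡⟨ cong ρσθ (exchange-2 l m j) ⟩
        ρσθ (j ↑ˡ (l ℕ.+ n))                      ≡⟨ ⊕-↑ˡ ρ (σ ⊕ θ) _ ⟩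
        (ρ ⟨$⟩ʳ j) ↑ˡ (l ℕ.+ n)                   ≡⟨ exchange-2 l m _ ⟨
        exchange l m (l ↑ʳ ((ρ ⟨$⟩ʳ j) ↑ˡ n))   ≡⟨ cong (exchange l m ∘ (l ↑ʳ_)) (⊕-↑ˡ ρ θ j) ⟨
        exchange l m (l ↑ʳ (ρ ⊕ θ ⟨$⟩ʳ (j ↑ˡ n)))  ≡⟨ cong (exchange l m) (⊕-↑ʳ σ (ρ ⊕ θ) _) ⟨
        exchange l m (σρθ (l ↑ʳ (j ↑ˡ n)))      ∎)
      (λ k → begin
        ρσθ (exchange l m (l ↑ʳ (m ↑ʳ k)))      ≡⟨ cong ρσθ (exchange-3 l m k) ⟩
        ρσθ (m ↑ʳ (l ↑ʳ k))                     ≡⟨ ⊕-↑ʳ ρ (σ ⊕ θ) _ ⟩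
        m ↑ʳ (σ ⊕ θ ⟨$⟩ʳ (l ↑ʳ k))              ≡⟨ cong (m ↑ʳ_) (⊕-↑ʳ σ θ k) ⟩
        m ↑ʳ (l ↑ʳ (θ ⟨$⟩ʳ k))                  ≡⟨ exchange-3 l m _ ⟨
        exchange l m (l ↑ʳ (m ↑ʳ (θ ⟨$⟩ʳ k)))   ≡⟨ cong (exchange l m ∘ (l ↑ʳ_)) (⊕-↑ʳ ρ θ k) ⟨
        exchange l m (l ↑ʳ (ρ ⊕ θ ⟨$⟩ʳ (m ↑ʳ k)))  ≡⟨ cong (exchange l m) (⊕-↑ʳ σ (ρ ⊕ θ) _) ⟨
        exchange l m (σρθ (l ↑ʳ (m ↑ʳ k)))      ∎)))
  where
  open ≡-Reasoning
  ρσθ = ρ ⊕ (σ ⊕ θ) ⟨$⟩ʳ_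
  σρθ = σ ⊕ (ρ ⊕ θ) ⟨$⟩ʳ_
  exchange : ∀ l m → Fin (l ℕ.+ (m ℕ.+ n)) → Fin (m ℕ.+ (l ℕ.+ n))
  exchange l m = [ (λ i → m ↑ʳ (i ↑ˡ n)) ∣ [_∣_]ᶠ {m} (_↑ˡ (l ℕ.+ n)) (λ k → m ↑ʳ (l ↑ʳ k)) ]ᶠ
  exchange-1 : ∀ l m i → exchange l m (i ↑ˡ (m ℕ.+ n)) ≡ m ↑ʳ (i ↑ˡ n)
  exchange-1 l m i = [∣]-↑ˡ _ ([_∣_]ᶠ {m} (_↑ˡ (l ℕ.+ n)) (λ k → m ↑ʳ (l ↑ʳ k))) i
  exchange-2 : ∀ l m j → exchange l m (l ↑ʳ (j ↑ˡ n)) ≡ j ↑ˡ (l ℕ.+ n)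
  exchange-2 l m j = trans ([∣]-↑ʳ {l} _ _ (j ↑ˡ n)) ([∣]-↑ˡ {m} _ (λ k → m ↑ʳ (l ↑ʳ k)) j)
  exchange-3 : ∀ l m k → exchange l m (l ↑ʳ (m ↑ʳ k)) ≡ m ↑ʳ (l ↑ʳ k)
  exchange-3 l m k = trans ([∣]-↑ʳ {l} _ _ (m ↑ʳ k)) ([∣]-↑ʳ {m} _ (λ k → m ↑ʳ (l ↑ʳ k)) k)
  exchange-involutive : ∀ l m x → exchange m l (exchange l m x) ≡ x
  exchange-involutive l m = ↑-elim l _
    (λ i → trans (cong (exchange m l) (exchange-1 l m i)) (exchange-2 m l i))
    (↑-elim m _
      (λ j → trans (cong (exchange m l) (exchange-2 l m j)) (exchange-1 m l j))
      (λ k → trans (cong (exchange m l) (exchange-3 l m k)) (exchange-3 m l k)))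

-- Reordering the lengths relabels the points block by block. An entry 0 contributes no block, hence
-- the four cases of a swap.
cycles-↭ : ∀ {ks ls} → ks ↭ ls → cycles ks ∼ cycles ls
cycles-↭ ↭.refl               = ∼-refl
cycles-↭ (↭.prep zero p)      = cycles-↭ p
cycles-↭ (↭.prep (suc k) p)   = ⊕-cong {σ = rotation k} ∼-refl (cycles-↭ p)
cycles-↭ (↭.swap zero zero p)       = cycles-↭ p
cycles-↭ (↭.swap zero (suc l) p)    = ⊕-cong {σ = rotation l} ∼-refl (cycles-↭ p)
cycles-↭ (↭.swap (suc k) zero p)    = ⊕-cong {σ = rotation k} ∼-refl (cycles-↭ p)
cycles-↭ (↭.swap (suc k) (suc l) p) = ∼-trans (⊕-exchange (rotation k) (rotation l) _)
  (⊕-cong {σ = rotation l} ∼-refl (⊕-cong {σ = rotation k} ∼-refl (cycles-↭ p)))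
cycles-↭ (↭.trans p q)        = ∼-trans (cycles-↭ p) (cycles-↭ q)

-- Inserting a point into a permutation

rotation-inject₁ : ∀ k (i : Fin k) → rotation k ⟨$⟩ʳ inject₁ i ≡ suc i
rotation-inject₁ k i = trans (cong (rotation k ⟨$⟩ʳ_) (sym (punchIn-fromℕ i)))
  (Perm.insert-punchIn (fromℕ k) zero Perm.id i)
  where
  punchIn-fromℕ : ∀ {k} (i : Fin k) → punchIn (fromℕ k) i ≡ inject₁ i
  punchIn-fromℕ zero    = refl
  punchIn-fromℕ (suc i) = cong suc (punchIn-fromℕ i)

rotation-fromℕ : ∀ k → rotation k ⟨$⟩ʳ fromℕ k ≡ zero
rotation-fromℕ k with fromℕ k Fin.≟ fromℕ k
... | yes _ = refl
... | no ≢  = contradiction refl ≢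

-- The case distinction that suits `rotation`: every point but the last moves up by one, and the
-- last one returns to zero.
inject₁-elim : ∀ {k} (P : Fin (suc k) → Set) → (∀ i → P (inject₁ i)) → P (fromℕ k) → ∀ x → P x
inject₁-elim {zero}  P p q zero    = q
inject₁-elim {suc k} P p q zero    = p zero
inject₁-elim {suc k} P p q (suc x) = inject₁-elim (P ∘ suc) (p ∘ suc) q x

-- insertAt (suc x) π inserts 0 into the cycle of x just before x; insertAt 0 π adds it as
-- a fixed point.
insertAt : ∀ {n} → Fin (suc n) → Permutation′ n → Permutation′ (suc n)
insertAt j π = lift₀ π ∘ₚ transpose zero j

transpose-first : ∀ {n} (i j : Fin n) → PC.transpose i j i ≡ j
transpose-first i j with i Fin.≟ i
... | yes _ = refl
... | no ≢  = contradiction refl ≢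

transpose-second : ∀ {n} (i j : Fin n) → PC.transpose i j j ≡ i
transpose-second i j with j Fin.≟ i
... | yes e = e
... | no _ with j Fin.≟ j
...   | yes _ = refl
...   | no ≢  = contradiction refl ≢

transpose-other : ∀ {n} (i j : Fin n) {k} → k ≢ i → k ≢ j → PC.transpose i j k ≡ k
transpose-other i j {k} k≢i k≢j with k Fin.≟ i
... | yes e = contradiction e k≢i
... | no _ with k Fin.≟ j
...   | yes e = contradiction e k≢j
...   | no _  = refl

transpose-natural : ∀ {m n} (β : Permutation m n) i j k →
  PC.transpose (β ⟨$⟩ʳ i) (β ⟨$⟩ʳ j) (β ⟨$⟩ʳ k) ≡ β ⟨$⟩ʳ PC.transpose i j k
transpose-natural β i j k with k Fin.≟ i
... | yes refl = transpose-first (β ⟨$⟩ʳ i) (β ⟨$⟩ʳ j)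
... | no k≢i with k Fin.≟ j
...   | yes refl = transpose-second (β ⟨$⟩ʳ i) (β ⟨$⟩ʳ j)
...   | no k≢j   = transpose-other (β ⟨$⟩ʳ i) (β ⟨$⟩ʳ j) (k≢i ∘ injective) (k≢j ∘ injective)
  where
  injective : ∀ {x y} → β ⟨$⟩ʳ x ≡ β ⟨$⟩ʳ y → x ≡ y
  injective e = trans (sym (Perm.inverseˡ β)) (trans (cong (β ⟨$⟩ˡ_) e) (Perm.inverseˡ β))

insertAt-cong : ∀ {m n} {π : Permutation′ m} {π′ : Permutation′ n} (c : π ∼ π′) j →
                insertAt j π ∼ insertAt (lift₀ (_∼_.by c) ⟨$⟩ʳ j) π′
insertAt-cong {π = π} {π′} (conj τ e) j = conj (lift₀ τ) λ x → trans
  (cong (PC.transpose zero (lift₀ τ ⟨$⟩ʳ j)) (lifted x))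
  (transpose-natural (lift₀ τ) zero j (lift₀ π ⟨$⟩ʳ x))
  where
  lifted : ∀ x → lift₀ π′ ⟨$⟩ʳ (lift₀ τ ⟨$⟩ʳ x) ≡ lift₀ τ ⟨$⟩ʳ (lift₀ π ⟨$⟩ʳ x)
  lifted zero    = refl
  lifted (suc x) = cong suc (e x)

insertAt-zero : ∀ {n} (π : Permutation′ n) → insertAt zero π ∼ rotation 0 ⊕ π
insertAt-zero π = ≈⇒∼ λ
  { zero    → refl
  ; (suc x) → transpose-other zero zero (λ ()) (λ ()) }

-- The new point 0 directly precedes the first point of the block, so the labels are already those
-- of the longer rotation and the two permutations agree pointwise.
insertAt-one : ∀ k {n} (ρ : Permutation′ n) →
               insertAt (suc zero) (rotation k ⊕ ρ) ∼ rotation (suc k) ⊕ ρ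
insertAt-one k {n} ρ = ≈⇒∼ λ
  { zero    → refl
  ; (suc x) → ↑-elim (suc k)
      (λ x → insertAt one (rotation k ⊕ ρ) ⟨$⟩ʳ suc x ≡ rotation (suc k) ⊕ ρ ⟨$⟩ʳ suc x)
      (inject₁-elim _
        (λ i → begin
          PC.transpose zero one (suc (rotation k ⊕ ρ ⟨$⟩ʳ (inject₁ i ↑ˡ n)))
            ≡⟨ cong (PC.transpose zero one ∘ suc) (⊕-↑ˡ (rotation k) ρ (inject₁ i)) ⟩
          PC.transpose zero one (suc ((rotation k ⟨$⟩ʳ inject₁ i) ↑ˡ n))
            ≡⟨ cong (λ y → PC.transpose zero one (suc (y ↑ˡ n))) (rotation-inject₁ k i) ⟩
          PC.transpose zero one (suc (suc (i ↑ˡ n)))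
            ≡⟨ transpose-other zero one (λ ()) (λ ()) ⟩
          suc (suc i) ↑ˡ n
            ≡⟨ cong (_↑ˡ n) (rotation-inject₁ (suc k) (suc i)) ⟨
          (rotation (suc k) ⟨$⟩ʳ suc (inject₁ i)) ↑ˡ n
            ≡⟨ ⊕-↑ˡ (rotation (suc k)) ρ (suc (inject₁ i)) ⟨
          rotation (suc k) ⊕ ρ ⟨$⟩ʳ (suc (inject₁ i) ↑ˡ n) ∎)
        (begin
          PC.transpose zero one (suc (rotation k ⊕ ρ ⟨$⟩ʳ (fromℕ k ↑ˡ n)))
            ≡⟨ cong (PC.transpose zero one ∘ suc) (⊕-↑ˡ (rotation k) ρ (fromℕ k)) ⟩
          PC.transpose zero one (suc ((rotation k ⟨$⟩ʳ fromℕ k) ↑ˡ n))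
            ≡⟨ cong (λ y → PC.transpose zero one (suc (y ↑ˡ n))) (rotation-fromℕ k) ⟩
          zero ↑ˡ n
            ≡⟨ cong (_↑ˡ n) (rotation-fromℕ (suc k)) ⟨
          (rotation (suc k) ⟨$⟩ʳ fromℕ (suc k)) ↑ˡ n
            ≡⟨ ⊕-↑ˡ (rotation (suc k)) ρ (fromℕ (suc k)) ⟨
          rotation (suc k) ⊕ ρ ⟨$⟩ʳ (fromℕ (suc k) ↑ˡ n) ∎))
      (λ j → begin
        PC.transpose zero one (suc (rotation k ⊕ ρ ⟨$⟩ʳ (suc k ↑ʳ j)))
          ≡⟨ cong (PC.transpose zero one ∘ suc) (⊕-↑ʳ (rotation k) ρ j) ⟩
        PC.transpose zero one (suc (suc k ↑ʳ (ρ ⟨$⟩ʳ j)))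
          ≡⟨ transpose-other zero one (λ ()) (λ ()) ⟩
        suc (suc k) ↑ʳ (ρ ⟨$⟩ʳ j)
          ≡⟨ ⊕-↑ʳ (rotation (suc k)) ρ j ⟨
        rotation (suc k) ⊕ ρ ⟨$⟩ʳ (suc (suc k) ↑ʳ j) ∎)
      x }
  where
  open ≡-Reasoning
  one : Fin (suc (suc k ℕ.+ n))
  one = suc zero
-- Conjugation by rotation k ⊕ id moves the point of insertion to the next one in its block.
insertAt-↑ˡ : ∀ k {n} (ρ : Permutation′ n) i →
              insertAt (suc (i ↑ˡ n)) (rotation k ⊕ ρ) ∼ rotation (suc k) ⊕ ρ
insertAt-↑ˡ k {n} ρ = <-weakInduction
  (λ i → insertAt (suc (i ↑ˡ n)) (rotation k ⊕ ρ) ∼ rotation (suc k) ⊕ ρ) (insertAt-one k ρ) λ i → ∼-trans (∼-sym (step i))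
  where
  r = rotation k
  turn : r ⊕ ρ ∼ r ⊕ ρ
  turn = ⊕-cong (conj r (λ _ → refl)) (∼-refl {σ = ρ})
  step : ∀ i → insertAt (suc (inject₁ i ↑ˡ n)) (r ⊕ ρ) ∼ insertAt (suc (suc i ↑ˡ n)) (r ⊕ ρ)
  step i = subst (λ j → insertAt (suc (inject₁ i ↑ˡ n)) (r ⊕ ρ) ∼ insertAt (suc j) (r ⊕ ρ))
    (trans (⊕-↑ˡ r Perm.id (inject₁ i)) (cong (_↑ˡ n) (rotation-inject₁ k i)))
    (insertAt-cong turn (suc (inject₁ i ↑ˡ n)))

-- The new point stands before both blocks on the left and between them on the right; the
-- conjugating bijection `β` carries it across the first block.
insertAt-↑ʳ : ∀ {m n} (σ : Permutation′ m) (ρ : Permutation′ n) j →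
              insertAt (suc (m ↑ʳ j)) (σ ⊕ ρ) ∼ σ ⊕ insertAt (suc j) ρ
insertAt-↑ʳ {m} {n} σ ρ j = conj
  (permutation β γ (↑-elim m (λ x → β (γ x) ≡ x)
      (λ i → trans (cong β (γ-↑ˡ i)) (β-↑ˡ i))
      (λ { zero    → trans (cong β (γ-↑ʳ zero)) refl
         ; (suc k) → trans (cong β (γ-↑ʳ (suc k))) (β-↑ʳ k) }))
    (λ { zero    → γ-↑ʳ zero
       ; (suc x) → ↑-elim m (λ x → γ (β (suc x)) ≡ suc x)
           (λ i → trans (cong γ (β-↑ˡ i)) (γ-↑ˡ i))
           (λ k → trans (cong γ (β-↑ʳ k)) (γ-↑ʳ (suc k))) x }))
  (λ { zero    → trans (⊕-↑ʳ σ (insertAt (suc j) ρ) zero) (sym (β-↑ʳ j))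
     ; (suc x) → ↑-elim m
         (λ x → σ ⊕ insertAt (suc j) ρ ⟨$⟩ʳ β (suc x) ≡
                β (insertAt (suc (m ↑ʳ j)) (σ ⊕ ρ) ⟨$⟩ʳ suc x))
         (λ i → begin
           σ ⊕ insertAt (suc j) ρ ⟨$⟩ʳ β (suc (i ↑ˡ n))
             ≡⟨ cong (σ ⊕ insertAt (suc j) ρ ⟨$⟩ʳ_) (β-↑ˡ i) ⟩
           σ ⊕ insertAt (suc j) ρ ⟨$⟩ʳ (i ↑ˡ suc n)
             ≡⟨ ⊕-↑ˡ σ (insertAt (suc j) ρ) i ⟩
           (σ ⟨$⟩ʳ i) ↑ˡ suc n
             ≡⟨ β-↑ˡ (σ ⟨$⟩ʳ i) ⟨
           β (suc ((σ ⟨$⟩ʳ i) ↑ˡ n))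
             ≡⟨ cong β (transpose-other zero (suc (m ↑ʳ j)) (λ ()) (↑ˡ≢↑ʳ (σ ⟨$⟩ʳ i) j ∘ Fin.suc-injective)) ⟨
           β (PC.transpose zero (suc (m ↑ʳ j)) (suc ((σ ⟨$⟩ʳ i) ↑ˡ n)))
             ≡⟨ cong (β ∘ PC.transpose zero (suc (m ↑ʳ j)) ∘ suc) (⊕-↑ˡ σ ρ i) ⟨
           β (insertAt (suc (m ↑ʳ j)) (σ ⊕ ρ) ⟨$⟩ʳ suc (i ↑ˡ n)) ∎)
         (λ k → begin
           σ ⊕ insertAt (suc j) ρ ⟨$⟩ʳ β (suc (m ↑ʳ k))
             ≡⟨ cong (σ ⊕ insertAt (suc j) ρ ⟨$⟩ʳ_) (β-↑ʳ k) ⟩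
           σ ⊕ insertAt (suc j) ρ ⟨$⟩ʳ (m ↑ʳ suc k)
             ≡⟨ ⊕-↑ʳ σ (insertAt (suc j) ρ) (suc k) ⟩
           m ↑ʳ PC.transpose zero (suc j) (suc (ρ ⟨$⟩ʳ k))
             ≡⟨ shifted (ρ ⟨$⟩ʳ k) (_ Fin.≟ _) ⟩
           β (PC.transpose zero (suc (m ↑ʳ j)) (suc (m ↑ʳ (ρ ⟨$⟩ʳ k))))
             ≡⟨ cong (β ∘ PC.transpose zero (suc (m ↑ʳ j)) ∘ suc) (⊕-↑ʳ σ ρ k) ⟨
           β (insertAt (suc (m ↑ʳ j)) (σ ⊕ ρ) ⟨$⟩ʳ suc (m ↑ʳ k)) ∎)
         x })
  where
  open ≡-Reasoning
  β : Fin (suc (m ℕ.+ n)) → Fin (m ℕ.+ suc n)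
  β zero    = m ↑ʳ zero
  β (suc x) = [ _↑ˡ suc n ∣ (λ k → m ↑ʳ suc k) ]ᶠ x
  γ₂ : Fin (suc n) → Fin (suc (m ℕ.+ n))
  γ₂ zero    = zero
  γ₂ (suc k) = suc (m ↑ʳ k)
  γ : Fin (m ℕ.+ suc n) → Fin (suc (m ℕ.+ n))
  γ = [ (λ i → suc (i ↑ˡ n)) ∣ γ₂ ]ᶠ
  β-↑ˡ : ∀ i → β (suc (i ↑ˡ n)) ≡ i ↑ˡ suc n
  β-↑ˡ = [∣]-↑ˡ (_↑ˡ suc n) (λ k → m ↑ʳ suc k)
  β-↑ʳ : ∀ k → β (suc (m ↑ʳ k)) ≡ m ↑ʳ suc k
  β-↑ʳ = [∣]-↑ʳ {m} (_↑ˡ suc n) (λ k → m ↑ʳ suc k)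
  γ-↑ˡ : ∀ i → γ (i ↑ˡ suc n) ≡ suc (i ↑ˡ n)
  γ-↑ˡ = [∣]-↑ˡ (λ i → suc (i ↑ˡ n)) γ₂
  γ-↑ʳ : ∀ k → γ (m ↑ʳ k) ≡ γ₂ k
  γ-↑ʳ = [∣]-↑ʳ {m} (λ i → suc (i ↑ˡ n)) γ₂
  ↑ˡ≢↑ʳ : ∀ (i : Fin m) (k : Fin n) → i ↑ˡ n ≢ m ↑ʳ k
  ↑ˡ≢↑ʳ i k e with trans (sym (Fin.splitAt-↑ˡ m i n)) (trans (cong (splitAt m) e) (Fin.splitAt-↑ʳ m n k))
  ... | ()
  shifted : ∀ k → Dec (k ≡ j) → m ↑ʳ PC.transpose zero (suc j) (suc k) ≡
                  β (PC.transpose zero (suc (m ↑ʳ j)) (suc (m ↑ʳ k)))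
  shifted k (yes refl) = trans (cong (m ↑ʳ_) (transpose-second zero (suc k)))
    (sym (cong β (transpose-second zero (suc (m ↑ʳ k)))))
  shifted k (no k≢j) = trans (cong (m ↑ʳ_) (transpose-other zero (suc j) (λ ()) (k≢j ∘ Fin.suc-injective)))
    (trans (sym (β-↑ʳ k)) (sym (cong β (transpose-other zero (suc (m ↑ʳ j)) (λ ())
      (k≢j ∘ Fin.↑ʳ-injective m k j ∘ Fin.suc-injective)))))

insertAt-cycles : ∀ {ks} → All NonZero ks → ∀ x →
                  ∃ λ ls → All NonZero ls × insertAt x (cycles ks) ∼ cycles ls
insertAt-cycles {ks} ≢0 zero = 1 ∷ ks , _ ∷ ≢0 , insertAt-zero (cycles ks)
insertAt-cycles {suc k ∷ ks} (_ ∷ ≢0) (suc x) = ↑-elim (suc k)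
  (λ x → ∃ λ ls → All NonZero ls × insertAt (suc x) (cycles (suc k ∷ ks)) ∼ cycles ls)
  (λ i → suc (suc k) ∷ ks , _ ∷ ≢0 , insertAt-↑ˡ k (cycles ks) i)
  (λ j → let ls , ≢0′ , c = insertAt-cycles ≢0 (suc j) in
    suc k ∷ ls , _ ∷ ≢0′ , ∼-trans (insertAt-↑ʳ (rotation k) (cycles ks) j) (⊕-cong {σ = rotation k} ∼-refl c))
  x

lift₀-injective : ∀ {n} {π ρ : Permutation′ n} → lift₀ π Perm.≈ lift₀ ρ → π Perm.≈ ρ
lift₀-injective e i = Fin.suc-injective (e (suc i))

transpose-injective : ∀ {n} (i j : Fin n) {x y} → PC.transpose i j x ≡ PC.transpose i j y → x ≡ y
transpose-injective i j e = trans (sym (PC.transpose-inverse j i))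
  (trans (cong (PC.transpose j i) e) (PC.transpose-inverse j i))

-- Composition with the transposition of `σ ⟨$⟩ʳ zero` and `zero` makes 0 a fixed point, which can
-- then be dropped. In the cycle of 0 this links the predecessor of 0 to its successor, and so
-- undoes `insertAt`.
deleteZero : ∀ {n} → Permutation′ (suc n) → Permutation′ n
deleteZero σ = remove zero (σ ∘ₚ transpose (σ ⟨$⟩ʳ zero) zero)

insertAt-deleteZero : ∀ {n} (σ : Permutation′ (suc n)) →
                      insertAt (σ ⟨$⟩ʳ zero) (deleteZero σ) Perm.≈ σ
insertAt-deleteZero σ x = trans
  (cong (PC.transpose zero (σ ⟨$⟩ʳ zero))
    (Perm.lift₀-remove (σ ∘ₚ transpose (σ ⟨$⟩ʳ zero) zero) (transpose-first (σ ⟨$⟩ʳ zero) zero) x))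
  (PC.transpose-inverse zero (σ ⟨$⟩ʳ zero))

insertAt-⟨$⟩-zero : ∀ {n} j (π : Permutation′ n) → insertAt j π ⟨$⟩ʳ zero ≡ j
insertAt-⟨$⟩-zero j π = transpose-first zero j

insertAt-injective : ∀ {n} {j k} {π ρ : Permutation′ n} →
                     insertAt j π Perm.≈ insertAt k ρ → j ≡ k × π Perm.≈ ρ
insertAt-injective {j = j} {k} {π} {ρ} e with trans (sym (insertAt-⟨$⟩-zero j π)) (trans (e zero) (insertAt-⟨$⟩-zero k ρ))
... | refl = refl , lift₀-injective {π = π} {ρ} (λ x → transpose-injective zero j (e x))

insertAt-resp : ∀ {n} j {π ρ : Permutation′ n} → π Perm.≈ ρ → insertAt j π Perm.≈ insertAt j ρ
insertAt-resp j {π} {ρ} e x = cong (PC.transpose zero j) (Perm.lift₀-cong π ρ e x)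

-- Induction on the number of points: delete 0, decompose the rest, and insert 0 again. Each
-- insertion either adds a cycle of length 1 or lengthens an existing cycle, so no orbit of σ has to
-- be followed.
cycles-decomposition : ∀ {n} (σ : Permutation′ n) → ∃ λ ks → All NonZero ks × σ ∼ cycles ks
cycles-decomposition {zero}  σ = [] , [] , ≈⇒∼ λ ()
cycles-decomposition {suc n} σ = insertZero (cycles-decomposition (deleteZero σ))
  where
  insertZero : (∃ λ ks → All NonZero ks × deleteZero σ ∼ cycles ks) →
               ∃ λ ls → All NonZero ls × σ ∼ cycles ls
  insertZero (ks , ≢0 , c) =
    let ls , ≢0′ , d = insertAt-cycles ≢0 (lift₀ (_∼_.by c) ⟨$⟩ʳ (σ ⟨$⟩ʳ zero)) in
    ls , ≢0′ , ∼-trans (∼-sym (≈⇒∼ {ρ = σ} (insertAt-deleteZero σ)))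
      (∼-trans (insertAt-cong c (σ ⟨$⟩ʳ zero)) d)

-- Summation over the symmetric group

PermutationSetoid : ℕ → Setoid 0ℓ 0ℓ
PermutationSetoid n = record
  { Carrier       = Permutation′ n
  ; _≈_           = Perm._≈_
  ; isEquivalence = record
    { refl  = λ _ → refl
    ; sym   = λ e i → sym (e i)
    ; trans = λ e d i → trans (e i) (d i)
    }
  }

insertion : ∀ {n} → Inverse (PermutationSetoid (suc n)) (×-setoid (setoid (Fin (suc n))) (PermutationSetoid n))
insertion = record
  { to        = split
  ; from      = λ (j , π) → insertAt j π
  ; to-cong   = λ {σ} {ρ} e → insertAt-injective {π = deleteZero σ} {deleteZero ρ}
      (λ x → trans (insertAt-deleteZero σ x) (trans (e x) (sym (insertAt-deleteZero ρ x))))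
  ; from-cong = λ { {j , π} {_ , ρ} (refl , e) → insertAt-resp j {π} {ρ} e }
  ; inverse   =
      (λ { {j , π} {σ} e → insertAt-injective {π = deleteZero σ} {π} λ x → trans (insertAt-deleteZero σ x) (e x) })
    , (λ { {σ} {j , π} (refl , e) x → trans (insertAt-resp j {π} {deleteZero σ} e x) (insertAt-deleteZero σ x) })
  }
  where
  split : ∀ {n} → Permutation′ (suc n) → Fin (suc n) × Permutation′ n
  split σ = σ ⟨$⟩ʳ zero , deleteZero σ

-- The enumeration is recursive along `insertion`, which gives the size n ! by the defining equation
-- of the factorial.
𝔖 : ℕ → FinSet
𝔖-enum : ∀ n → Inverse (PermutationSetoid n) (setoid (Fin (n !)))

𝔖 n = record { set = PermutationSetoid n ; size = n ! ; enum = 𝔖-enum n }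

𝔖-enum zero = record
  { to        = λ _ → zero
  ; from      = λ _ → Perm.id
  ; to-cong   = λ _ → refl
  ; from-cong = λ _ ()
  ; inverse   = (λ { {zero} _ → refl }) , (λ _ ())
  }
𝔖-enum (suc n) = Composition.inverse insertion (FinSet.enum ([ suc n ] ×ᴮ 𝔖 n))

𝔖-suc : ∀ n → 𝔖 (suc n) ≅ ([ suc n ] ×ᴮ 𝔖 n)
𝔖-suc n = bij insertion

-- A class function on all symmetric groups at once, because the recursion obtains a class function
-- on n points from the values on n + 1 points. Pointwise equal permutations are conjugate, so such
-- an `h` also respects the equality of `𝔖 n`.
Invariant : (∀ {n} → Permutation′ n → ℕ) → Set
Invariant h = ∀ {m n} {σ : Permutation′ m} {ρ : Permutation′ n} → σ ∼ ρ → h σ ≡ h ρ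

∑-𝔖-suc : ∀ n (h : ∀ {n} → Permutation′ n → ℕ) → Invariant h →
          ∑ (𝔖 (suc n)) h ≡ ∑ (𝔖 n) (λ π → ∑ [ suc n ] (λ j → h (insertAt j π)))
∑-𝔖-suc n h h-inv = begin
  ∑ (𝔖 (suc n)) h
    ≡⟨ ∑-≅ (𝔖-suc n ⁻¹) h (λ {σ} {ρ} e → h-inv (≈⇒∼ {σ = σ} {ρ} e)) ⟨
  ∑ ([ suc n ] ×ᴮ 𝔖 n) (λ (j , π) → h (insertAt j π))
    ≡⟨ ∑-× [ suc n ] (𝔖 n) _ ⟩
  ∑ [ suc n ] (λ j → ∑ (𝔖 n) (λ π → h (insertAt j π)))
    ≡⟨ ∑-comm [ suc n ] (𝔖 n) _ ⟩
  ∑ (𝔖 n) (λ π → ∑ [ suc n ] (λ j → h (insertAt j π))) ∎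
  where open ≡-Reasoning

∑-insertAt-invariant : (h : ∀ {n} → Permutation′ n → ℕ) → Invariant h →
                       Invariant (λ {n} π → ∑ [ suc n ] (λ j → h (insertAt j π)))
∑-insertAt-invariant h h-inv {m} {n} {σ} {ρ} c = trans
  (∑-cong [ suc m ] (λ j → h-inv (insertAt-cong c j)))
  (∑-≅ (bij (lift₀ (_∼_.by c))) (λ j → h (insertAt j ρ)) (cong (λ j → h (insertAt j ρ))))

-- Burnside's counting argument

module Transporters
  (X : FinSet) {n : ℕ} (act : Permutation′ n → ∣ X ∣ → ∣ X ∣)
  (act-cong : ∀ σ {x y} → FinSet._≈_ X x y → FinSet._≈_ X (act σ x) (act σ y))
  (act-resp : ∀ {σ ρ} → σ Perm.≈ ρ → ∀ x → FinSet._≈_ X (act σ x) (act ρ x))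
  (act-∘ : ∀ σ ρ x → FinSet._≈_ X (act (ρ ∘ₚ σ) x) (act σ (act ρ x)))
  where
  open FinSet X using (_≈_; _≟_; ≈-refl; ≈-sym; ≈-trans)
  open ≡-Reasoning

  transporters : ∣ X ∣ → ∣ X ∣ → ℕ
  transporters x y = ∑ (𝔖 n) (λ σ → 𝟙 (act σ x ≟ y))

  ∑-transporters : ∀ x → ∑ X (transporters x) ≡ n !
  ∑-transporters x = begin
    ∑ X (λ y → ∑ (𝔖 n) (λ σ → 𝟙 (act σ x ≟ y)))
      ≡⟨ ∑-comm X (𝔖 n) _ ⟩
    ∑ (𝔖 n) (λ σ → ∑ X (λ y → 𝟙 (act σ x ≟ y)))
      ≡⟨ ∑-cong (𝔖 n) (λ σ → trans
           (∑-cong X λ y → 𝟙-cong (act σ x ≟ y) (y ≟ act σ x) ≈-sym ≈-sym)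
           (∑-δ X (act σ x))) ⟩
    ∑ (𝔖 n) (λ σ → 1)
      ≡⟨ ∑-1 (𝔖 n) ⟩
    n ! ∎

  -- Translation by ρ permutes 𝔖ₙ: σ carries x′ to y exactly when ρ followed by σ carries x to y.
  transporters-move : ∀ ρ {x x′} y → act ρ x ≈ x′ → transporters x′ y ≡ transporters x y
  transporters-move ρ {x} {x′} y e = begin
    ∑ (𝔖 n) (λ σ → 𝟙 (act σ x′ ≟ y))
      ≡⟨ ∑-cong (𝔖 n) (λ σ → 𝟙-cong (act σ x′ ≟ y) (act (ρ ∘ₚ σ) x ≟ y)
           (≈-trans (shift σ)) (≈-trans (≈-sym (shift σ)))) ⟩
    ∑ (𝔖 n) (λ σ → 𝟙 (act (ρ ∘ₚ σ) x ≟ y))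
      ≡⟨ ∑-≅ precompose (λ σ → 𝟙 (act σ x ≟ y)) (λ {σ} {σ′} σ≈ →
           𝟙-cong (act σ x ≟ y) (act σ′ x ≟ y)
             (≈-trans (≈-sym (act-resp {σ} {σ′} σ≈ x))) (≈-trans (act-resp {σ} {σ′} σ≈ x))) ⟩
    ∑ (𝔖 n) (λ σ → 𝟙 (act σ x ≟ y)) ∎
    where
    shift : ∀ σ → act (ρ ∘ₚ σ) x ≈ act σ x′
    shift σ = ≈-trans (act-∘ σ ρ x) (act-cong σ e)
    precompose : 𝔖 n ≅ 𝔖 n
    precompose = bij record
      { to        = ρ ∘ₚ_
      ; from      = flip ρ ∘ₚ_
      ; to-cong   = λ σ≈ i → σ≈ (ρ ⟨$⟩ʳ i)
      ; from-cong = λ σ≈ i → σ≈ (flip ρ ⟨$⟩ʳ i)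
      ; inverse   = (λ {σ} {σ′} σ≈ i → trans (σ≈ (ρ ⟨$⟩ʳ i)) (cong (σ ⟨$⟩ʳ_) (Perm.inverseˡ ρ)))
                  , (λ {σ} {σ′} σ≈ i → trans (σ≈ (flip ρ ⟨$⟩ʳ i)) (cong (σ ⟨$⟩ʳ_) (Perm.inverseʳ ρ)))
      }

  transporters≡0 : ∀ {x y} → (∀ σ → ¬ act σ x ≈ y) → transporters x y ≡ 0
  transporters≡0 {x} {y} none =
    trans (∑-cong (𝔖 n) (λ σ → 𝟙-false (act σ x ≟ y) (none σ))) (∑-0 (𝔖 n))

module Burnside (F : Species) (H : Species₂) (fin : StrictlyFinite F) {V : FinSet} (τ : V ≅ V) where
  private
    module F = Species F
    module H = Species₂ H
    S = scalarProduct F H fin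
    O = Species.obj S V
    module O = FinSet O
  open ≡-Reasoning

  τ* : O ≅ O
  τ* = Species.hom S τ

  ofDegree : ℕ → O.Carrier → ℕ
  ofDegree n o = 𝟙 ((proj₁ o ℕ.≟ n) ×-dec (to τ* o O.≟ o))

  fixedOfDegree : ℕ → ℕ
  fixedOfDegree n = ∑ O (ofDegree n)

  module _ (n : ℕ) where
    private
      A = F.obj [ n ]
      B = H.obj [ n ] V
      module A = FinSet A
      module B = FinSet B
      X = A ×ᴮ B
      module X = FinSet X

    act : Permutation′ n → X.Carrier → X.Carrier
    act σ (t , h) = to (F.hom ⟦ σ ⟧) t , to (H.hom ⟦ σ ⟧ idᴮ) h

    open Transporters X act
      (λ σ (p , q) → to-cong (F.hom ⟦ σ ⟧) p , to-cong (H.hom ⟦ σ ⟧ idᴮ) q)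
      (λ {σ} {ρ} σ≈ρ (t , h) → F.resp {f = ⟦ σ ⟧} {⟦ ρ ⟧} σ≈ρ t
        , H.resp {β = ⟦ σ ⟧} {⟦ ρ ⟧} {idᴮ} {idᴮ} σ≈ρ (λ _ → FinSet.≈-refl V) h)
      (λ σ ρ (t , h) → F.comp ⟦ σ ⟧ ⟦ ρ ⟧ t , B.≈-trans
        (H.resp {β = ⟦ ρ ∘ₚ σ ⟧} {⟦ σ ⟧ ∘ᴮ ⟦ ρ ⟧} {idᴮ} {idᴮ ∘ᴮ idᴮ}
          (λ _ → refl) (λ _ → FinSet.≈-refl V) h)
        (H.comp ⟦ σ ⟧ ⟦ ρ ⟧ idᴮ idᴮ h))

    τₓ : X.Carrier → X.Carrier
    τₓ (t , h) = t , to (H.hom idᴮ τ) h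

    -- A form of the orbit-stabiliser theorem without division. Each of the n ! permutations carries
    -- y to exactly one x, and that x lies in the orbit of y. If τ fixes the orbit, then y, x and τ
    -- x all lie in it, and the number of permutations carrying y to x equals that carrying τ x to
    -- x; if not, none carries τ x to x.
    orbit-sum : ∀ o → n ! ℕ.* ofDegree n o ≡
                      ∑ X (λ x → 𝟙 (o O.≟ (n , x)) ℕ.* transporters (τₓ x) x)
    orbit-sum (m , y) = byDegree y (m ℕ.≟ n)
      where
      byDegree : ∀ {m} y (d : Dec (m ≡ n)) → let o = m , y in
                 n ! ℕ.* 𝟙 (d ×-dec (to τ* o O.≟ o)) ≡
                 ∑ X (λ x → 𝟙 (o O.≟ (n , x)) ℕ.* transporters (τₓ x) x)
      byDegree {m} y (no m≢n) = trans (ℕ.*-zeroʳ (n !)) (sym (trans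
        (∑-cong X λ x → cong (ℕ._* transporters (τₓ x) x)
          (𝟙-false ((m , y) O.≟ (n , x)) (λ (σ , _) → m≢n (Perm.↔⇒≡ (bijection σ)))))
        (∑-0 X)))
      byDegree y (yes refl) = begin
        n ! ℕ.* 𝟙 (to τ* o O.≟ o)
          ≡⟨ ℕ.*-comm (n !) _ ⟩
        𝟙 (to τ* o O.≟ o) ℕ.* n !
          ≡⟨ cong (𝟙 (to τ* o O.≟ o) ℕ.*_) (∑-transporters y) ⟨
        𝟙 (to τ* o O.≟ o) ℕ.* ∑ X (transporters y)
          ≡⟨ ∑-*ˡ X (𝟙 (to τ* o O.≟ o)) (transporters y) ⟩
        ∑ X (λ x → 𝟙 (to τ* o O.≟ o) ℕ.* transporters y x)
          ≡⟨ ∑-cong X (λ x → compare x (o O.≟ (n , x)) (to τ* o O.≟ o)) ⟩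
        ∑ X (λ x → 𝟙 (o O.≟ (n , x)) ℕ.* transporters (τₓ x) x) ∎
        where
        o = n , y
        compare : ∀ x (d : Dec (o O.≈ (n , x))) (e : Dec (to τ* o O.≈ o)) →
                  𝟙 e ℕ.* transporters y x ≡ 𝟙 d ℕ.* transporters (τₓ x) x
        compare x (no o≁x) e = trans
          (cong (𝟙 e ℕ.*_) (transporters≡0 λ σ (p , q) → o≁x (⟦ σ ⟧ , p , q)))
          (ℕ.*-zeroʳ (𝟙 e))
        compare x (yes o∼x) (no τo≁o) = sym (trans (ℕ.+-identityʳ _)
          (transporters≡0 {τₓ x} {x} λ σ (p , q) → τo≁o
            (O.≈-trans {to τ* o} {n , τₓ x} {o} (to-cong τ* {o} {n , x} o∼x)
              (O.≈-trans {n , τₓ x} {n , x} {o} (⟦ σ ⟧ , p , q) (O.≈-sym {o} {n , x} o∼x)))))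
        -- Both indicators are now 1, and `1 ℕ.* t` computes to `t ℕ.+ 0`. The chain replaces the
        -- starting point y first by x and then by τ x.
        compare x (yes o∼x@(bij σ , p , q)) (yes τo∼o) = cong (ℕ._+ 0) (begin
          transporters y x       ≡⟨ transporters-move σ x (p , q) ⟨
          transporters x x       ≡⟨ transporters-move ρ x (p′ , q′) ⟨
          transporters (τₓ x) x  ∎)
          where
          x∼τx : (n , x) O.≈ (n , τₓ x)
          x∼τx = O.≈-sym {n , τₓ x} {n , x} (O.≈-trans {n , τₓ x} {to τ* o} {n , x}
            (O.≈-sym {to τ* o} {n , τₓ x} (to-cong τ* {o} {n , x} o∼x))
            (O.≈-trans {to τ* o} {o} {n , x} τo∼o o∼x))
          ρ  = bijection (proj₁ x∼τx)
          p′ = proj₁ (proj₂ x∼τx)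
          q′ = proj₂ (proj₂ x∼τx)

    -- Both sides count the pairs (σ, x) with σ τ x = x.
    burnside : n ! ℕ.* fixedOfDegree n ≡
               ∑ (𝔖 n) (λ σ → fixedPoints (F.hom ⟦ σ ⟧) ℕ.* fixedPoints (H.hom ⟦ σ ⟧ τ))
    burnside = begin
      n ! ℕ.* ∑ O (ofDegree n)
        ≡⟨ ∑-*ˡ O (n !) (ofDegree n) ⟩
      ∑ O (λ o → n ! ℕ.* ofDegree n o)
        ≡⟨ ∑-cong O orbit-sum ⟩
      ∑ O (λ o → ∑ X (λ x → 𝟙 (o O.≟ (n , x)) ℕ.* transporters (τₓ x) x))
        ≡⟨ ∑-comm O X _ ⟩
      ∑ X (λ x → ∑ O (λ o → 𝟙 (o O.≟ (n , x)) ℕ.* transporters (τₓ x) x))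
        ≡⟨ ∑-cong X (λ x → trans (sym (∑-*ʳ O (transporters (τₓ x) x) _))
             (trans (cong (ℕ._* transporters (τₓ x) x) (∑-δ O (n , x))) (ℕ.*-identityˡ _))) ⟩
      ∑ X (λ x → transporters (τₓ x) x)
        ≡⟨ ∑-comm X (𝔖 n) _ ⟩
      ∑ (𝔖 n) (λ σ → ∑ X (λ x → 𝟙 (act σ (τₓ x) X.≟ x)))
        ≡⟨ ∑-cong (𝔖 n) (λ σ → begin
             ∑ X (λ x → 𝟙 (act σ (τₓ x) X.≟ x))
               ≡⟨ ∑-cong X (λ (t , h) → trans
                    (𝟙-cong (act σ (τₓ (t , h)) X.≟ (t , h)) (fixed? σ t ×-dec fixed₂? σ h)
                      (λ (p , q) → p , B.≈-trans (B.≈-sym (split σ h)) q)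
                      (λ (p , q) → p , B.≈-trans (split σ h) q))
                    (𝟙-× (fixed? σ t) (fixed₂? σ h))) ⟩
             ∑ X (λ (t , h) → 𝟙 (fixed? σ t) ℕ.* 𝟙 (fixed₂? σ h))
               ≡⟨ ∑-×-* A B _ _ ⟩
             ∑ A (λ t → 𝟙 (fixed? σ t)) ℕ.* ∑ B (λ h → 𝟙 (fixed₂? σ h))
               ≡⟨ cong₂ ℕ._*_ (fixedPoints≡∑ (F.hom ⟦ σ ⟧)) (fixedPoints≡∑ (H.hom ⟦ σ ⟧ τ)) ⟨
             fixedPoints (F.hom ⟦ σ ⟧) ℕ.* fixedPoints (H.hom ⟦ σ ⟧ τ) ∎) ⟩
      ∑ (𝔖 n) (λ σ → fixedPoints (F.hom ⟦ σ ⟧) ℕ.* fixedPoints (H.hom ⟦ σ ⟧ τ)) ∎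
      where
      fixed? : ∀ σ t → Dec (to (F.hom ⟦ σ ⟧) t A.≈ t)
      fixed? σ t = to (F.hom ⟦ σ ⟧) t A.≟ t
      fixed₂? : ∀ σ h → Dec (to (H.hom ⟦ σ ⟧ τ) h B.≈ h)
      fixed₂? σ h = to (H.hom ⟦ σ ⟧ τ) h B.≟ h
      split : ∀ σ h → to (H.hom ⟦ σ ⟧ idᴮ) (to (H.hom idᴮ τ) h) B.≈ to (H.hom ⟦ σ ⟧ τ) h
      split σ h = B.≈-trans (B.≈-sym (H.comp ⟦ σ ⟧ idᴮ idᴮ τ h))
        (H.resp {β = ⟦ σ ⟧ ∘ᴮ idᴮ} {⟦ σ ⟧} {idᴮ ∘ᴮ τ} {τ} (λ _ → refl) (λ _ → FinSet.≈-refl V) h)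

  -- A representative of an orbit contains an element of F[n], so its degree n is within the bound
  -- of strict finiteness and the orbit is counted for exactly one `i`.
  fixedPoints-τ* : fixedPoints τ* ≡ ∑ [ suc (proj₁ fin) ] (λ i → fixedOfDegree (toℕ i))
  fixedPoints-τ* = begin
    fixedPoints τ*
      ≡⟨ fixedPoints≡∑ τ* ⟩
    ∑ O (λ o → 𝟙 (to τ* o O.≟ o))
      ≡⟨ ∑-cong O byDegree ⟩
    ∑ O (λ o → ∑ [ suc (proj₁ fin) ] (λ i → ofDegree (toℕ i) o))
      ≡⟨ ∑-comm O [ suc (proj₁ fin) ] _ ⟩
    ∑ [ suc (proj₁ fin) ] (λ i → fixedOfDegree (toℕ i)) ∎
    where
    I = [ suc (proj₁ fin) ]
    module I = FinSet I
    byDegree : ∀ o → 𝟙 (to τ* o O.≟ o) ≡ ∑ I (λ i → ofDegree (toℕ i) o)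
    byDegree o@(n , t , h) = begin
      f                                   ≡⟨ ℕ.*-identityˡ f ⟨
      1 ℕ.* f                               ≡⟨ cong (ℕ._* f) (∑-δ I d) ⟨
      ∑ I (λ i → 𝟙 (i I.≟ d)) ℕ.* f         ≡⟨ ∑-*ʳ I f _ ⟩
      ∑ I (λ i → 𝟙 (i I.≟ d) ℕ.* f)         ≡⟨ ∑-cong I (λ i → trans
        (cong (ℕ._* f) (𝟙-cong (i I.≟ d) (n ℕ.≟ toℕ i)
          (λ e → trans (sym (Fin.toℕ-fromℕ< n≤N)) (cong toℕ (sym e)))
          (λ e → Fin.toℕ-injective (trans (sym e) (sym (Fin.toℕ-fromℕ< n≤N))))))
        (sym (𝟙-× (n ℕ.≟ toℕ i) (to τ* o O.≟ o)))) ⟩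
      ∑ I (λ i → ofDegree (toℕ i) o)      ∎
      where
      f = 𝟙 (to τ* o O.≟ o)
      n≤N = s≤s (ℕ.≮⇒≥ (λ N<n → proj₂ fin n N<n t))
      d = fromℕ< n≤N

-- Equivariant functions

infixl 10 _^ᴮ_

-- The single factor acts first, as in `_^ₚ_`, so that functoriality compares the two powers one
-- factor at a time.
_^ᴮ_ : ∀ {A} → A ≅ A → ℕ → A ≅ A
α ^ᴮ zero  = idᴮ
α ^ᴮ suc k = α ^ᴮ k ∘ᴮ α

hom-^ : ∀ (G : Species) {n} (σ : Permutation′ n) k →
        Species.hom G ⟦ σ ^ₚ k ⟧ ≋ Species.hom G ⟦ σ ⟧ ^ᴮ k
hom-^ G {n} σ zero    x = Species.ident G {[ n ]} x
hom-^ G {n} σ (suc k) x = FinSet.≈-trans (Species.obj G [ n ])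
  (Species.comp G ⟦ σ ^ₚ k ⟧ ⟦ σ ⟧ x) (hom-^ G σ k _)

module _ {B : FinSet} (α : B ≅ B) where
  private module B = FinSet B

  ^ᴮ-comm : ∀ k b → to α (to (α ^ᴮ k) b) B.≈ to (α ^ᴮ k) (to α b)
  ^ᴮ-comm zero    b = B.≈-refl
  ^ᴮ-comm (suc k) b = ^ᴮ-comm k (to α b)

  Equivariant : ∀ {n} → Permutation′ n → Pred ∣ Functions [ n ] B ∣ 0ℓ
  Equivariant σ f = ∀ x → to α (Func.to f x) B.≈ Func.to f (σ ⟨$⟩ʳ x)

  equivariant? : ∀ {n} (σ : Permutation′ n) → Decidable (Equivariant σ)
  equivariant? σ f = Fin.all? λ x → to α (Func.to f x) B.≟ Func.to f (σ ⟨$⟩ʳ x)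

  equivariants : ∀ {n} → Permutation′ n → ℕ
  equivariants {n} σ = ∑ (Functions [ n ] B) (λ f → 𝟙 (equivariant? σ f))

  private
    function : ∀ {n} → (Fin n → B.Carrier) → ∣ Functions [ n ] B ∣
    function f = record { to = f ; cong = λ { refl → B.≈-refl } }

  -- An equivariant function on a cycle is determined by its value at one point b, and the
  -- values of b are the fixed points of α ^ length.
  equivariants-rotation : ∀ k {n} (ρ : Permutation′ n) →
    equivariants (rotation k ⊕ ρ) ≡ fixedPoints (α ^ᴮ suc k) ℕ.* equivariants ρ
  equivariants-rotation k {n} ρ = begin
    equivariants (rotation k ⊕ ρ)
      ≡⟨ ∑-partial-bijection (Functions [ suc k ℕ.+ n ] B) (B ×ᴮ Functions [ n ] B)
           (equivariant? (rotation k ⊕ ρ)) (λ (b , g) → fixed? b ×-dec equivariant? ρ g)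
           (λ f → Func.to f zero , function (λ j → Func.to f (suc k ↑ʳ j)))
           (λ (b , g) → function (extend b g))
           (λ {f} p {bg} → there {f} p {bg}) (λ {bg} q {f} → back {bg} q {f}) ⟩
    ∑ (B ×ᴮ Functions [ n ] B) (λ (b , g) → 𝟙 (fixed? b ×-dec equivariant? ρ g))
      ≡⟨ ∑-cong (B ×ᴮ Functions [ n ] B) (λ (b , g) → 𝟙-× (fixed? b) (equivariant? ρ g)) ⟩
    ∑ (B ×ᴮ Functions [ n ] B) (λ (b , g) → 𝟙 (fixed? b) ℕ.* 𝟙 (equivariant? ρ g))
      ≡⟨ ∑-×-* B (Functions [ n ] B) _ _ ⟩
    ∑ B (λ b → 𝟙 (fixed? b)) ℕ.* equivariants ρ
      ≡⟨ cong (ℕ._* equivariants ρ) (fixedPoints≡∑ (α ^ᴮ suc k)) ⟨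
    fixedPoints (α ^ᴮ suc k) ℕ.* equivariants ρ ∎
    where
    open ≡-Reasoning
    σ = rotation k ⊕ ρ

    fixed? : ∀ b → Dec (to (α ^ᴮ suc k) b B.≈ b)
    fixed? b = to (α ^ᴮ suc k) b B.≟ b

    extend : B.Carrier → ∣ Functions [ n ] B ∣ → Fin (suc k ℕ.+ n) → B.Carrier
    extend b g = [ (λ i → to (α ^ᴮ toℕ i) b) ∣ Func.to g ]ᶠ

    extend-↑ˡ : ∀ b g i → extend b g (i ↑ˡ n) ≡ to (α ^ᴮ toℕ i) b
    extend-↑ˡ b g = [∣]-↑ˡ {suc k} _ (Func.to g)

    extend-↑ʳ : ∀ b g j → extend b g (suc k ↑ʳ j) ≡ Func.to g j
    extend-↑ʳ b g = [∣]-↑ʳ {suc k} (λ i → to (α ^ᴮ toℕ i) b) (Func.to g)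

    σ-inject₁ : ∀ i → σ ⟨$⟩ʳ (inject₁ i ↑ˡ n) ≡ suc i ↑ˡ n
    σ-inject₁ i = trans (⊕-↑ˡ (rotation k) ρ (inject₁ i)) (cong (_↑ˡ n) (rotation-inject₁ k i))

    σ-fromℕ : σ ⟨$⟩ʳ (fromℕ k ↑ˡ n) ≡ zero
    σ-fromℕ = trans (⊕-↑ˡ (rotation k) ρ (fromℕ k)) (cong (_↑ˡ n) (rotation-fromℕ k))

    σ-↑ʳ : ∀ j → σ ⟨$⟩ʳ (suc k ↑ʳ j) ≡ suc k ↑ʳ (ρ ⟨$⟩ʳ j)
    σ-↑ʳ = ⊕-↑ʳ (rotation k) ρ

    there : ∀ {f} → Equivariant σ f → ∀ {bg} →
            (proj₁ bg B.≈ Func.to f zero) × (∀ j → Func.to (proj₂ bg) j B.≈ Func.to f (suc k ↑ʳ j)) →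
            ((to (α ^ᴮ suc k) (proj₁ bg) B.≈ proj₁ bg) × Equivariant ρ (proj₂ bg)) ×
            (∀ x → Func.to f x B.≈ extend (proj₁ bg) (proj₂ bg) x)
    there {f} eq {b , g} (b≈ , g≈) = (b-fixed , g-eq) , agree
      where
      powers : ∀ i → Func.to f (i ↑ˡ n) B.≈ to (α ^ᴮ toℕ i) b
      powers = <-weakInduction (λ i → Func.to f (i ↑ˡ n) B.≈ to (α ^ᴮ toℕ i) b) (B.≈-sym b≈) λ i p →
        B.≈-trans (B.reflexive (cong (Func.to f) (sym (σ-inject₁ i))))
          (B.≈-trans (B.≈-sym (eq (inject₁ i ↑ˡ n)))
            (B.≈-trans (to-cong α p)
              (B.≈-trans (^ᴮ-comm (toℕ (inject₁ i)) b)
                (B.reflexive (cong (λ m → to (α ^ᴮ suc m) b) (Fin.toℕ-inject₁ i))))))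
      -- Closing the cycle: the last point has the value αᵏ b, and equivariance there equates its
      -- image under α with the value at zero, which is b.
      b-fixed : to (α ^ᴮ suc k) b B.≈ b
      b-fixed = B.≈-trans (B.≈-sym (^ᴮ-comm k b))
        (B.≈-trans (to-cong α (B.≈-trans
            (B.reflexive (cong (λ m → to (α ^ᴮ m) b) (sym (Fin.toℕ-fromℕ k))))
            (B.≈-sym (powers (fromℕ k)))))
          (B.≈-trans (eq (fromℕ k ↑ˡ n))
            (B.≈-trans (B.reflexive (cong (Func.to f) σ-fromℕ)) (B.≈-sym b≈))))
      g-eq : Equivariant ρ g
      g-eq j = B.≈-trans (to-cong α (g≈ j)) (B.≈-trans (eq (suc k ↑ʳ j))
        (B.≈-trans (B.reflexive (cong (Func.to f) (σ-↑ʳ j))) (B.≈-sym (g≈ (ρ ⟨$⟩ʳ j)))))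
      agree : ∀ x → Func.to f x B.≈ extend b g x
      agree = ↑-elim (suc k) _
        (λ i → B.≈-trans (powers i) (B.reflexive (sym (extend-↑ˡ b g i))))
        (λ j → B.≈-trans (B.≈-sym (g≈ j)) (B.reflexive (sym (extend-↑ʳ b g j))))

    back : ∀ {bg} → (to (α ^ᴮ suc k) (proj₁ bg) B.≈ proj₁ bg) × Equivariant ρ (proj₂ bg) → ∀ {f} →
           (∀ x → Func.to f x B.≈ extend (proj₁ bg) (proj₂ bg) x) →
           Equivariant σ f ×
           (proj₁ bg B.≈ Func.to f zero) × (∀ j → Func.to (proj₂ bg) j B.≈ Func.to f (suc k ↑ʳ j))
    back {b , g} (b-fixed , g-eq) {f} f≈ = eq , B.≈-sym (powers zero) , (λ j → B.≈-sym (values j))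
      where
      powers : ∀ i → Func.to f (i ↑ˡ n) B.≈ to (α ^ᴮ toℕ i) b
      powers i = B.≈-trans (f≈ (i ↑ˡ n)) (B.reflexive (extend-↑ˡ b g i))
      values : ∀ j → Func.to f (suc k ↑ʳ j) B.≈ Func.to g j
      values j = B.≈-trans (f≈ (suc k ↑ʳ j)) (B.reflexive (extend-↑ʳ b g j))
      eq : Equivariant σ f
      eq = ↑-elim (suc k) _
        (inject₁-elim _
          (λ i → B.≈-trans (to-cong α (powers (inject₁ i)))
            (B.≈-trans (^ᴮ-comm (toℕ (inject₁ i)) b)
              (B.≈-trans (B.reflexive (cong (λ m → to (α ^ᴮ suc m) b) (Fin.toℕ-inject₁ i)))
                (B.≈-trans (B.≈-sym (powers (suc i)))
                  (B.reflexive (cong (Func.to f) (sym (σ-inject₁ i))))))))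
          (B.≈-trans (to-cong α (powers (fromℕ k)))
            (B.≈-trans (^ᴮ-comm (toℕ (fromℕ k)) b)
              (B.≈-trans (B.reflexive (cong (λ m → to (α ^ᴮ suc m) b) (Fin.toℕ-fromℕ k)))
                (B.≈-trans b-fixed (B.≈-trans (B.≈-sym (powers zero))
                  (B.reflexive (cong (Func.to f) (sym σ-fromℕ)))))))))
        (λ j → B.≈-trans (to-cong α (values j)) (B.≈-trans (g-eq j)
          (B.≈-trans (B.≈-sym (values (ρ ⟨$⟩ʳ j))) (B.reflexive (cong (Func.to f) (sym (σ-↑ʳ j)))))))

  -- Entries must be nonzero: an entry 0 adds no block to `cycles`, but it would add the factor
  -- `fixedPoints idᴮ` to the product.
  equivariants-cycles : ∀ {ks} → All NonZero ks →
                        equivariants (cycles ks) ≡ product (map (λ k → fixedPoints (α ^ᴮ k)) ks)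
  equivariants-cycles [] = trans
    (∑-cong (Functions [ 0 ] B) λ f → 𝟙-true (equivariant? Perm.id f) λ ())
    -- The set of functions on the empty set has size `B.size ^ 0`, which is the empty product 1.
    (∑-1 (Functions [ 0 ] B))
  equivariants-cycles {suc k ∷ ks} (_ ∷ ≢0) = trans
    (equivariants-rotation k (cycles ks))
    (cong (fixedPoints (α ^ᴮ suc k) ℕ.*_) (equivariants-cycles ≢0))

-- The transport of f is α ∘ f ∘ σ⁻¹. Evaluating its equality with f at σ x turns it into α ∘ f = f
-- ∘ σ, and evaluating the latter at σ⁻¹ x leads back.
fixedPoints-Φ : ∀ (G : Species) {V} {n} (σ : Permutation′ n) (τ : V ≅ V) →
  fixedPoints (Species₂.hom (Φ G) ⟦ σ ⟧ τ) ≡ equivariants (Species.hom G τ) σ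
fixedPoints-Φ G {V} {n} σ τ = trans (fixedPoints≡∑ (Species₂.hom (Φ G) ⟦ σ ⟧ τ))
  (∑-cong E λ f → 𝟙-cong (to (Species₂.hom (Φ G) ⟦ σ ⟧ τ) f E.≟ f)
    (equivariant? α σ f)
    (λ e x → B.≈-trans (to-cong α (B.reflexive (cong (Func.to f) (sym (Perm.inverseˡ σ))))) (e (σ ⟨$⟩ʳ x)))
    (λ e x → B.≈-trans (e (σ ⟨$⟩ˡ x)) (B.reflexive (cong (Func.to f) (Perm.inverseʳ σ)))))
  where
  α = Species.hom G τ
  B = Species.obj G V
  E = Functions [ n ] B
  module B = FinSet B
  module E = FinSet E

-- Cycle types

^ₚ-suc : ∀ {n} (σ : Permutation′ n) k x → σ ^ₚ suc k ⟨$⟩ʳ x ≡ σ ⟨$⟩ʳ (σ ^ₚ k ⟨$⟩ʳ x)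
^ₚ-suc σ zero    x = refl
^ₚ-suc σ (suc k) x = ^ₚ-suc σ k (σ ⟨$⟩ʳ x)

^ₚ-comm : ∀ {n} (σ : Permutation′ n) j k x →
          σ ^ₚ j ⟨$⟩ʳ (σ ^ₚ k ⟨$⟩ʳ x) ≡ σ ^ₚ k ⟨$⟩ʳ (σ ^ₚ j ⟨$⟩ʳ x)
^ₚ-comm σ zero    k x = refl
^ₚ-comm σ (suc j) k x = trans (cong (σ ^ₚ j ⟨$⟩ʳ_) (sym (^ₚ-suc σ k x))) (^ₚ-comm σ j k (σ ⟨$⟩ʳ x))

^ₚ-∼ : ∀ {m n} {σ : Permutation′ m} {ρ : Permutation′ n} (c : σ ∼ ρ) k x →
       ρ ^ₚ k ⟨$⟩ʳ (_∼_.by c ⟨$⟩ʳ x) ≡ _∼_.by c ⟨$⟩ʳ (σ ^ₚ k ⟨$⟩ʳ x)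
^ₚ-∼ c zero    x = refl
^ₚ-∼ {σ = σ} {ρ} c (suc k) x = trans
  (cong (ρ ^ₚ k ⟨$⟩ʳ_) (_∼_.intertwines c x)) (^ₚ-∼ c k (σ ⟨$⟩ʳ x))

module _ {m n} (σ : Permutation′ m) (ρ : Permutation′ n) where
  ⊕-^-↑ˡ : ∀ k i → (σ ⊕ ρ) ^ₚ k ⟨$⟩ʳ (i ↑ˡ n) ≡ (σ ^ₚ k ⟨$⟩ʳ i) ↑ˡ n
  ⊕-^-↑ˡ zero    i = refl
  ⊕-^-↑ˡ (suc k) i = trans (cong ((σ ⊕ ρ) ^ₚ k ⟨$⟩ʳ_) (⊕-↑ˡ σ ρ i)) (⊕-^-↑ˡ k (σ ⟨$⟩ʳ i))

  ⊕-^-↑ʳ : ∀ k j → (σ ⊕ ρ) ^ₚ k ⟨$⟩ʳ (m ↑ʳ j) ≡ m ↑ʳ (ρ ^ₚ k ⟨$⟩ʳ j)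
  ⊕-^-↑ʳ zero    j = refl
  ⊕-^-↑ʳ (suc k) j = trans (cong ((σ ⊕ ρ) ^ₚ k ⟨$⟩ʳ_) (⊕-↑ʳ σ ρ j)) (⊕-^-↑ʳ k (ρ ⟨$⟩ʳ j))

  count-⊕ : ∀ k → count (inCycle? (σ ⊕ ρ) k) ≡ count (inCycle? σ k) ℕ.+ count (inCycle? ρ k)
  count-⊕ k = trans (sum-++ m (λ x → 𝟙 (inCycle? (σ ⊕ ρ) k x))) (cong₂ ℕ._+_
    (Σℕ.sum-cong-≗ {m} λ i → 𝟙-cong (inCycle? (σ ⊕ ρ) k (i ↑ˡ n)) (inCycle? σ k i)
      (λ (p , q) → Fin.↑ˡ-injective n _ _ (trans (sym (⊕-^-↑ˡ (suc k) i)) p)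
        , λ j e → q j (trans (⊕-^-↑ˡ (suc (toℕ j)) i) (cong (_↑ˡ n) e)))
      (λ (p , q) → trans (⊕-^-↑ˡ (suc k) i) (cong (_↑ˡ n) p)
        , λ j e → q j (Fin.↑ˡ-injective n _ _ (trans (sym (⊕-^-↑ˡ (suc (toℕ j)) i)) e))))
    (Σℕ.sum-cong-≗ {n} λ i → 𝟙-cong (inCycle? (σ ⊕ ρ) k (m ↑ʳ i)) (inCycle? ρ k i)
      (λ (p , q) → Fin.↑ʳ-injective m _ _ (trans (sym (⊕-^-↑ʳ (suc k) i)) p)
        , λ j e → q j (trans (⊕-^-↑ʳ (suc (toℕ j)) i) (cong (m ↑ʳ_) e)))
      (λ (p , q) → trans (⊕-^-↑ʳ (suc k) i) (cong (m ↑ʳ_) p)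
        , λ j e → q j (Fin.↑ʳ-injective m _ _ (trans (sym (⊕-^-↑ʳ (suc (toℕ j)) i)) e)))))

module _ (m : ℕ) where
  private r = rotation m

  rotation-^-zero : ∀ i → r ^ₚ toℕ i ⟨$⟩ʳ zero ≡ i
  rotation-^-zero = <-weakInduction (λ i → r ^ₚ toℕ i ⟨$⟩ʳ zero ≡ i) refl λ i e → begin
    r ^ₚ suc (toℕ i) ⟨$⟩ʳ zero               ≡⟨ ^ₚ-suc r (toℕ i) zero ⟩
    r ⟨$⟩ʳ (r ^ₚ toℕ i ⟨$⟩ʳ zero)            ≡⟨ cong (λ j → r ⟨$⟩ʳ (r ^ₚ j ⟨$⟩ʳ zero)) (Fin.toℕ-inject₁ i) ⟨
    r ⟨$⟩ʳ (r ^ₚ toℕ (inject₁ i) ⟨$⟩ʳ zero)  ≡⟨ cong (r ⟨$⟩ʳ_) e ⟩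
    r ⟨$⟩ʳ inject₁ i                         ≡⟨ rotation-inject₁ m i ⟩
    suc i                                    ∎
    where open ≡-Reasoning

  rotation-period : ∀ x → r ^ₚ suc m ⟨$⟩ʳ x ≡ x
  rotation-period x = begin
    r ^ₚ suc m ⟨$⟩ʳ x                           ≡⟨ cong (r ^ₚ suc m ⟨$⟩ʳ_) (rotation-^-zero x) ⟨
    r ^ₚ suc m ⟨$⟩ʳ (r ^ₚ toℕ x ⟨$⟩ʳ zero)      ≡⟨ ^ₚ-comm r (suc m) (toℕ x) zero ⟩
    r ^ₚ toℕ x ⟨$⟩ʳ (r ^ₚ suc m ⟨$⟩ʳ zero)      ≡⟨ cong (r ^ₚ toℕ x ⟨$⟩ʳ_) (begin
      r ^ₚ suc m ⟨$⟩ʳ zero                        ≡⟨ ^ₚ-suc r m zero ⟩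
      r ⟨$⟩ʳ (r ^ₚ m ⟨$⟩ʳ zero)                   ≡⟨ cong (λ j → r ⟨$⟩ʳ (r ^ₚ j ⟨$⟩ʳ zero)) (Fin.toℕ-fromℕ m) ⟨
      r ⟨$⟩ʳ (r ^ₚ toℕ (fromℕ m) ⟨$⟩ʳ zero)       ≡⟨ cong (r ⟨$⟩ʳ_) (rotation-^-zero (fromℕ m)) ⟩
      r ⟨$⟩ʳ fromℕ m                              ≡⟨ rotation-fromℕ m ⟩
      zero                                        ∎) ⟩
    r ^ₚ toℕ x ⟨$⟩ʳ zero                        ≡⟨ rotation-^-zero x ⟩
    x                                           ∎
    where open ≡-Reasoning

  -- Powers of the rotation commute and one of them carries zero to x, so if x were fixed, zero
  -- would be fixed too. But zero goes to j + 1, which is still a point of the block because j < m.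
  rotation-^-moves : ∀ {j} → j < m → ∀ x → r ^ₚ suc j ⟨$⟩ʳ x ≢ x
  rotation-^-moves {j} j<m x e = Fin.0≢1+n (begin
    zero                                   ≡⟨ injective (begin
      r ^ₚ toℕ x ⟨$⟩ʳ (r ^ₚ suc j ⟨$⟩ʳ zero)   ≡⟨ ^ₚ-comm r (toℕ x) (suc j) zero ⟩
      r ^ₚ suc j ⟨$⟩ʳ (r ^ₚ toℕ x ⟨$⟩ʳ zero)   ≡⟨ cong (r ^ₚ suc j ⟨$⟩ʳ_) (rotation-^-zero x) ⟩
      r ^ₚ suc j ⟨$⟩ʳ x                        ≡⟨ e ⟩
      x                                        ≡⟨ rotation-^-zero x ⟨
      r ^ₚ toℕ x ⟨$⟩ʳ zero                     ∎) ⟨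
    r ^ₚ suc j ⟨$⟩ʳ zero                   ≡⟨ cong (λ i → r ^ₚ suc i ⟨$⟩ʳ zero) (Fin.toℕ-fromℕ< j<m) ⟨
    r ^ₚ toℕ (suc (fromℕ< j<m)) ⟨$⟩ʳ zero  ≡⟨ rotation-^-zero (suc (fromℕ< j<m)) ⟩
    suc (fromℕ< j<m)                       ∎)
    where
    open ≡-Reasoning
    injective : ∀ {y z} → r ^ₚ toℕ x ⟨$⟩ʳ y ≡ r ^ₚ toℕ x ⟨$⟩ʳ z → y ≡ z
    injective e = trans (sym (Perm.inverseˡ (r ^ₚ toℕ x)))
      (trans (cong (r ^ₚ toℕ x ⟨$⟩ˡ_) e) (Perm.inverseˡ (r ^ₚ toℕ x)))

  -- If k < m, the power k + 1 has no fixed point. If k > m, the power m + 1 already returns x,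
  -- against the minimality in `InCycle`.
  inCycle⇒≡ : ∀ {k x} → InCycle r k x → k ≡ m
  inCycle⇒≡ {k} {x} (p , q) with ℕ.<-cmp k m
  ... | tri< k<m _ _ = contradiction p (rotation-^-moves k<m x)
  ... | tri≈ _ k≡m _ = k≡m
  ... | tri> _ _ m<k = contradiction
    (trans (cong (λ i → r ^ₚ suc i ⟨$⟩ʳ x) (Fin.toℕ-fromℕ< m<k)) (rotation-period x))
    (q (fromℕ< m<k))

  ≡⇒inCycle : ∀ {k} → k ≡ m → ∀ x → InCycle r k x
  ≡⇒inCycle refl x = rotation-period x , λ j → rotation-^-moves (Fin.toℕ<n j) x

  count-rotation : ∀ k → count (inCycle? r k) ≡ suc k ℕ.* 𝟙 (suc k ℕ.≟ suc m)
  count-rotation k = begin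
    count (inCycle? r k)
      ≡⟨ Σℕ.sum-cong-≗ {suc m} (λ x → trans
           (𝟙-cong (inCycle? r k x) (suc k ℕ.≟ suc m) (cong suc ∘ inCycle⇒≡)
             (λ e → ≡⇒inCycle (ℕ.suc-injective e) x))
           (sym (ℕ.*-identityʳ _))) ⟩
    Σℕ.sum {suc m} (λ _ → d ℕ.* 1)
      ≡⟨ Σℕ.*-distribˡ-sum {suc m} d (λ _ → 1) ⟨
    d ℕ.* Σℕ.sum {suc m} (λ _ → 1)
      ≡⟨ cong (d ℕ.*_) (trans (sym (∑-Fin (suc m) (λ _ → 1))) (∑-1 [ suc m ])) ⟩
    d ℕ.* suc m
      ≡⟨ same (suc k ℕ.≟ suc m) ⟩
    suc k ℕ.* d ∎
    where
    open ≡-Reasoning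
    d = 𝟙 (suc k ℕ.≟ suc m)
    same : (e : Dec (suc k ≡ suc m)) → 𝟙 e ℕ.* suc m ≡ suc k ℕ.* 𝟙 e
    same (yes refl) = ℕ.*-comm 1 (suc m)
    same (no _)     = sym (ℕ.*-zeroʳ (suc k))

-- Multiplicities and the recovery of the cycle type

occurrences : ℕ → List ℕ → ℕ
occurrences k ps = length (filter (k ℕ.≟_) ps)

occurrences-∷ : ∀ k l ps → occurrences k (l ∷ ps) ≡ 𝟙 (k ℕ.≟ l) ℕ.+ occurrences k ps
occurrences-∷ k l ps = byCases (k ℕ.≟ l)
  where
  byCases : Dec (k ≡ l) → occurrences k (l ∷ ps) ≡ 𝟙 (k ℕ.≟ l) ℕ.+ occurrences k ps
  byCases (yes k≡l) = trans (cong length (List.filter-accept (k ℕ.≟_) k≡l))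
    (cong (ℕ._+ occurrences k ps) (sym (𝟙-true (k ℕ.≟ l) k≡l)))
  byCases (no k≢l) = trans (cong length (List.filter-reject (k ℕ.≟_) k≢l))
    (cong (ℕ._+ occurrences k ps) (sym (𝟙-false (k ℕ.≟ l) k≢l)))

count-cycles : ∀ ks k → count (inCycle? (cycles ks) k) ≡ suc k ℕ.* occurrences (suc k) ks
count-cycles []           k = sym (ℕ.*-zeroʳ (suc k))
count-cycles (zero ∷ ks)  k = count-cycles ks k
count-cycles (suc l ∷ ks) k = trans (count-⊕ (rotation l) (cycles ks) k)
  (trans (cong₂ ℕ._+_ (count-rotation l k) (count-cycles ks k))
    (trans (sym (ℕ.*-distribˡ-+ (suc k) (𝟙 (suc k ℕ.≟ suc l)) (occurrences (suc k) ks)))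
      (cong (suc k ℕ.*_) (sym (occurrences-∷ (suc k) (suc l) ks)))))

cycleCount-cycles : ∀ ks k → cycleCount (cycles ks) k ≡ occurrences (suc k) ks
cycleCount-cycles ks k = trans
  (cong (_/ suc k) (trans (count-cycles ks k) (ℕ.*-comm (suc k) (occurrences (suc k) ks))))
  (ℕ.m*n/n≡m (occurrences (suc k) ks) (suc k))

partsWith : (ℕ → ℕ) → ℕ → List ℕ
partsWith m n = Partition.parts (PartsUpTo.toPartition (withMultiplicities m n))

partsWith-cong : ∀ {m m′} n → (∀ i → i < n → m i ≡ m′ i) → partsWith m n ≡ partsWith m′ n
partsWith-cong zero    eq = refl
partsWith-cong (suc n) eq = cong₂ (λ j ps → replicate j (suc n) ++ ps)
  (eq n ℕ.≤-refl) (partsWith-cong n (λ i i<n → eq i (ℕ.m≤n⇒m≤1+n i<n)))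

-- The extra copy of l + 1 appears at its place in the decreasing list, behind the larger parts, and
-- a permutation of the list brings it to the front.
partsWith-suc : ∀ m {l n} → l < n →
                partsWith (λ k → 𝟙 (suc k ℕ.≟ suc l) ℕ.+ m k) n ↭ suc l ∷ partsWith m n
partsWith-suc m {l} {suc n} l<1+n with l ℕ.≟ n
... | yes refl = ↭-reflexive (cong₂ (λ j ps → replicate j (suc n) ++ ps)
  (cong (ℕ._+ m n) (𝟙-true (suc n ℕ.≟ suc n) refl))
  (partsWith-cong n (λ i i<n → cong (ℕ._+ m i)
    (𝟙-false (suc i ℕ.≟ suc n) (λ e → ℕ.<⇒≢ i<n (ℕ.suc-injective e))))))
... | no l≢n = ↭-trans
  (↭-reflexive (cong (λ j → replicate j (suc n) ++ partsWith m′ n)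
    (cong (ℕ._+ m n) (𝟙-false (suc n ℕ.≟ suc l) (λ e → l≢n (sym (ℕ.suc-injective e)))))))
  (↭-trans (↭.++⁺ˡ (replicate (m n) (suc n)) (partsWith-suc m (ℕ.≤∧≢⇒< (s≤s⁻¹ l<1+n) l≢n)))
    (↭.shift (suc l) (replicate (m n) (suc n)) (partsWith m n)))
  where m′ = λ k → 𝟙 (suc k ℕ.≟ suc l) ℕ.+ m k

partsWith-0 : ∀ n → partsWith (λ _ → 0) n ≡ []
partsWith-0 zero    = refl
partsWith-0 (suc n) = partsWith-0 n

partsWith-occurrences : ∀ {n ks} → All NonZero ks → All (_≤ n) ks →
                        partsWith (λ k → occurrences (suc k) ks) n ↭ ks
partsWith-occurrences {n}             []        []         = ↭-reflexive (partsWith-0 n)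
partsWith-occurrences {n} {suc l ∷ ks} (_ ∷ ≢0) (l<n ∷ ≤n) = ↭-trans
  (↭-trans (↭-reflexive (partsWith-cong n λ k _ → occurrences-∷ (suc k) (suc l) ks))
    (partsWith-suc (λ k → occurrences (suc k) ks) l<n))
  (↭.prep (suc l) (partsWith-occurrences ≢0 ≤n))

parts≤sum : ∀ ks → All (_≤ sum ks) ks
parts≤sum []       = []
parts≤sum (k ∷ ks) = ℕ.m≤m+n k (sum ks) ∷ All.map (λ l≤ → ℕ.≤-trans l≤ (ℕ.m≤n+m (sum ks) k)) (parts≤sum ks)

-- For σ conjugate to `cycles ks`, counting points recovers the multiplicities of `ks`; the cycle
-- type is then `ks` in decreasing order, and reordering does not change the conjugacy class.
ofType-cycleType : ∀ {n} (σ : Permutation′ n) → ofType (cycleType σ) ∼ σ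
ofType-cycleType σ = fromDecomposition σ (cycles-decomposition σ)
  where
  -- `cycleType-intertwine` compares permutations of one set `Fin n`, so n is first identified with
  -- `sum ks`.
  sameSize : ∀ {n} (σ : Permutation′ n) ks → All NonZero ks → n ≡ sum ks → σ ∼ cycles ks →
             ofType (cycleType σ) ∼ σ
  sameSize σ ks ≢0 refl c = ∼-trans
    (subst (λ λs → ofType (cycleType σ) ∼ ofType λs)
      (sym (cycleType-intertwine (_∼_.by c) σ (cycles ks) (^ₚ-∼ c))) ∼-refl)
    (∼-trans (cycles-↭ (↭-trans
        (↭-reflexive (partsWith-cong (sum ks) (λ i _ → cycleCount-cycles ks i)))
        (partsWith-occurrences ≢0 (parts≤sum ks))))
      (∼-sym c))
  fromDecomposition : ∀ {n} (σ : Permutation′ n) → (∃ λ ks → All NonZero ks × σ ∼ cycles ks) →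
                      ofType (cycleType σ) ∼ σ
  fromDecomposition σ (ks , ≢0 , c) = sameSize σ ks ≢0 (Perm.↔⇒≡ (_∼_.by c)) c

fixedPoints-invariant : (F : Species) → Invariant (λ {n} σ → fixedPoints (Species.hom F ⟦ σ ⟧))
fixedPoints-invariant F {m} {n} {σ} {ρ} (conj τ e) =
  fixedPoints-conjugate (F.hom ⟦ τ ⟧) (F.hom ⟦ σ ⟧) (F.hom ⟦ ρ ⟧) λ t →
    ≈-trans (≈-sym (F.comp ⟦ ρ ⟧ ⟦ τ ⟧ t))
      (≈-trans (F.resp {f = ⟦ ρ ⟧ ∘ᴮ ⟦ τ ⟧} {⟦ τ ⟧ ∘ᴮ ⟦ σ ⟧} e t) (F.comp ⟦ τ ⟧ ⟦ σ ⟧ t))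
  where
  module F = Species F
  open FinSet (F.obj [ n ]) using (≈-trans; ≈-sym)

fixedPoints₂-invariant : (H : Species₂) {V : FinSet} (θ : V ≅ V) →
  Invariant (λ {n} σ → fixedPoints (Species₂.hom H ⟦ σ ⟧ θ))
fixedPoints₂-invariant H {V} θ {m} {n} {σ} {ρ} (conj τ e) =
  fixedPoints-conjugate (H.hom ⟦ τ ⟧ idᴮ) (H.hom ⟦ σ ⟧ θ) (H.hom ⟦ ρ ⟧ θ) λ h →
    ≈-trans (≈-sym (H.comp ⟦ ρ ⟧ ⟦ τ ⟧ θ idᴮ h))
      (≈-trans
        (H.resp {β = ⟦ ρ ⟧ ∘ᴮ ⟦ τ ⟧} {⟦ τ ⟧ ∘ᴮ ⟦ σ ⟧} {θ ∘ᴮ idᴮ} {idᴮ ∘ᴮ θ} e (λ _ → FinSet.≈-refl V) h)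
        (H.comp ⟦ τ ⟧ ⟦ σ ⟧ idᴮ θ h))
  where
  module H = Species₂ H
  open FinSet (H.obj [ n ] V) using (≈-trans; ≈-sym)

-- Sums over partitions

private
  fromℚᵘ-homo-+ : ∀ p q → fromℚᵘ (p ℚᵘ.+ q) ≡ fromℚᵘ p + fromℚᵘ q
  fromℚᵘ-homo-+ p q = ℚ.toℚᵘ-injective (ℚᵘ.≃-trans (ℚ.toℚᵘ-fromℚᵘ (p ℚᵘ.+ q))
    (ℚᵘ.≃-sym (ℚᵘ.≃-trans (ℚ.toℚᵘ-homo-+ (fromℚᵘ p) (fromℚᵘ q))
      (ℚᵘ.+-cong (ℚ.toℚᵘ-fromℚᵘ p) (ℚ.toℚᵘ-fromℚᵘ q)))))

  fromℚᵘ-homo-* : ∀ p q → fromℚᵘ (p ℚᵘ.* q) ≡ fromℚᵘ p * fromℚᵘ q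
  fromℚᵘ-homo-* p q = ℚ.toℚᵘ-injective (ℚᵘ.≃-trans (ℚ.toℚᵘ-fromℚᵘ (p ℚᵘ.* q))
    (ℚᵘ.≃-sym (ℚᵘ.≃-trans (ℚ.toℚᵘ-homo-* (fromℚᵘ p) (fromℚᵘ q))
      (ℚᵘ.*-cong (ℚ.toℚᵘ-fromℚᵘ p) (ℚ.toℚᵘ-fromℚᵘ q)))))

opaque
  ι : ℕ → ℚ
  ι n = ℤ.+ n ℚ./ 1

  -- The reciprocal, with value 0 at 0.
  inv : ℕ → ℚ
  inv zero    = 0ℚ
  inv (suc n) = ℤ.+ 1 ℚ./ suc n

  ι-def : ∀ n → ℤ.+ n ℚ./ 1 ≡ ι n
  ι-def n = refl

  /-def : ∀ a n .{{_ : NonZero n}} → ℤ.+ a ℚ./ n ≡ ι a * inv n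
  /-def a (suc n) = trans
    (ℚ.fromℚᵘ-cong {mkℚᵘ (ℤ.+ a) n} {mkℚᵘ (ℤ.+ a) 0 ℚᵘ.* mkℚᵘ (ℤ.+ 1) n}
      (*≡* (cong₂ ℤ._*_ (sym (ℤ.*-identityʳ (ℤ.+ a))) (cong (λ k → ℤ.+ suc k) (ℕ.+-identityʳ n)))))
    (fromℚᵘ-homo-* (mkℚᵘ (ℤ.+ a) 0) (mkℚᵘ (ℤ.+ 1) n))

  ι-0 : ι 0 ≡ 0ℚ
  ι-0 = refl

  ι-1 : ι 1 ≡ 1ℚ
  ι-1 = refl

  inv-1 : inv 1 ≡ 1ℚ
  inv-1 = refl

  ι-+ : ∀ m n → ι (m ℕ.+ n) ≡ ι m + ι n
  ι-+ m n = trans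
    (ℚ.fromℚᵘ-cong {mkℚᵘ (ℤ.+ (m ℕ.+ n)) 0} {mkℚᵘ (ℤ.+ m) 0 ℚᵘ.+ mkℚᵘ (ℤ.+ n) 0}
      (*≡* (cong (ℤ._* ℤ.+ 1)
        (sym (cong₂ ℤ._+_ (ℤ.*-identityʳ (ℤ.+ m)) (ℤ.*-identityʳ (ℤ.+ n)))))))
    (fromℚᵘ-homo-+ (mkℚᵘ (ℤ.+ m) 0) (mkℚᵘ (ℤ.+ n) 0))

  ι-* : ∀ m n → ι (m ℕ.* n) ≡ ι m * ι n
  ι-* m n = trans
    (ℚ.fromℚᵘ-cong {mkℚᵘ (ℤ.+ (m ℕ.* n)) 0} {mkℚᵘ (ℤ.+ m) 0 ℚᵘ.* mkℚᵘ (ℤ.+ n) 0}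
      (*≡* (cong (ℤ._* ℤ.+ 1) (ℤ.pos-* m n))))
    (fromℚᵘ-homo-* (mkℚᵘ (ℤ.+ m) 0) (mkℚᵘ (ℤ.+ n) 0))

  -- The default value of `inv 0` makes both sides vanish when a factor is 0; positive factors are
  -- multiplied as fractions.
  inv-* : ∀ m n → inv (m ℕ.* n) ≡ inv m * inv n
  inv-* zero    n    = sym (ℚ.*-zeroˡ (inv n))
  inv-* (suc m) zero = trans (cong inv (ℕ.*-zeroʳ m)) (sym (ℚ.*-zeroʳ (inv (suc m))))
  inv-* (suc m) (suc n) = fromℚᵘ-homo-* (mkℚᵘ (ℤ.+ 1) m) (mkℚᵘ (ℤ.+ 1) n)

  ι-inv : ∀ n .{{_ : NonZero n}} → ι n * inv n ≡ 1ℚ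
  ι-inv (suc n) = trans
    (sym (fromℚᵘ-homo-* (mkℚᵘ (ℤ.+ suc n) 0) (mkℚᵘ (ℤ.+ 1) n)))
    (ℚ.fromℚᵘ-cong {mkℚᵘ (ℤ.+ suc n) 0 ℚᵘ.* mkℚᵘ (ℤ.+ 1) n} {mkℚᵘ (ℤ.+ 1) 0}
      (*≡* (trans (ℤ.*-identityʳ (ℤ.+ suc n ℤ.* ℤ.+ 1)) (trans (ℤ.*-identityʳ (ℤ.+ suc n))
        (trans (cong (λ k → ℤ.+ suc k) (sym (ℕ.+-identityʳ n))) (sym (ℤ.*-identityˡ _)))))))

ι-cancel : ∀ n .{{_ : NonZero n}} {p q} → ι n * p ≡ ι n * q → p ≡ q
ι-cancel n {p} {q} e = trans (sym (undo p)) (trans (cong (inv n *_) e) (undo q))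
  where
  undo : ∀ p → inv n * (ι n * p) ≡ p
  undo p = trans (sym (ℚ.*-assoc (inv n) (ι n) p))
    (trans (cong (_* p) (trans (ℚ.*-comm (inv n) (ι n)) (ι-inv n))) (ℚ.*-identityˡ p))

-- Finite sums and power series over the rationals

opaque
  ∑< : ℕ → (ℕ → ℚ) → ℚ
  ∑< zero    f = 0ℚ
  ∑< (suc n) f = f 0 + ∑< n (f ∘ suc)

  ∑<-zero : ∀ f → ∑< 0 f ≡ 0ℚ
  ∑<-zero f = refl

  ∑<-first : ∀ n f → ∑< (suc n) f ≡ f 0 + ∑< n (f ∘ suc)
  ∑<-first n f = refl

  ∑<-cong : ∀ n {f g} → (∀ i → i < n → f i ≡ g i) → ∑< n f ≡ ∑< n g
  ∑<-cong zero    eq = refl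
  ∑<-cong (suc n) eq = cong₂ _+_ (eq 0 (s≤s z≤n)) (∑<-cong n (λ i i<n → eq (suc i) (s≤s i<n)))

  ∑<-0 : ∀ n → ∑< n (λ _ → 0ℚ) ≡ 0ℚ
  ∑<-0 zero    = refl
  ∑<-0 (suc n) = trans (ℚ.+-identityˡ _) (∑<-0 n)

  ∑<-+ : ∀ n f g → ∑< n (λ i → f i + g i) ≡ ∑< n f + ∑< n g
  ∑<-+ zero    f g = sym (ℚ.+-identityˡ 0ℚ)
  ∑<-+ (suc n) f g = trans (cong (f 0 + g 0 +_) (∑<-+ n (f ∘ suc) (g ∘ suc)))
    (solve 4 (λ a b c d → (a :+ b) :+ (c :+ d) := (a :+ c) :+ (b :+ d)) refl (f 0) (g 0) _ _)

  ∑<-*ˡ : ∀ n c f → c * ∑< n f ≡ ∑< n (λ i → c * f i)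
  ∑<-*ˡ zero    c f = ℚ.*-zeroʳ c
  ∑<-*ˡ (suc n) c f = trans (ℚ.*-distribˡ-+ c (f 0) _) (cong (c * f 0 +_) (∑<-*ˡ n c (f ∘ suc)))

  ∑<-comm : ∀ m n (f : ℕ → ℕ → ℚ) → ∑< m (λ i → ∑< n (f i)) ≡ ∑< n (λ j → ∑< m (λ i → f i j))
  ∑<-comm zero    n f = sym (∑<-0 n)
  ∑<-comm (suc m) n f = trans (cong (∑< n (f 0) +_) (∑<-comm m n (f ∘ suc)))
    (sym (∑<-+ n (f 0) (λ j → ∑< m (λ i → f (suc i) j))))

  ∑<-last : ∀ n f → ∑< (suc n) f ≡ ∑< n f + f n
  ∑<-last zero    f = ℚ.+-comm (f 0) 0ℚ
  ∑<-last (suc n) f = trans (cong (f 0 +_) (∑<-last n (f ∘ suc))) (sym (ℚ.+-assoc (f 0) _ _))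

  ∑<-extend : ∀ {m n} f → m ≤ n → (∀ i → m ≤ i → f i ≡ 0ℚ) → ∑< n f ≡ ∑< m f
  ∑<-extend {zero}  {n} f _  f≡0 = trans (∑<-cong n (λ i _ → f≡0 i z≤n)) (∑<-0 n)
  ∑<-extend {suc m} f (s≤s m≤n) f≡0 =
    cong (f 0 +_) (∑<-extend (f ∘ suc) m≤n (λ i m≤i → f≡0 (suc i) (s≤s m≤i)))

-- Multiplication of the power series ∑ₙ aₙ xⁿ by xᵏ.
shift : ℕ → (ℕ → ℚ) → ℕ → ℚ
shift zero    a n       = a n
shift (suc k) a zero    = 0ℚ
shift (suc k) a (suc n) = shift k a n

shift-cong : ∀ k {a b} n → (∀ m → k ℕ.+ m ≡ n → a m ≡ b m) → shift k a n ≡ shift k b n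
shift-cong zero    n       eq = eq n refl
shift-cong (suc k) zero    eq = refl
shift-cong (suc k) (suc n) eq = shift-cong k n (λ m e → eq m (cong suc e))

shift-∸ : ∀ k a {n} → k ≤ n → shift k a n ≡ a (n ∸ k)
shift-∸ zero    a _         = refl
shift-∸ (suc k) a (s≤s k≤n) = shift-∸ k a k≤n

shift-> : ∀ k a {n} → n < k → shift k a n ≡ 0ℚ
shift-> (suc k) a {zero}  _         = refl
shift-> (suc k) a {suc n} (s≤s n<k) = shift-> k a n<k

shift-shift : ∀ k l a n → shift k (shift l a) n ≡ shift (k ℕ.+ l) a n
shift-shift zero    l a n       = refl
shift-shift (suc k) l a zero    = refl
shift-shift (suc k) l a (suc n) = shift-shift k l a n

shift-comm : ∀ k l a n → shift k (shift l a) n ≡ shift l (shift k a) n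
shift-comm k l a n = trans (shift-shift k l a n)
  (trans (cong (λ i → shift i a n) (ℕ.+-comm k l)) (sym (shift-shift l k a n)))

-- With constant term 0, `b ∘ suc` is the series b divided by x. The condition matters at n + 1 = k,
-- where the right side is `b 0`, while the left side vanishes when k is positive.
shift-suc : ∀ k b n → b 0 ≡ 0ℚ → shift k (b ∘ suc) n ≡ shift k b (suc n)
shift-suc zero          b n       b0≡0 = refl
shift-suc (suc zero)    b zero    b0≡0 = sym b0≡0
shift-suc (suc (suc k)) b zero    b0≡0 = refl
shift-suc (suc k)       b (suc n) b0≡0 = shift-suc k b n b0≡0

shift-* : ∀ k c a n → c * shift k a n ≡ shift k (λ m → c * a m) n
shift-* zero    c a n       = refl
shift-* (suc k) c a zero    = ℚ.*-zeroʳ c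
shift-* (suc k) c a (suc n) = shift-* k c a n

shift-+ : ∀ k a b n → shift k (λ m → a m + b m) n ≡ shift k a n + shift k b n
shift-+ zero    a b n       = refl
shift-+ (suc k) a b zero    = sym (ℚ.+-identityˡ 0ℚ)
shift-+ (suc k) a b (suc n) = shift-+ k a b n

shift-∑ : ∀ k B (a : ℕ → ℕ → ℚ) n → shift k (λ m → ∑< B (λ j → a j m)) n ≡ ∑< B (λ j → shift k (a j) n)
shift-∑ zero    B a n       = refl
shift-∑ (suc k) B a zero    = sym (∑<-0 B)
shift-∑ (suc k) B a (suc n) = shift-∑ k B a n

-- The Leibniz rule for the derivation x d/dx, which multiplies the n-th coefficient by n.
shift-derivation : ∀ k a n → ι n * shift k a n ≡ shift k (λ m → ι m * a m) n + ι k * shift k a n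
shift-derivation k a n = trans (shift-* k (ι n) a n)
  (trans (shift-cong k n (λ { m refl → trans
      (cong (_* a m) (trans (ι-+ k m) (ℚ.+-comm (ι k) (ι m))))
      (ℚ.*-distribʳ-+ (a m) (ι m) (ι k)) }))
    (trans (shift-+ k (λ m → ι m * a m) (λ m → ι k * a m) n)
      (cong (shift k (λ m → ι m * a m) n +_) (sym (shift-* k (ι k) a n)))))

-- The factor of 1 / z λ contributed by the part K + 1 when its multiplicity is j.
coefficient : ℕ → ℕ → ℚ
coefficient K j = inv (suc K ^ j ℕ.* j !)

-- The sum of w λ / z λ over the partitions λ of n with all parts at most K, recursively in K
-- as in partitionsUpTo.
partitionSum : ℕ → (List ℕ → ℚ) → ℕ → ℚ
partitionSum zero    w zero    = w []
partitionSum zero    w (suc n) = 0ℚ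
partitionSum (suc K) w n       = ∑< (suc (n / suc K))
  (λ j → coefficient K j * partitionSum K (λ ps → w (replicate j (suc K) ++ ps)) (n ∸ j ℕ.* suc K))

-- If j exceeds n / (K + 1), the shift exceeds n and the term vanishes. So the range of j can be
-- enlarged to one that serves several degrees at once, which lets this sum be exchanged with other
-- sums and shifts.
partitionSum-shift : ∀ K w {n B} → n < B → partitionSum (suc K) w n ≡
  ∑< B (λ j → coefficient K j * shift (j ℕ.* suc K) (partitionSum K (λ ps → w (replicate j (suc K) ++ ps))) n)
partitionSum-shift K w {n} n<B = sym (trans
  (∑<-extend _ (ℕ.≤-trans (s≤s (ℕ.m/n≤m n (suc K))) n<B) λ j n/K<j → trans
    (cong (coefficient K j *_) (shift-> (j ℕ.* suc K) _ (ℕ.≰⇒> λ jK≤n → ℕ.<⇒≱ n/K<j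
      (subst (_≤ n / suc K) (ℕ.m*n/n≡m j (suc K)) (ℕ./-monoˡ-≤ (suc K) jK≤n)))))
    (ℚ.*-zeroʳ (coefficient K j)))
  (∑<-cong (suc (n / suc K)) λ j j≤n/K → cong (coefficient K j *_) (shift-∸ (j ℕ.* suc K) _
    (ℕ.≤-trans (ℕ.*-monoˡ-≤ (suc K) (s≤s⁻¹ j≤n/K)) (ℕ.m/n*n≤m n (suc K))))))

partitionSum-cong : ∀ K {w v} n → (∀ ps → w ps ≡ v ps) → partitionSum K w n ≡ partitionSum K v n
partitionSum-cong zero    zero    eq = eq []
partitionSum-cong zero    (suc n) eq = refl
partitionSum-cong (suc K) n       eq = ∑<-cong (suc (n / suc K)) λ j _ → cong (coefficient K j *_)
  (partitionSum-cong K (n ∸ j ℕ.* suc K) (λ ps → eq (replicate j (suc K) ++ ps)))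

partitionSum-+ : ∀ K w v n →
  partitionSum K (λ ps → w ps + v ps) n ≡ partitionSum K w n + partitionSum K v n
partitionSum-+ zero    w v zero    = refl
partitionSum-+ zero    w v (suc n) = sym (ℚ.+-identityˡ 0ℚ)
partitionSum-+ (suc K) w v n       = trans
  (∑<-cong (suc (n / suc K)) λ j _ → trans
    (cong (coefficient K j *_) (partitionSum-+ K _ _ (n ∸ j ℕ.* suc K)))
    (ℚ.*-distribˡ-+ (coefficient K j) _ _))
  (∑<-+ (suc (n / suc K)) _ _)

partitionSum-* : ∀ K c w n → partitionSum K (λ ps → c * w ps) n ≡ c * partitionSum K w n
partitionSum-* zero    c w zero    = refl
partitionSum-* zero    c w (suc n) = sym (ℚ.*-zeroʳ c)
partitionSum-* (suc K) c w n       = trans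
  (∑<-cong (suc (n / suc K)) λ j _ → trans
    (cong (coefficient K j *_) (partitionSum-* K c _ (n ∸ j ℕ.* suc K)))
    (solve 3 (λ a b d → a :* (b :* d) := b :* (a :* d)) refl (coefficient K j) c _))
  (sym (∑<-*ˡ (suc (n / suc K)) c _))

partitionSum-zero : ∀ K w → partitionSum K w 0 ≡ w []
partitionSum-zero zero    w = refl
partitionSum-zero (suc K) w = trans
  (trans (∑<-first 0 _) (trans (cong (coefficient K 0 * partitionSum K w 0 +_) (∑<-zero _)) (ℚ.+-identityʳ _)))
  (trans (cong₂ _*_ inv-1 (partitionSum-zero K w)) (ℚ.*-identityˡ (w [])))

Symmetric : (List ℕ → ℚ) → Set
Symmetric w = ∀ {ps qs} → ps ↭ qs → w ps ≡ w qs

coefficient-suc : ∀ K i → coefficient K (suc i) * ι (suc i ℕ.* suc K) ≡ coefficient K i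
coefficient-suc K i = begin
  inv (suc K ^ suc i ℕ.* suc i !) * ι (suc i ℕ.* suc K)
    ≡⟨ cong (λ k → inv k * ι (suc i ℕ.* suc K)) (rearrange (suc K) (suc K ^ i) (suc i) (i !)) ⟩
  inv ((suc K ^ i ℕ.* i !) ℕ.* (suc i ℕ.* suc K)) * ι (suc i ℕ.* suc K)
    ≡⟨ cong (_* ι (suc i ℕ.* suc K)) (inv-* (suc K ^ i ℕ.* i !) (suc i ℕ.* suc K)) ⟩
  inv (suc K ^ i ℕ.* i !) * inv (suc i ℕ.* suc K) * ι (suc i ℕ.* suc K)
    ≡⟨ ℚ.*-assoc (inv (suc K ^ i ℕ.* i !)) _ _ ⟩
  inv (suc K ^ i ℕ.* i !) * (inv (suc i ℕ.* suc K) * ι (suc i ℕ.* suc K))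
    ≡⟨ cong (inv (suc K ^ i ℕ.* i !) *_)
         (trans (ℚ.*-comm (inv (suc i ℕ.* suc K)) (ι (suc i ℕ.* suc K))) (ι-inv (suc i ℕ.* suc K))) ⟩
  inv (suc K ^ i ℕ.* i !) * 1ℚ
    ≡⟨ ℚ.*-identityʳ _ ⟩
  inv (suc K ^ i ℕ.* i !) ∎
  where
  open ≡-Reasoning
  rearrange : ∀ a b c d → a ℕ.* b ℕ.* (c ℕ.* d) ≡ b ℕ.* d ℕ.* (c ℕ.* a)
  rearrange = solve-∀

-- Removing one part k from λ divides z λ by k mₖ(λ), and the sum of k mₖ(λ) over k is n.
partitionSum-derivation : ∀ K w → Symmetric w → ∀ n →
  ι n * partitionSum K w n ≡ ∑< K (λ k → shift (suc k) (partitionSum K (λ ps → w (suc k ∷ ps))) n)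
partitionSum-derivation zero    w w-sym zero    = trans
  (trans (cong (_* w []) ι-0) (ℚ.*-zeroˡ (w []))) (sym (∑<-zero _))
partitionSum-derivation zero    w w-sym (suc n) = trans (ℚ.*-zeroʳ (ι (suc n))) (sym (∑<-zero _))
partitionSum-derivation (suc K) w w-sym n = begin
  ι n * partitionSum (suc K) w n
    ≡⟨ cong (ι n *_) (partitionSum-shift K w ℕ.≤-refl) ⟩
  ι n * ∑< (suc n) (λ j → c j * S j (a j) n)
    ≡⟨ ∑<-*ˡ (suc n) (ι n) _ ⟩
  ∑< (suc n) (λ j → ι n * (c j * S j (a j) n))
    ≡⟨ ∑<-cong (suc n) (λ j _ → leibniz j) ⟩
  ∑< (suc n) (λ j → c j * S j (λ m → ι m * a j m) n + c j * ι (j ℕ.* K′) * S j (a j) n)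
    ≡⟨ ∑<-+ (suc n) _ _ ⟩
  ∑< (suc n) (λ j → c j * S j (λ m → ι m * a j m) n) +
  ∑< (suc n) (λ j → c j * ι (j ℕ.* K′) * S j (a j) n)
    ≡⟨ cong₂ _+_ smaller largest ⟩
  ∑< K (λ k → shift (suc k) (partitionSum K′ (λ ps → w (suc k ∷ ps))) n) +
  shift K′ (partitionSum K′ (λ ps → w (K′ ∷ ps))) n
    ≡⟨ ∑<-last K _ ⟨
  ∑< K′ (λ k → shift (suc k) (partitionSum K′ (λ ps → w (suc k ∷ ps))) n) ∎
  where
  open ≡-Reasoning
  K′ = suc K
  c = coefficient K
  S : ℕ → (ℕ → ℚ) → ℕ → ℚ
  S j = shift (j ℕ.* K′)
  w′ : ℕ → List ℕ → ℚ
  w′ j ps = w (replicate j K′ ++ ps)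
  a : ℕ → ℕ → ℚ
  a j = partitionSum K (w′ j)

  leibniz : ∀ j → ι n * (c j * S j (a j) n) ≡
                  c j * S j (λ m → ι m * a j m) n + c j * ι (j ℕ.* K′) * S j (a j) n
  leibniz j = begin
    ι n * (c j * S j (a j) n)
      ≡⟨ solve 3 (λ x y z → x :* (y :* z) := y :* (x :* z)) refl (ι n) (c j) (S j (a j) n) ⟩
    c j * (ι n * S j (a j) n)
      ≡⟨ cong (c j *_) (shift-derivation (j ℕ.* K′) (a j) n) ⟩
    c j * (S j (λ m → ι m * a j m) n + ι (j ℕ.* K′) * S j (a j) n)
      ≡⟨ solve 4 (λ x y z t → x :* (y :+ z :* t) := x :* y :+ x :* z :* t) refl
           (c j) (S j (λ m → ι m * a j m) n) (ι (j ℕ.* K′)) (S j (a j) n) ⟩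
    c j * S j (λ m → ι m * a j m) n + c j * ι (j ℕ.* K′) * S j (a j) n ∎

  -- The removed part is at most K: this is the induction hypothesis with j copies of K + 1 held
  -- fixed in front. Symmetry of `w` moves the removed part before these copies, and the sum over j
  -- is then reassembled.
  smaller : ∑< (suc n) (λ j → c j * S j (λ m → ι m * a j m) n) ≡
            ∑< K (λ k → shift (suc k) (partitionSum K′ (λ ps → w (suc k ∷ ps))) n)
  smaller = begin
    ∑< (suc n) (λ j → c j * S j (λ m → ι m * a j m) n)
      ≡⟨ ∑<-cong (suc n) (λ j _ → trans
           (cong (c j *_) (trans
             (shift-cong (j ℕ.* K′) n λ m _ → trans
               (partitionSum-derivation K (w′ j) (w-sym ∘ ↭.++⁺ˡ (replicate j K′)) m)
               (∑<-cong K λ k _ → shift-cong (suc k) m λ l _ → partitionSum-cong K l λ ps →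
                 w-sym (↭.shift (suc k) (replicate j K′) ps)))
             (shift-∑ (j ℕ.* K′) K (λ k → shift (suc k) (b k j)) n)))
           (∑<-*ˡ K (c j) _)) ⟩
    ∑< (suc n) (λ j → ∑< K (λ k → c j * S j (shift (suc k) (b k j)) n))
      ≡⟨ ∑<-comm (suc n) K _ ⟩
    ∑< K (λ k → ∑< (suc n) (λ j → c j * S j (shift (suc k) (b k j)) n))
      ≡⟨ ∑<-cong K (λ k _ → trans
           (∑<-cong (suc n) (λ j _ → trans
             (cong (c j *_) (shift-comm (j ℕ.* K′) (suc k) (b k j) n))
             (shift-* (suc k) (c j) (S j (b k j)) n)))
           (trans (sym (shift-∑ (suc k) (suc n) (λ j m → c j * S j (b k j) m) n))
             (shift-cong (suc k) n λ m e → sym (partitionSum-shift K (λ ps → w (suc k ∷ ps))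
               (s≤s (ℕ.≤-trans (ℕ.m≤n+m m (suc k)) (ℕ.≤-reflexive e))))))) ⟩
    ∑< K (λ k → shift (suc k) (partitionSum K′ (λ ps → w (suc k ∷ ps))) n) ∎
    where
    b : ℕ → ℕ → ℕ → ℚ
    b k j = partitionSum K (λ ps → w (suc k ∷ w″ j ps))
      where
      w″ : ℕ → List ℕ → List ℕ
      w″ j ps = replicate j K′ ++ ps

  -- The removed part is K + 1: the j copies have total size j (K + 1), which cancels against the
  -- coefficient for j and leaves the one for j - 1. The term j = 0 drops out, and the sum is
  -- reindexed by j = i + 1.
  largest : ∑< (suc n) (λ j → c j * ι (j ℕ.* K′) * S j (a j) n) ≡
            shift K′ (partitionSum K′ (λ ps → w (K′ ∷ ps))) n
  largest = begin
    ∑< (suc n) (λ j → c j * ι (j ℕ.* K′) * S j (a j) n)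
      ≡⟨ ∑<-first n _ ⟩
    c 0 * ι 0 * S 0 (a 0) n + ∑< n (λ i → c (suc i) * ι (suc i ℕ.* K′) * S (suc i) (a (suc i)) n)
      ≡⟨ cong (_+ ∑< n (λ i → c (suc i) * ι (suc i ℕ.* K′) * S (suc i) (a (suc i)) n))
           (trans (cong (λ x → c 0 * x * S 0 (a 0) n) ι-0)
             (trans (cong (_* S 0 (a 0) n) (ℚ.*-zeroʳ (c 0))) (ℚ.*-zeroˡ (S 0 (a 0) n)))) ⟩
    0ℚ + ∑< n (λ i → c (suc i) * ι (suc i ℕ.* K′) * S (suc i) (a (suc i)) n)
      ≡⟨ ℚ.+-identityˡ _ ⟩
    ∑< n (λ i → c (suc i) * ι (suc i ℕ.* K′) * S (suc i) (a (suc i)) n)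
      ≡⟨ ∑<-cong n (λ i _ → trans
           (cong₂ _*_ (coefficient-suc K i) (sym (shift-shift K′ (i ℕ.* K′) (a (suc i)) n)))
           (shift-* K′ (c i) (S i (a (suc i))) n)) ⟩
    ∑< n (λ i → shift K′ (λ m → c i * S i (a (suc i)) m) n)
      ≡⟨ shift-∑ K′ n (λ i m → c i * S i (a (suc i)) m) n ⟨
    shift K′ (λ m → ∑< n (λ i → c i * S i (a (suc i)) m)) n
      -- Only degrees m with K + 1 + m = n matter, so m < n and the n values of `i` suffice.
      ≡⟨ shift-cong K′ n (λ m e → sym (partitionSum-shift K (λ ps → w (K′ ∷ ps))
           (ℕ.≤-trans (s≤s (ℕ.m≤n+m m K)) (ℕ.≤-reflexive e)))) ⟩
    shift K′ (partitionSum K′ (λ ps → w (K′ ∷ ps))) n ∎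

-- Sums over symmetric groups

-- A part k can be raised in k ways: at each point of the corresponding cycle.
raise : (List ℕ → ℚ) → List ℕ → ℚ
raise w []       = 0ℚ
raise w (k ∷ ks) = ι k * w (suc k ∷ ks) + raise (λ ls → w (k ∷ ls)) ks

raise-cong : ∀ {w v} → (∀ ks → w ks ≡ v ks) → ∀ ks → raise w ks ≡ raise v ks
raise-cong eq []       = refl
raise-cong eq (k ∷ ks) = cong₂ _+_ (cong (ι k *_) (eq (suc k ∷ ks))) (raise-cong (λ ls → eq (k ∷ ls)) ks)

raise-symmetric : ∀ w → Symmetric w → Symmetric (raise w)
raise-symmetric w w-sym ↭.refl = refl
raise-symmetric w w-sym (↭.prep k p) = cong₂ _+_
  (cong (ι k *_) (w-sym (↭.prep (suc k) p)))
  (raise-symmetric (λ ls → w (k ∷ ls)) (w-sym ∘ ↭.prep k) p)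
raise-symmetric w w-sym (↭.swap {ps} {qs} k l p) = trans
  (solve 3 (λ a b c → a :+ (b :+ c) := b :+ (a :+ c)) refl
    (ι k * w (suc k ∷ l ∷ ps)) (ι l * w (k ∷ suc l ∷ ps)) (raise (λ ls → w (k ∷ l ∷ ls)) ps))
  (cong₂ _+_ (cong (ι l *_) (w-sym (↭.swap k (suc l) p)))
    (cong₂ _+_ (cong (ι k *_) (w-sym (↭.swap (suc k) l p)))
      (trans (raise-cong (λ ls → w-sym (↭.swap k l ↭-refl)) ps)
        (raise-symmetric (λ ls → w (l ∷ k ∷ ls)) (w-sym ∘ ↭.prep l ∘ ↭.prep k) p))))
raise-symmetric w w-sym (↭.trans p q) = trans (raise-symmetric w w-sym p) (raise-symmetric w w-sym q)

ι-suc : ∀ n → ι (suc n) ≡ 1ℚ + ι n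
ι-suc n = trans (ι-+ 1 n) (cong (_+ ι n) ι-1)

-- The insertion recursion for sums over partitions

module _ (K : ℕ) where
  private
    P : (List ℕ → ℚ) → ℕ → ℚ
    P = partitionSum K

  -- The case n = 0, kept apart because `RaiseStep` gives the recursion only with a factor n. In
  -- degree 1 only the removal of a part 1 survives, and the empty partition has no part to raise.
  partitionSum-1 : ∀ w → Symmetric w → 1 ≤ K → ι 1 * P w 1 ≡ P (λ ps → w (1 ∷ ps)) 0 + P (raise w) 0
  partitionSum-1 w w-sym (s≤s {n = K₀} z≤n) = begin
    ι 1 * P w 1
      ≡⟨ partitionSum-derivation K w w-sym 1 ⟩
    ∑< (suc K₀) (λ k → shift (suc k) (P (λ ps → w (suc k ∷ ps))) 1)
      ≡⟨ ∑<-first K₀ _ ⟩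
    P (λ ps → w (1 ∷ ps)) 0 + ∑< K₀ (λ k → 0ℚ)
      ≡⟨ cong (P (λ ps → w (1 ∷ ps)) 0 +_) (trans (∑<-0 K₀) (sym (partitionSum-zero K (raise w)))) ⟩
    P (λ ps → w (1 ∷ ps)) 0 + P (raise w) 0 ∎
    where open ≡-Reasoning

  -- All terms are expanded by removing one part. In `A` the removed part is the raised one (`E`,
  -- where a part k + 1 has weight k since it was raised from k) or another one (`B`). In `Y` a
  -- second factor n + 1 splits by the Leibniz rule into the degree of the rest (`C`) and the size k
  -- + 1 of the removed part (`Y + E`). The hypothesis, applied to the rest of degree below n,
  -- yields `B + W ≡ C`. Cancelling one `Y` leaves the recursion multiplied by n.
  module RaiseStep (n : ℕ) (n<K : n < K)
    (hyp : ∀ {m} → m < n → ∀ w → Symmetric w →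
           ι (suc m) * P w (suc m) ≡ P (λ ps → w (1 ∷ ps)) m + P (raise w) m)
    (w : List ℕ → ℚ) (w-sym : Symmetric w) where
    open ≡-Reasoning

    Q R T : ℕ → ℕ → ℚ
    Q k = P (λ ps → w (suc k ∷ ps))
    R k = P (raise (λ ps → w (suc k ∷ ps)))
    T k = P (λ ps → w (1 ∷ suc k ∷ ps))

    S : ℕ → ℚ
    S k = shift (suc k) (Q k) (suc n)

    A B C E W Y : ℚ
    A = ι n * P (raise w) n
    B = ∑< K (λ k → shift (suc k) (R k) n)
    C = ∑< K (λ k → shift (suc k) (λ m → ι m * Q k m) (suc n))
    E = ∑< K (λ k → ι k * S k)
    W = ι n * P (λ ps → w (1 ∷ ps)) n
    Y = ι (suc n) * P w (suc n)

    A≡E+B : A ≡ E + B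
    A≡E+B = begin
      ι n * P (raise w) n
        ≡⟨ partitionSum-derivation K (raise w) (raise-symmetric w w-sym) n ⟩
      ∑< K (λ k → shift (suc k) (P (λ ps → raise w (suc k ∷ ps))) n)
        ≡⟨ ∑<-cong K (λ k _ → trans
             (shift-cong (suc k) n λ m _ → trans
               (partitionSum-+ K (λ ps → ι (suc k) * w (suc (suc k) ∷ ps)) _ m)
               (cong (_+ R k m) (partitionSum-* K (ι (suc k)) (λ ps → w (suc (suc k) ∷ ps)) m)))
             (trans (shift-+ (suc k) (λ m → ι (suc k) * Q (suc k) m) (R k) n)
               (cong (_+ shift (suc k) (R k) n) (sym (shift-* (suc k) (ι (suc k)) (Q (suc k)) n))))) ⟩
      ∑< K (λ k → ι (suc k) * S (suc k) + shift (suc k) (R k) n)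
        ≡⟨ ∑<-+ K (λ k → ι (suc k) * S (suc k)) _ ⟩
      ∑< K (λ k → ι (suc k) * S (suc k)) + B
        ≡⟨ cong (_+ B) (begin
          ∑< K (λ k → ι (suc k) * S (suc k))
            ≡⟨ trans (cong (_+ ∑< K (λ k → ι (suc k) * S (suc k)))
                 (trans (cong (_* S 0) ι-0) (ℚ.*-zeroˡ (S 0)))) (ℚ.+-identityˡ _) ⟨
          ι 0 * S 0 + ∑< K (λ k → ι (suc k) * S (suc k))
            ≡⟨ ∑<-first K (λ k → ι k * S k) ⟨
          ∑< (suc K) (λ k → ι k * S k)
            ≡⟨ ∑<-last K (λ k → ι k * S k) ⟩
          E + ι K * S K
            -- A part raised from K to K + 1 would exceed the degree n + 1, because n < K, so the
            -- top term vanishes.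
            ≡⟨ cong (E +_) (trans (cong (ι K *_) (shift-> (suc K) (Q K) (s≤s n<K))) (ℚ.*-zeroʳ (ι K))) ⟩
          E + 0ℚ
            ≡⟨ ℚ.+-identityʳ E ⟩
          E ∎) ⟩
      E + B ∎

    B+W≡C : B + W ≡ C
    B+W≡C = begin
      B + W
        ≡⟨ cong (B +_) (partitionSum-derivation K (λ ps → w (1 ∷ ps)) (w-sym ∘ ↭.prep 1) n) ⟩
      B + ∑< K (λ k → shift (suc k) (T k) n)
        ≡⟨ ∑<-+ K _ _ ⟨
      ∑< K (λ k → shift (suc k) (R k) n + shift (suc k) (T k) n)
        ≡⟨ ∑<-cong K (λ k _ → begin
          shift (suc k) (R k) n + shift (suc k) (T k) n
            ≡⟨ shift-+ (suc k) (R k) (T k) n ⟨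
          shift (suc k) (λ m → R k m + T k m) n
            ≡⟨ shift-cong (suc k) n (λ m e → begin
                 R k m + T k m
                   ≡⟨ ℚ.+-comm (R k m) (T k m) ⟩
                 T k m + R k m
                   ≡⟨ cong (_+ R k m) (partitionSum-cong K m (λ ps → w-sym (↭.swap 1 (suc k) ↭-refl))) ⟩
                 P (λ ps → w (suc k ∷ 1 ∷ ps)) m + R k m
                   ≡⟨ hyp (ℕ.≤-trans (s≤s (ℕ.m≤n+m m k)) (ℕ.≤-reflexive e))
                          (λ ps → w (suc k ∷ ps)) (w-sym ∘ ↭.prep (suc k)) ⟨
                 ι (suc m) * Q k (suc m) ∎) ⟩
          shift (suc k) (λ m → ι (suc m) * Q k (suc m)) n
            ≡⟨ shift-suc (suc k) (λ m → ι m * Q k m) n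
                 (trans (cong (_* Q k 0) ι-0) (ℚ.*-zeroˡ (Q k 0))) ⟩
          shift (suc k) (λ m → ι m * Q k m) (suc n) ∎) ⟩
      C ∎

    Y≡∑S : Y ≡ ∑< K S
    Y≡∑S = partitionSum-derivation K w w-sym (suc n)

    ι-suc-Y : ι (suc n) * Y ≡ C + (Y + E)
    ι-suc-Y = begin
      ι (suc n) * Y
        ≡⟨ cong (ι (suc n) *_) Y≡∑S ⟩
      ι (suc n) * ∑< K S
        ≡⟨ ∑<-*ˡ K (ι (suc n)) S ⟩
      ∑< K (λ k → ι (suc n) * S k)
        ≡⟨ ∑<-cong K (λ k _ → trans (shift-derivation (suc k) (Q k) (suc n))
             (cong (shift (suc k) (λ m → ι m * Q k m) (suc n) +_)
               (trans (cong (_* S k) (ι-suc k))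
                 (trans (ℚ.*-distribʳ-+ (S k) 1ℚ (ι k)) (cong (_+ ι k * S k) (ℚ.*-identityˡ (S k))))))) ⟩
      ∑< K (λ k → shift (suc k) (λ m → ι m * Q k m) (suc n) + (S k + ι k * S k))
        ≡⟨ trans (∑<-+ K _ _) (cong (C +_) (∑<-+ K S _)) ⟩
      C + (∑< K S + E)
        ≡⟨ cong (λ y → C + (y + E)) Y≡∑S ⟨
      C + (Y + E) ∎

    step : ι n * Y ≡ ι n * (P (λ ps → w (1 ∷ ps)) n + P (raise w) n)
    step = +-cancelʳ Y _ _ (begin
      ι n * Y + Y
        ≡⟨ solve 2 (λ a y → a :* y :+ y := (con 1ℚ :+ a) :* y) refl (ι n) Y ⟩
      (1ℚ + ι n) * Y
        ≡⟨ cong (_* Y) (ι-suc n) ⟨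
      ι (suc n) * Y
        ≡⟨ ι-suc-Y ⟩
      C + (Y + E)
        ≡⟨ cong (_+ (Y + E)) B+W≡C ⟨
      B + W + (Y + E)
        ≡⟨ solve 4 (λ b w y e → b :+ w :+ (y :+ e) := w :+ (e :+ b) :+ y) refl B W Y E ⟩
      W + (E + B) + Y
        ≡⟨ cong (λ a → W + a + Y) A≡E+B ⟨
      W + A + Y
        ≡⟨ cong (_+ Y) (ℚ.*-distribˡ-+ (ι n) _ _) ⟨
      ι n * (P (λ ps → w (1 ∷ ps)) n + P (raise w) n) + Y ∎)

  -- Strong induction for all symmetric `w` together, because the hypothesis is used with one part
  -- of the argument of `w` held fixed. The bound K is the same in both degrees and at least n + 1,
  -- so raising a part never leaves the range.
  partitionSum-raise : ∀ {n} → n < K → ∀ w → Symmetric w →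
    ι (suc n) * P w (suc n) ≡ P (λ ps → w (1 ∷ ps)) n + P (raise w) n
  partitionSum-raise {n} = go (suc n) ℕ.≤-refl
    where
    -- The bound `b` decreases structurally and makes every degree below n available.
    go : ∀ b {n} → n < b → n < K → ∀ w → Symmetric w →
         ι (suc n) * P w (suc n) ≡ P (λ ps → w (1 ∷ ps)) n + P (raise w) n
    go (suc b) {zero}  _         0<K w w-sym = partitionSum-1 w w-sym 0<K
    go (suc b) {suc n} (s≤s n<b) n<K w w-sym = ι-cancel (suc n)
      (RaiseStep.step (suc n) n<K
        (λ m<n → go b (ℕ.<-≤-trans m<n n<b) (ℕ.<-trans m<n n<K)) w w-sym)

-- The k + 1 points of the first block all yield the same conjugacy class, that of the lengthened
-- cycle. For the other points the induction hypothesis is used with `h` precomposed by adding the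
-- first block.
∑-insertAt-suc : (h : ∀ {n} → Permutation′ n → ℕ) → Invariant h → ∀ ks →
  ι (∑ [ sum ks ] (λ x → h (insertAt (suc x) (cycles ks)))) ≡ raise (λ ls → ι (h (cycles ls))) ks
∑-insertAt-suc h h-inv []          = trans (cong ι (∑-Fin 0 _)) ι-0
-- An entry 0 has no points to insert at, which agrees with its weight 0 in `raise`.
∑-insertAt-suc h h-inv (zero ∷ ks) = trans (∑-insertAt-suc h h-inv ks) (sym
  (trans (cong (λ x → x * ι (h (cycles (1 ∷ ks))) + raise (λ ls → ι (h (cycles ls))) ks) ι-0)
    (trans (cong (_+ raise (λ ls → ι (h (cycles ls))) ks) (ℚ.*-zeroˡ (ι (h (cycles (1 ∷ ks))))))
      (ℚ.+-identityˡ _))))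
∑-insertAt-suc h h-inv (suc k ∷ ks) = begin
  ι (∑ [ suc k ℕ.+ sum ks ] f)
    ≡⟨ cong ι (∑-++ (suc k) (sum ks) f) ⟩
  ι (∑ [ suc k ] (λ i → f (i ↑ˡ sum ks)) ℕ.+ ∑ [ sum ks ] (λ j → f (suc k ↑ʳ j)))
    ≡⟨ ι-+ (∑ [ suc k ] (λ i → f (i ↑ˡ sum ks))) _ ⟩
  ι (∑ [ suc k ] (λ i → f (i ↑ˡ sum ks))) + ι (∑ [ sum ks ] (λ j → f (suc k ↑ʳ j)))
    ≡⟨ cong₂ _+_
         (trans (cong ι (trans
             (∑-cong [ suc k ] λ i → trans (h-inv (insertAt-↑ˡ k (cycles ks) i)) (sym (ℕ.*-identityˡ v)))
             (trans (sym (∑-*ʳ [ suc k ] v (λ _ → 1))) (cong (ℕ._* v) (∑-1 [ suc k ])))))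
           (ι-* (suc k) v))
         (trans (cong ι (∑-cong [ sum ks ] λ j → h-inv (insertAt-↑ʳ (rotation k) (cycles ks) j)))
           (∑-insertAt-suc (λ ρ → h (rotation k ⊕ ρ))
             (λ c → h-inv (⊕-cong {σ = rotation k} ∼-refl c)) ks)) ⟩
  ι (suc k) * ι v + raise (λ ls → ι (h (cycles (suc k ∷ ls)))) ks ∎
  where
  open ≡-Reasoning
  f : Fin (suc k ℕ.+ sum ks) → ℕ
  f x = h (insertAt (suc x) (cycles (suc k ∷ ks)))
  v = h (cycles (suc (suc k) ∷ ks))

∑-insertAt : (h : ∀ {n} → Permutation′ n → ℕ) → Invariant h → ∀ ks →
  let w = λ ls → ι (h (cycles ls)) in
  ι (∑ [ suc (sum ks) ] (λ j → h (insertAt j (cycles ks)))) ≡ w (1 ∷ ks) + raise w ks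
∑-insertAt h h-inv ks = trans
  (trans (cong ι (∑-suc (sum ks) (λ j → h (insertAt j (cycles ks))))) (ι-+ (h (insertAt zero (cycles ks))) _))
  (cong₂ _+_ (cong ι (h-inv (insertAt-zero (cycles ks)))) (∑-insertAt-suc h h-inv ks))

-- The class of cycle type λ in the symmetric group has n! / z λ elements.
∑-𝔖 : ∀ K n → n ≤ K → (h : ∀ {n} → Permutation′ n → ℕ) → Invariant h →
      ι (∑ (𝔖 n) h) ≡ ι (n !) * partitionSum K (λ ks → ι (h (cycles ks))) n
∑-𝔖 K zero _ h h-inv = begin
  ι (∑ (𝔖 0) h)
    ≡⟨ cong ι (trans
         (∑-cong (𝔖 0) (λ σ → trans (h-inv (≈⇒∼ {σ = σ} {Perm.id} (λ ()))) (sym (ℕ.*-identityˡ _))))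
         (trans (sym (∑-*ʳ (𝔖 0) (h (cycles [])) (λ _ → 1)))
           (trans (cong (ℕ._* h (cycles [])) (∑-1 (𝔖 0))) (ℕ.*-identityˡ _)))) ⟩
  ι (h (cycles []))
    ≡⟨ trans (cong (_* ι (h (cycles []))) ι-1) (ℚ.*-identityˡ _) ⟨
  ι 1 * ι (h (cycles []))
    ≡⟨ cong (ι 1 *_) (partitionSum-zero K (λ ks → ι (h (cycles ks)))) ⟨
  ι 1 * partitionSum K (λ ks → ι (h (cycles ks))) 0 ∎
  where open ≡-Reasoning
∑-𝔖 K (suc n) n<K h h-inv = begin
  ι (∑ (𝔖 (suc n)) h)
    ≡⟨ cong ι (∑-𝔖-suc n h h-inv) ⟩
  ι (∑ (𝔖 n) (λ π → ∑ [ suc n ] (λ j → h (insertAt j π))))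
    -- The induction hypothesis is applied to the sum of `h` over all n + 1 insertions, again a
    -- class function. K stays fixed while n decreases, as the recursion for partitions relates sums
    -- with one common bound.
    ≡⟨ ∑-𝔖 K n (ℕ.<⇒≤ n<K) (λ {n} π → ∑ [ suc n ] (λ j → h (insertAt j π))) (∑-insertAt-invariant h h-inv) ⟩
  ι (n !) * partitionSum K (λ ks → ι (∑ [ suc (sum ks) ] (λ j → h (insertAt j (cycles ks))))) n
    ≡⟨ cong (ι (n !) *_) (trans (partitionSum-cong K n (∑-insertAt h h-inv))
         (partitionSum-+ K (λ ks → w (1 ∷ ks)) (raise w) n)) ⟩
  ι (n !) * (partitionSum K (λ ks → w (1 ∷ ks)) n + partitionSum K (raise w) n)
    ≡⟨ cong (ι (n !) *_) (partitionSum-raise K n<K w (λ p → cong ι (h-inv (cycles-↭ p)))) ⟨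
  ι (n !) * (ι (suc n) * partitionSum K w (suc n))
    ≡⟨ solve 3 (λ a b c → a :* (b :* c) := (b :* a) :* c) refl (ι (n !)) (ι (suc n)) _ ⟩
  ι (suc n) * ι (n !) * partitionSum K w (suc n)
    ≡⟨ cong (_* partitionSum K w (suc n)) (ι-* (suc n) (n !)) ⟨
  ι (suc n !) * partitionSum K w (suc n) ∎
  where
  open ≡-Reasoning
  w : List ℕ → ℚ
  w ks = ι (h (cycles ks))

-- The cycle index of the inner plethysm

sumOver : ∀ {A : Set} → List A → (A → ℚ) → ℚ
sumOver []       f = 0ℚ
sumOver (x ∷ xs) f = f x + sumOver xs f

sumOver-cong : ∀ {A : Set} (xs : List A) {f g} → (∀ x → f x ≡ g x) → sumOver xs f ≡ sumOver xs g
sumOver-cong []       eq = refl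
sumOver-cong (x ∷ xs) eq = cong₂ _+_ (eq x) (sumOver-cong xs eq)

sumOver-*ˡ : ∀ {A : Set} (xs : List A) c f → sumOver xs (λ x → c * f x) ≡ c * sumOver xs f
sumOver-*ˡ []       c f = sym (ℚ.*-zeroʳ c)
sumOver-*ˡ (x ∷ xs) c f = trans (cong (c * f x +_) (sumOver-*ˡ xs c f)) (sym (ℚ.*-distribˡ-+ c (f x) _))

sumOver-map : ∀ {A B : Set} (g : A → B) xs f → sumOver (map g xs) f ≡ sumOver xs (f ∘ g)
sumOver-map g []       f = refl
sumOver-map g (x ∷ xs) f = cong (f (g x) +_) (sumOver-map g xs f)

sumOver-++ : ∀ {A : Set} (xs ys : List A) f → sumOver (xs ++ ys) f ≡ sumOver xs f + sumOver ys f
sumOver-++ []       ys f = sym (ℚ.+-identityˡ _)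
sumOver-++ (x ∷ xs) ys f = trans (cong (f x +_) (sumOver-++ xs ys f)) (sym (ℚ.+-assoc (f x) _ _))

sumOver-concatMap : ∀ {A B : Set} (g : A → List B) xs f →
                    sumOver (concatMap g xs) f ≡ sumOver xs (λ x → sumOver (g x) f)
sumOver-concatMap g []       f = refl
sumOver-concatMap g (x ∷ xs) f = trans (sumOver-++ (g x) (concatMap g xs) f)
  (cong (sumOver (g x) f +_) (sumOver-concatMap g xs f))

sumOver-applyUpTo : ∀ (g : ℕ → ℕ) n f → sumOver (applyUpTo g n) f ≡ ∑< n (f ∘ g)
sumOver-applyUpTo g zero    f = sym (∑<-zero _)
sumOver-applyUpTo g (suc n) f = trans (cong (f (g 0) +_) (sumOver-applyUpTo (g ∘ suc) n f))
  (sym (∑<-first n (f ∘ g)))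

sumOver-upTo : ∀ n f → sumOver (upTo n) f ≡ ∑< n f
sumOver-upTo = sumOver-applyUpTo (λ i → i)

-- The factors of z

occurrences-++ : ∀ k ps qs → occurrences k (ps ++ qs) ≡ occurrences k ps ℕ.+ occurrences k qs
occurrences-++ k ps qs = trans (cong length (List.filter-++ (k ℕ.≟_) ps qs))
  (List.length-++ (filter (k ℕ.≟_) ps))

occurrences-replicate : ∀ j k → occurrences k (replicate j k) ≡ j
occurrences-replicate zero    k = refl
occurrences-replicate (suc j) k = trans (cong length (List.filter-accept (k ℕ.≟_) refl))
  (cong suc (occurrences-replicate j k))

occurrences-none : ∀ {ps k} → All (k ≢_) ps → occurrences k ps ≡ 0
occurrences-none {k = k} k∉ = cong length (List.filter-none (k ℕ.≟_) k∉)

zFactor : List ℕ → ℕ → ℕ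
zFactor ps i = suc i ^ occurrences (suc i) ps ℕ.* occurrences (suc i) ps !

-- A truncation of `z` by part size instead of by the size of the partition, so that it follows the
-- recursion of `partitionsUpTo` in K.
zUpTo : ℕ → List ℕ → ℕ
zUpTo zero    ps = 1
zUpTo (suc K) ps = zUpTo K ps ℕ.* zFactor ps K

product-upTo : ∀ K ps → product (map (zFactor ps) (upTo K)) ≡ zUpTo K ps
product-upTo zero    ps = refl
product-upTo (suc K) ps = begin
  product (map (zFactor ps) (upTo (suc K)))           ≡⟨ cong (product ∘ map (zFactor ps)) (List.upTo-∷ʳ K) ⟨
  product (map (zFactor ps) (upTo K ∷ʳ K))            ≡⟨ cong product (List.map-++ (zFactor ps) (upTo K) (K ∷ [])) ⟩
  product (map (zFactor ps) (upTo K) ∷ʳ zFactor ps K) ≡⟨ product-++ (map (zFactor ps) (upTo K)) (zFactor ps K ∷ []) ⟩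
  product (map (zFactor ps) (upTo K)) ℕ.* (zFactor ps K ℕ.* 1)
    ≡⟨ cong₂ ℕ._*_ (product-upTo K ps) (ℕ.*-identityʳ (zFactor ps K)) ⟩
  zUpTo K ps ℕ.* zFactor ps K ∎
  where open ≡-Reasoning

zUpTo-bounded : ∀ {K L ps} → All (_≤ K) ps → K ≤ L → zUpTo L ps ≡ zUpTo K ps
zUpTo-bounded {L = L} bd K≤L with ℕ.m≤n⇒m<n∨m≡n K≤L
... | inj₂ refl = refl
zUpTo-bounded {L = suc L} {ps} bd K≤L | inj₁ (s≤s K≤L′) = trans
  (cong (λ j → zUpTo L ps ℕ.* (suc L ^ j ℕ.* j !))
    (occurrences-none (All.map (λ { p≤K refl → ℕ.<⇒≱ (s≤s K≤L′) p≤K }) bd)))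
  (trans (ℕ.*-identityʳ (zUpTo L ps)) (zUpTo-bounded bd K≤L′))

zUpTo-replicate : ∀ {K L} j ps → K ≤ L → zUpTo K (replicate j (suc L) ++ ps) ≡ zUpTo K ps
zUpTo-replicate {zero}      j ps K≤L = refl
zUpTo-replicate {suc K} {L} j ps K<L = cong₂ ℕ._*_ (zUpTo-replicate j ps (ℕ.<⇒≤ K<L))
  (cong (λ i → suc K ^ i ℕ.* i !) (trans (occurrences-++ (suc K) (replicate j (suc L)) ps)
    (cong (ℕ._+ occurrences (suc K) ps)
      (occurrences-none (All.replicate⁺ j (λ e → ℕ.<⇒≢ K<L (ℕ.suc-injective e)))))))

-- The bound is an irrelevant field; it is recovered because it is decidable.
partsBounded : ∀ {K} (p : PartsUpTo K) → All (_≤ K) (parts (PartsUpTo.toPartition p))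
partsBounded {K} (upTo≤ λs bounded) = recompute (All.all? (ℕ._≤? K) (parts λs)) bounded

partsPositive : ∀ λs → All NonZero (parts λs)
partsPositive (partition ps positive _) = recompute (All.all? ℕ.nonZero? ps) positive

zUpTo-addParts : ∀ K j (p : PartsUpTo K) → let ps = parts (PartsUpTo.toPartition p) in
                 inv (zUpTo (suc K) (replicate j (suc K) ++ ps)) ≡ coefficient K j * inv (zUpTo K ps)
zUpTo-addParts K j p = trans
  (cong inv (trans
    (cong₂ (λ a i → a ℕ.* (suc K ^ i ℕ.* i !)) (zUpTo-replicate {K} {K} j ps ℕ.≤-refl) (begin
      occurrences (suc K) (replicate j (suc K) ++ ps)
        ≡⟨ occurrences-++ (suc K) (replicate j (suc K)) ps ⟩
      occurrences (suc K) (replicate j (suc K)) ℕ.+ occurrences (suc K) ps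
        ≡⟨ cong₂ ℕ._+_ (occurrences-replicate j (suc K))
             (occurrences-none (All.map (λ { p≤K refl → ℕ.<⇒≱ ℕ.≤-refl p≤K }) (partsBounded p))) ⟩
      j ℕ.+ 0
        ≡⟨ ℕ.+-identityʳ j ⟩
      j ∎))
    (ℕ.*-comm (zUpTo K ps) (suc K ^ j ℕ.* j !))))
  (inv-* (suc K ^ j ℕ.* j !) (zUpTo K ps))
  where
  open ≡-Reasoning
  ps = parts (PartsUpTo.toPartition p)

sumOver-partitionsUpTo : ∀ K n (w : List ℕ → ℚ) →
  sumOver (partitionsUpTo K n) (λ p → let ps = parts (PartsUpTo.toPartition p) in w ps * inv (zUpTo K ps)) ≡
  partitionSum K w n
sumOver-partitionsUpTo zero zero w = trans (ℚ.+-identityʳ _)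
  (trans (cong (w [] *_) inv-1) (ℚ.*-identityʳ (w [])))
sumOver-partitionsUpTo zero (suc n) w = refl
sumOver-partitionsUpTo (suc K) n w = begin
  sumOver (concatMap (λ j → map (addParts K j) (rest j)) (upTo top)) (term (suc K) w)
    ≡⟨ sumOver-concatMap (λ j → map (addParts K j) (rest j)) (upTo top) (term (suc K) w) ⟩
  sumOver (upTo top) (λ j → sumOver (map (addParts K j) (rest j)) (term (suc K) w))
    ≡⟨ sumOver-upTo top _ ⟩
  ∑< top (λ j → sumOver (map (addParts K j) (rest j)) (term (suc K) w))
    ≡⟨ ∑<-cong top (λ j _ → begin
      sumOver (map (addParts K j) (rest j)) (term (suc K) w)
        ≡⟨ sumOver-map (addParts K j) (rest j) (term (suc K) w) ⟩
      sumOver (rest j) (λ p → term (suc K) w (addParts K j p))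
        ≡⟨ sumOver-cong (rest j) (λ p → trans
             (cong (w′ j (parts (PartsUpTo.toPartition p)) *_) (zUpTo-addParts K j p))
             (solve 3 (λ a b c → a :* (b :* c) := b :* (a :* c)) refl
               (w′ j (parts (PartsUpTo.toPartition p))) (coefficient K j) _)) ⟩
      sumOver (rest j) (λ p → coefficient K j * term K (w′ j) p)
        ≡⟨ sumOver-*ˡ (rest j) (coefficient K j) (term K (w′ j)) ⟩
      coefficient K j * sumOver (rest j) (term K (w′ j))
        ≡⟨ cong (coefficient K j *_) (sumOver-partitionsUpTo K (n ∸ j ℕ.* suc K) (w′ j)) ⟩
      coefficient K j * partitionSum K (w′ j) (n ∸ j ℕ.* suc K) ∎) ⟩
  partitionSum (suc K) w n ∎
  where
  open ≡-Reasoning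
  top = suc (n / suc K)
  rest : ℕ → List (PartsUpTo K)
  rest j = partitionsUpTo K (n ∸ j ℕ.* suc K)
  w′ : ℕ → List ℕ → ℚ
  w′ j ps = w (replicate j (suc K) ++ ps)
  term : ∀ K → (List ℕ → ℚ) → PartsUpTo K → ℚ
  term K w p = w (parts (PartsUpTo.toPartition p)) * inv (zUpTo K (parts (PartsUpTo.toPartition p)))

-- `z` takes its factors up to the size of the partition and `zUpTo n` up to n. No part exceeds
-- either number, and the factors beyond the largest part are 1, so the two products agree.
sumOver-partitions : ∀ n (w : List ℕ → ℚ) →
  sumOver (partitions n) (λ λs → w (parts λs) * inv (z λs)) ≡ partitionSum n w n
sumOver-partitions n w = trans
  (sumOver-map PartsUpTo.toPartition (partitionsUpTo n n) (λ λs → w (parts λs) * inv (z λs)))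
  (trans (sumOver-cong (partitionsUpTo n n) λ p → cong (λ k → w (parts (PartsUpTo.toPartition p)) * inv k)
      (trans (product-upTo (sum (parts (PartsUpTo.toPartition p))) (parts (PartsUpTo.toPartition p)))
        (independent (parts≤sum _) (partsBounded p) (ℕ.≤-total _ n))))
    (sumOver-partitionsUpTo n n w))
  where
  independent : ∀ {K L ps} → All (_≤ K) ps → All (_≤ L) ps → K ≤ L ⊎ L ≤ K → zUpTo K ps ≡ zUpTo L ps
  independent ≤K ≤L (inj₁ K≤L) = sym (zUpTo-bounded ≤K K≤L)
  independent ≤K ≤L (inj₂ L≤K) = zUpTo-bounded ≤L L≤K

-- Values of class functions and comparison of the two sides

value-sumᶜ : ∀ {n} {A : Set} (c : A → CF n) xs σ →
             value (sumᶜ (map c xs)) σ ≡ sumOver xs (λ x → value (c x) σ)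
value-sumᶜ c []       σ = refl
value-sumᶜ c (x ∷ xs) σ = cong (value (c x) σ +_) (value-sumᶜ c xs σ)

value-powerSum : ∀ {n} (χ : CF n) σ (f : ℕ → ℕ) → (∀ k → value χ (σ ^ₚ k) ≡ ι (f k)) → ∀ ks →
                 value (productᶜ (map (λ k → ψ k χ) ks)) σ ≡ ι (product (map f ks))
value-powerSum χ σ f eq []       = sym ι-1
value-powerSum χ σ f eq (k ∷ ks) = trans (cong₂ _*_ (eq k) (value-powerSum χ σ f eq ks))
  (sym (ι-* (f k) (product (map f ks))))

Z-def : ∀ F λs → Z F λs ≡ ι (fix F λs) * inv (z λs)
Z-def F λs = /-def (fix F λs) (z λs) {{z≢0 λs}}

-- The factor z cancels the denominator in the cycle index and leaves the count at the
-- representative of the cycle type of σ, which is conjugate to σ.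
classFunction-Z : ∀ G {n} (σ : Permutation′ n) →
                  value (classFunction (Z G) n) σ ≡ ι (fixedPoints (Species.hom G ⟦ σ ⟧))
classFunction-Z G σ = begin
  Z G μ * (ℤ.+ z μ ℚ./ 1)              ≡⟨ cong₂ _*_ (Z-def G μ) (ι-def (z μ)) ⟩
  ι (fix G μ) * inv (z μ) * ι (z μ)    ≡⟨ ℚ.*-assoc (ι (fix G μ)) _ _ ⟩
  ι (fix G μ) * (inv (z μ) * ι (z μ))  ≡⟨ cong (ι (fix G μ) *_) (trans (ℚ.*-comm (inv (z μ)) _) (ι-inv (z μ) {{z≢0 μ}})) ⟩
  ι (fix G μ) * 1ℚ                     ≡⟨ ℚ.*-identityʳ _ ⟩
  ι (fix G μ)                          ≡⟨ cong ι (fixedPoints-invariant G (ofType-cycleType σ)) ⟩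
  ι (fixedPoints (Species.hom G ⟦ σ ⟧)) ∎
  where
  open ≡-Reasoning
  μ = cycleType σ

module _ (F G : Species) (fin : StrictlyFinite F) {n : ℕ} (τ : Permutation′ n) where
  private
    N = proj₁ fin
    α = Species.hom G ⟦ τ ⟧
    χ = classFunction (Z G) n
    open Burnside F (Φ G) fin ⟦ τ ⟧

    weight : ∀ {m} → Permutation′ m → ℕ
    weight σ = fixedPoints (Species.hom F ⟦ σ ⟧) ℕ.* fixedPoints (Species₂.hom (Φ G) ⟦ σ ⟧ ⟦ τ ⟧)

    weight-invariant : Invariant weight
    weight-invariant c = cong₂ ℕ._*_ (fixedPoints-invariant F c) (fixedPoints₂-invariant (Φ G) ⟦ τ ⟧ c)

    w : List ℕ → ℚ
    w ks = ι (weight (cycles ks))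

  fixedOfDegree-sum : ∀ m → ι (fixedOfDegree m) ≡ partitionSum m w m
  fixedOfDegree-sum m = ι-cancel (m !) {{m ℕ.!≢0}} (begin
    ι (m !) * ι (fixedOfDegree m)  ≡⟨ ι-* (m !) (fixedOfDegree m) ⟨
    ι (m ! ℕ.* fixedOfDegree m)    ≡⟨ cong ι (burnside m) ⟩
    ι (∑ (𝔖 m) weight)             ≡⟨ ∑-𝔖 m m ℕ.≤-refl weight weight-invariant ⟩
    ι (m !) * partitionSum m w m   ∎)
    where open ≡-Reasoning

  powerSum-Z : ∀ λs → value (powerSum λs χ) τ ≡
               ι (fixedPoints (Species₂.hom (Φ G) ⟦ ofType λs ⟧ ⟦ τ ⟧))
  powerSum-Z λs = begin
    value (powerSum λs χ) τ
      ≡⟨ value-powerSum χ τ (λ k → fixedPoints (α ^ᴮ k))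
           (λ k → trans (classFunction-Z G (τ ^ₚ k))
             (cong ι (fixedPoints-cong {f = Species.hom G ⟦ τ ^ₚ k ⟧} {α ^ᴮ k} (hom-^ G τ k)))) (parts λs) ⟩
    ι (product (map (λ k → fixedPoints (α ^ᴮ k)) (parts λs)))
      ≡⟨ cong ι (equivariants-cycles α (partsPositive λs)) ⟨
    ι (equivariants α (ofType λs))
      ≡⟨ cong ι (fixedPoints-Φ G (ofType λs) ⟦ τ ⟧) ⟨
    ι (fixedPoints (Species₂.hom (Φ G) ⟦ ofType λs ⟧ ⟦ τ ⟧)) ∎
    where open ≡-Reasoning

  fixedPoints-⊠ : ι (fixedPoints (Species.hom (F ⊠[ fin ] G) ⟦ τ ⟧)) ≡
                  value (Z F [ Z-bounded F fin ]⟨ χ ⟩) τ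
  fixedPoints-⊠ = begin
    ι (fixedPoints τ*)
      ≡⟨ cong ι fixedPoints-τ* ⟩
    ι (∑ [ suc N ] (λ i → fixedOfDegree (toℕ i)))
      ≡⟨ ι-∑ (suc N) fixedOfDegree ⟩
    ∑< (suc N) (λ m → ι (fixedOfDegree m))
      ≡⟨ ∑<-cong (suc N) (λ m _ → begin
        ι (fixedOfDegree m)
          ≡⟨ fixedOfDegree-sum m ⟩
        partitionSum m w m
          ≡⟨ sumOver-partitions m w ⟨
        sumOver (partitions m) (λ λs → w (parts λs) * inv (z λs))
          ≡⟨ sumOver-cong (partitions m) (λ λs → begin
            w (parts λs) * inv (z λs)
              ≡⟨ cong (_* inv (z λs)) (ι-* (fix F λs) _) ⟩
            ι (fix F λs) * ι (fixedPoints (Species₂.hom (Φ G) ⟦ ofType λs ⟧ ⟦ τ ⟧)) * inv (z λs)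
              ≡⟨ solve 3 (λ a b c → a :* b :* c := a :* c :* b) refl
                   (ι (fix F λs)) (ι (fixedPoints (Species₂.hom (Φ G) ⟦ ofType λs ⟧ ⟦ τ ⟧))) (inv (z λs)) ⟩
            ι (fix F λs) * inv (z λs) * ι (fixedPoints (Species₂.hom (Φ G) ⟦ ofType λs ⟧ ⟦ τ ⟧))
              ≡⟨ cong₂ _*_ (Z-def F λs) (powerSum-Z λs) ⟨
            term λs ∎) ⟩
        sumOver (partitions m) term ∎) ⟩
    ∑< (suc N) (λ m → sumOver (partitions m) term)
      ≡⟨ sumOver-upTo (suc N) _ ⟨
    sumOver (upTo (suc N)) (λ m → sumOver (partitions m) term)
      ≡⟨ sumOver-concatMap partitions (upTo (suc N)) term ⟨
    sumOver (concatMap partitions (upTo (suc N))) term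
      ≡⟨ value-sumᶜ (λ λs → constᶜ (Z F λs) *ᶜ powerSum λs χ) (concatMap partitions (upTo (suc N))) τ ⟨
    value (Z F [ Z-bounded F fin ]⟨ χ ⟩) τ ∎
    where
    open ≡-Reasoning
    term : Partition → ℚ
    term λs = Z F λs * value (powerSum λs χ) τ
    ι-∑ : ∀ n (f : ℕ → ℕ) → ι (∑ [ n ] (λ i → f (toℕ i))) ≡ ∑< n (λ i → ι (f i))
    ι-∑ zero    f = trans (cong ι (∑-Fin 0 _)) (trans ι-0 (sym (∑<-zero _)))
    ι-∑ (suc n) f = trans (cong ι (∑-suc n (λ i → f (toℕ i)))) (trans (ι-+ (f 0) _)
      (trans (cong (ι (f 0) +_) (ι-∑ n (f ∘ suc))) (sym (∑<-first n (λ i → ι (f i))))))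

-- Stated for an arbitrary species: for F ⊠ G the type checker would unfold both sides.
fix-fixedPoints : ∀ F μ → fix F μ ≡ fixedPoints (Species.hom F ⟦ ofType μ ⟧)
fix-fixedPoints F μ = refl

fix-⊠ : ∀ F G fin μ → ι (fix (F ⊠[ fin ] G) μ) ≡
  value (Z F [ Z-bounded F fin ]⟨ classFunction (Z G) (Partition.size μ) ⟩) (ofType μ)
fix-⊠ F G fin μ =
  trans (cong ι (fix-fixedPoints (F ⊠[ fin ] G) μ)) (fixedPoints-⊠ F G fin (ofType μ))

1/z : ∀ μ → ℚ._/_ (ℤ.+ 1) (z μ) {{z≢0 μ}} ≡ inv (z μ)
1/z μ = trans (/-def 1 (z μ) {{z≢0 μ}}) (trans (cong (_* inv (z μ)) ι-1) (ℚ.*-identityˡ (inv (z μ))))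

theorem2p12 : (F G : Species) (fin : StrictlyFinite F) →
    Z (F ⊠[ fin ] G) ≈ˢ Z F ⊠ˢ[ Z-bounded F fin ] Z G
theorem2p12 F G fin μ = trans (Z-def (F ⊠[ fin ] G) μ) (cong₂ _*_ (fix-⊠ F G fin μ) (sym (1/z μ)))
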